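{- For each countable limit ordinal $\lambda$ there is a countable linear order whose Scott complexity is $\Sigma_{\lambda+1}$.
   Context: All structures are countable. A Scott sentence for a countable structure $\mathcal{A}$ is a sentence $\varphi$ of $\mathcal{L}_{\omega_1\omega}$ such that for every countable $\mathcal{B}$, $\mathcal{B}\models\varphi$ iff $\mathcal{B}\cong\mathcal{A}$. The Scott complexity of $\mathcal{A}$ is the least complexity, among the infinitary classes $\Sigma_\alpha$, d-$\Sigma_\alpha$ (a conjunction of a $\Sigma_\alpha$ and a $\Pi_\alpha$ sentence) and $\Pi_\alpha$, of a Scott sentence for $\mathcal{A}$. -}

module Defs where

open import Data.Nat using (ℕ; zero; suc)
open import Data.Fin using (Fin) renaming (zero to fz; suc to fs)
open import Data.Vec using (Vec; []; _∷_; lookup)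
open import Data.Product using (Σ; ∃; _×_; _,_)
open import Data.Sum using (_⊎_)
open import Data.Unit using (⊤)
open import Data.Empty using (⊥)
open import Relation.Nullary using (¬_)
open import Relation.Binary.PropositionalEquality using (_≡_)
open import Relation.Binary.Structures using (IsStrictTotalOrder)
open import Function.Definitions using (Injective)
open import Function.Bundles using (_↔_; Inverse; _⇔_)

-- Countable ordinals as Brouwer trees, with the usual (extensional) order

data Ord : Set where
  ozero : Ord
  osuc  : Ord → Ord
  olim  : (ℕ → Ord) → Ord

mutual
  _≤ₒ_ : Ord → Ord → Set
  ozero  ≤ₒ β = ⊤
  osuc α ≤ₒ β = α <ₒ β
  olim f ≤ₒ β = ∀ i → f i ≤ₒ β

  _<ₒ_ : Ord → Ord → Set
  α <ₒ ozero  = ⊥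
  α <ₒ osuc β = α ≤ₒ β
  α <ₒ olim g = ∃ λ i → α <ₒ g i

IsLimit : Ord → Set
IsLimit λ' = (ozero <ₒ λ') × (∀ β → β <ₒ λ' → osuc β <ₒ λ')

-- Infinitary formulas of L_{ω₁ω} in the signature {<}, scoped:
-- Form n = formulas with free variables among Fin n.

data Form : ℕ → Set where
  rel  : ∀ {n} → Fin n → Fin n → Form n
  eq   : ∀ {n} → Fin n → Fin n → Form n
  neg  : ∀ {n} → Form n → Form n
  and  : ∀ {n} → Form n → Form n → Form n
  or   : ∀ {n} → Form n → Form n → Form n
  ⋀    : ∀ {n} → (ℕ → Form n) → Form n
  ⋁    : ∀ {n} → (ℕ → Form n) → Form n
  all  : ∀ {n} → Form (suc n) → Form n
  ex   : ∀ {n} → Form (suc n) → Form n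

Sentence : Set
Sentence = Form 0

data QF : ∀ {n} → Form n → Set where
  rel : ∀ {n} (i j : Fin n) → QF (rel i j)
  eq  : ∀ {n} (i j : Fin n) → QF (eq i j)
  neg : ∀ {n} {φ : Form n} → QF φ → QF (neg φ)
  and : ∀ {n} {φ ψ : Form n} → QF φ → QF ψ → QF (and φ ψ)
  or  : ∀ {n} {φ ψ : Form n} → QF φ → QF ψ → QF (or φ ψ)

mutual
  data IsΣ : Ord → ∀ {n} → Form n → Set where
    qf   : ∀ {α n} {φ : Form n} → QF φ → IsΣ α φ
    disj : ∀ {α n} (f : ℕ → Form n) → (∀ i → ExBlock α (f i)) → IsΣ α (⋁ f)

  data ExBlock : Ord → ∀ {n} → Form n → Set where
    base : ∀ {α β n} {φ : Form n} → β <ₒ α → IsΠ β φ → ExBlock α φ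
    step : ∀ {α n} {φ : Form (suc n)} → ExBlock α φ → ExBlock α (ex φ)

  data IsΠ : Ord → ∀ {n} → Form n → Set where
    qf   : ∀ {α n} {φ : Form n} → QF φ → IsΠ α φ
    conj : ∀ {α n} (f : ℕ → Form n) → (∀ i → AllBlock α (f i)) → IsΠ α (⋀ f)

  data AllBlock : Ord → ∀ {n} → Form n → Set where
    base : ∀ {α β n} {φ : Form n} → β <ₒ α → IsΣ β φ → AllBlock α φ
    step : ∀ {α n} {φ : Form (suc n)} → AllBlock α φ → AllBlock α (all φ)

Countable : Set → Set
Countable A = Σ (A → ℕ) λ f → Injective _≡_ _≡_ f

record Str : Set₁ where
  field
    Carrier   : Set
    R         : Carrier → Carrier → Set
    countable : Countable Carrier
open Str public

IsLinearOrder : Str → Set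
IsLinearOrder M = IsStrictTotalOrder {A = Carrier M} _≡_ (R M)

_≅_ : Str → Str → Set
M ≅ N = Σ (Carrier M ↔ Carrier N) λ h →
          ∀ a b → R M a b ⇔ R N (Inverse.to h a) (Inverse.to h b)

Sat : (M : Str) → ∀ {n} → Form n → Vec (Carrier M) n → Set
Sat M (rel i j) e = R M (lookup e i) (lookup e j)
Sat M (eq i j)  e = lookup e i ≡ lookup e j
Sat M (neg φ)   e = ¬ Sat M φ e
Sat M (and φ ψ) e = Sat M φ e × Sat M ψ e
Sat M (or φ ψ)  e = Sat M φ e ⊎ Sat M ψ e
Sat M (⋀ f)     e = ∀ i → Sat M (f i) e
Sat M (⋁ f)     e = ∃ λ i → Sat M (f i) e
Sat M (all φ)   e = ∀ a → Sat M φ (a ∷ e)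
Sat M (ex φ)    e = ∃ λ a → Sat M φ (a ∷ e)

_⊨_ : Str → Sentence → Set
M ⊨ φ = Sat M φ []

IsScottSentence : Str → Sentence → Set₁
IsScottSentence M φ = ∀ (N : Str) → (N ⊨ φ) ⇔ (N ≅ M)

HasΣScott HasΠScott HasdΣScott : Str → Ord → Set₁
HasΣScott M α = Σ Sentence λ φ → IsΣ α φ × IsScottSentence M φ
HasΠScott M α = Σ Sentence λ φ → IsΠ α φ × IsScottSentence M φ
HasdΣScott M α = Σ Sentence λ φ → Σ Sentence λ ψ →
                   IsΣ α φ × IsΠ α ψ × IsScottSentence M (and φ ψ)

ScottComplexityΣ : Str → Ord → Set₁
ScottComplexityΣ M α =
  HasΣScott M α × ¬ HasΠScott M α ×
  (∀ β → β <ₒ α → ¬ HasΣScott M β × ¬ HasΠScott M β × ¬ HasdΣScott M β)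

{-# OPTIONS --safe #-}

{-
Every tree α carries two linear orders P and Q which satisfy the same sentences up to a rank ℓ and are distinguished
just above it.  Both are dense sums of blocks, a block being an ω-sequence of slots filled with P- or Q-orders of smaller
trees; finitely many slots of a block are marked, that is, filled with P, all blocks have different sets of marks, and
Q has one additional block, the root, without marks.  A block can be imitated by blocks with one more mark in a far slot,
so P and Q are equivalent two levels above the orders in the slots; on the other hand an answer to the root has a mark
somewhere.  Slot numbers are made visible by clusters of adjacent points.  All orders are rigid, which allows
isomorphisms to be constructed although countable structures come without enumerations.

M is a ℤ-chain of blocks whose slot n contains an order for the join of the first n + 1 points of λ, marked in block κ
iff 2 ^ n divides κ.  Once a block is named, the remaining marks are described by formulas of rank below λ, which gives a
Σ_{λ+1} Scott sentence.  Given a Π_{λ+1} sentence true in M, one moves the origin of M by a rapidly growing sum of powers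
of 2, at each stage so far that the finitely many witnesses chosen before survive; in the limit this gives
another model, in which no block has all slots marked.  The classes below Σ_{λ+1} are contained in Π_{λ+1}.

Points of λ need not be comparable constructively, and the points used for one slot need not have an upper bound
below λ.  Therefore slots are described by several ranks at once, and a wrong answer of the game played at one rank
yields a proof that this rank lies below another one.
-}

module Submission where

open import Defs
open import Data.Bool using (Bool; true; false; _∧_; _∨_; not; T; if_then_else_)
open import Data.Bool.Properties using (T-irrelevant; T?)
open import Data.Empty using (⊥; ⊥-elim)
open import Data.Fin using (Fin; toℕ; fromℕ<) renaming (zero to fz; suc to fs)
open import Data.Fin.Properties using (pigeonhole)
open import Data.Integer using (ℤ; +_; -[1+_]) renaming (_+_ to _+ℤ_; _<_ to _<ℤ_; -_ to -ℤ_)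
open import Data.List using (List; []; _∷_; _++_; _∷ʳ_; map)
open import Data.List.Membership.Propositional using (_∈_)
open import Data.List.Relation.Unary.All using (All; []; _∷_)
open import Data.List.Relation.Unary.Any using (here; there)
open import Data.Maybe using (Maybe; just; nothing)
open import Data.Nat using (ℕ; zero; suc; _+_; _∸_; _^_; _≤_; _<_; z≤n; s≤s; _⊔_; _≡ᵇ_; _<ᵇ_; _≤ᵇ_)
open import Data.Product using (Σ; _×_; _,_; proj₁; proj₂; uncurry)
open import Data.Sum using (_⊎_; inj₁; inj₂; [_,_])
open import Data.Unit using (⊤; tt)
open import Data.Vec using (Vec; []; _∷_; lookup) renaming (_++_ to _++ᵛ_)
open import Function using (_∘_; id; case_of_)
open import Function.Bundles using (Inverse; _⇔_; Equivalence; mk⇔; mk↔ₛ′)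
open import Relation.Binary.Definitions using (Trichotomous; Tri; tri<; tri≈; tri>)
open import Relation.Binary.PropositionalEquality
  using (_≡_; _≢_; refl; sym; trans; cong; cong₂; subst; subst₂)
open import Relation.Nullary using (¬_; Dec; yes; no; does)
import Data.Bool.Properties as Boolₚ
import Data.Fin.Properties as Finₚ
import Data.Integer.Properties as ℤₚ
import Data.List.Properties as Listₚ
import Data.List.Membership.Propositional.Properties as ∈ₚ
import Data.Nat.Properties as ℕₚ
import Data.Integer.Divisibility.Signed as ℤ∣
import Data.Product.Properties as ×ₚ
import Data.Vec.Properties as Vecₚ
import Data.Integer as ℤ
import Data.List as List
import Data.List.Membership.DecPropositional as ∈?
import Data.List.Relation.Unary.All as All
import Data.List.Relation.Unary.All.Properties as Allₚ
import Data.Nat as ℕ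
import Data.Nat.Divisibility as ℕ∣
import Data.Sum as Sum
import Data.Vec as Vec

-- Ordinals, codings and comparators

-- The accounting behind the constants: a round of the symmetric game `Bf` costs two quantifier
-- alternations (`double`). One more node keeps its two orders equivalent for two more levels
-- (`hidden`), while one more symmetric round (`visible`) tells them apart. Both measurements thus
-- give the same ordinal up to a finite error, and a limit ordinal absorbs finite errors. This
-- reconciles the two opposite demands on the slots of M: their orders must be distinguishable by
-- formulas of rank below λ, so that a sentence can record the marks, and equivalent up to any given
-- rank below λ in all but finitely many slots, so that a formula of that rank does not notice a
-- change of marks far out. Hence a true Σ_λ formula remains true whenever the marks in a suitable
-- finite set of slots are kept: its truth is an open condition on the marks. The refutation of
-- Π_{λ+1} is then a category argument. Each instance of the sentence is such an open condition, and
-- the orbit of the marks under translation has no isolated points, so conditions met one after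
-- another can have a limit outside the orbit.

≤ₒ-mono-lim : ∀ α g i → α ≤ₒ g i → α ≤ₒ olim g
≤ₒ-mono-lim ozero g i p = tt
≤ₒ-mono-lim (osuc α) g i p = i , p
≤ₒ-mono-lim (olim f) g i p = λ j → ≤ₒ-mono-lim (f j) g i (p j)

mutual
  ≤ₒ-refl : ∀ α → α ≤ₒ α
  ≤ₒ-refl ozero = tt
  ≤ₒ-refl (osuc α) = ≤ₒ-refl α
  ≤ₒ-refl (olim f) = λ i → ≤ₒ-lim f i

  ≤ₒ-lim : ∀ f i → f i ≤ₒ olim f
  ≤ₒ-lim f i = ≤ₒ-mono-lim (f i) f i (≤ₒ-refl (f i))

mutual
  ≤ₒ-trans : ∀ α β γ → α ≤ₒ β → β ≤ₒ γ → α ≤ₒ γ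
  ≤ₒ-trans ozero β γ p q = tt
  ≤ₒ-trans (osuc α) β γ p q = <-≤ₒ-trans α β γ p q
  ≤ₒ-trans (olim f) β γ p q = λ i → ≤ₒ-trans (f i) β γ (p i) q

  <-≤ₒ-trans : ∀ α β γ → α <ₒ β → β ≤ₒ γ → α <ₒ γ
  <-≤ₒ-trans α (osuc β) γ p q = ≤-<ₒ-trans α β γ p q
  <-≤ₒ-trans α (olim g) γ (i , p) q = <-≤ₒ-trans α (g i) γ p (q i)

  ≤-<ₒ-trans : ∀ α β γ → α ≤ₒ β → β <ₒ γ → α <ₒ γ
  ≤-<ₒ-trans α β (osuc γ) p q = ≤ₒ-trans α β γ p q
  ≤-<ₒ-trans α β (olim g) p (i , q) = i , ≤-<ₒ-trans α β (g i) p q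

mutual
  ≤ₒ-step : ∀ α β → α ≤ₒ β → α ≤ₒ osuc β
  ≤ₒ-step ozero β p = tt
  ≤ₒ-step (osuc α) β p = <⇒≤ₒ α β p
  ≤ₒ-step (olim f) β p = λ i → ≤ₒ-step (f i) β (p i)

  <⇒≤ₒ : ∀ α β → α <ₒ β → α ≤ₒ β
  <⇒≤ₒ α (osuc β) p = ≤ₒ-step α β p
  <⇒≤ₒ α (olim g) (i , p) = ≤ₒ-mono-lim α g i (<⇒≤ₒ α (g i) p)

≤ₒ-suc : ∀ α → α ≤ₒ osuc α
≤ₒ-suc α = ≤ₒ-step α α (≤ₒ-refl α)

<ₒ-irrefl : ∀ α → ¬ (α <ₒ α)
<ₒ-irrefl (osuc α) p = <ₒ-irrefl α p
<ₒ-irrefl (olim f) (i , p) = <ₒ-irrefl (f i) (≤-<ₒ-trans (f i) (olim f) (f i) (≤ₒ-lim f i) p)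

<ₒ-trans : ∀ α β γ → α <ₒ β → β <ₒ γ → α <ₒ γ
<ₒ-trans α β γ p q = ≤-<ₒ-trans α β γ (<⇒≤ₒ α β p) q

sucs : ℕ → Ord → Ord
sucs zero α = α
sucs (suc n) α = osuc (sucs n α)

sucs-mono : ∀ n α β → α ≤ₒ β → sucs n α ≤ₒ sucs n β
sucs-mono zero α β p = p
sucs-mono (suc n) α β p = sucs-mono n α β p

sucs-< : ∀ λ' → IsLimit λ' → ∀ n β → β <ₒ λ' → sucs n β <ₒ λ'
sucs-< λ' L zero β p = p
sucs-< λ' L (suc n) β p = proj₂ L (sucs n β) (sucs-< λ' L n β p)

fin : ℕ → Ord
fin n = sucs n ozero

-- c + α with the finite summand on the left: the finite part is put at the bottom of the tree.
pad : ℕ → Ord → Ord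
pad c ozero = fin c
pad c (osuc α) = osuc (pad c α)
pad c (olim f) = olim (λ i → pad c (f i))

fin≤pad : ∀ c α → fin c ≤ₒ pad c α
fin≤pad c ozero = ≤ₒ-refl (fin c)
fin≤pad c (osuc α) = ≤ₒ-trans (fin c) (pad c α) (osuc (pad c α)) (fin≤pad c α) (≤ₒ-suc (pad c α))
fin≤pad c (olim f) = ≤ₒ-trans (fin c) (pad c (f 0)) (olim (λ i → pad c (f i))) (fin≤pad c (f 0)) (≤ₒ-lim (λ i → pad c (f i)) 0)

mutual
  pad-mono : ∀ c α β → α ≤ₒ β → pad c α ≤ₒ pad c β
  pad-mono c ozero β p = fin≤pad c β
  pad-mono c (osuc α) β p = pad-mono-< c α β p
  pad-mono c (olim f) β p = λ i → pad-mono c (f i) β (p i)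

  pad-mono-< : ∀ c α β → α <ₒ β → pad c α <ₒ pad c β
  pad-mono-< c α (osuc β) p = pad-mono c α β p
  pad-mono-< c α (olim g) (i , p) = i , pad-mono-< c α (g i) p

tri : ℕ → ℕ
tri zero = zero
tri (suc n) = suc (tri n + n)

pair : ℕ → ℕ → ℕ
pair a b = tri (a + b) + b

-- One step along the antidiagonals. Iterating it inverts the Cantor pairing without any division,
-- and `unpair-diagonal` is an induction along the same walk.
unpair-next : ℕ × ℕ → ℕ × ℕ
unpair-next (zero , b) = suc b , zero
unpair-next (suc a , b) = a , suc b

unpair : ℕ → ℕ × ℕ
unpair zero = 0 , 0
unpair (suc n) = unpair-next (unpair n)

unpair-diagonal : ∀ n a b → a + b ≡ n → unpair (tri n + b) ≡ (a , b)
unpair-diagonal zero zero zero e = refl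
unpair-diagonal (suc n) a zero e
  rewrite ℕₚ.+-identityʳ (tri n + n) | unpair-diagonal n 0 n refl | ℕₚ.+-identityʳ a = cong (_, 0) (sym e)
unpair-diagonal n a (suc b) e
  rewrite ℕₚ.+-suc (tri n) b | unpair-diagonal n (suc a) b (trans (sym (ℕₚ.+-suc a b)) e) = refl

unpair-pair : ∀ a b → unpair (pair a b) ≡ (a , b)
unpair-pair a b = unpair-diagonal (a + b) a b refl

n≤tri-n : ∀ n → n ≤ tri n
n≤tri-n zero = z≤n
n≤tri-n (suc n) = s≤s (ℕₚ.m≤n+m n (tri n))

pair-≥ˡ : ∀ a b → a ≤ pair a b
pair-≥ˡ a b = ℕₚ.≤-trans (ℕₚ.m≤m+n a b) (ℕₚ.≤-trans (n≤tri-n (a + b)) (ℕₚ.m≤m+n _ b))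

pair-≥ʳ : ∀ a b → b ≤ pair a b
pair-≥ʳ a b = ℕₚ.m≤n+m b (tri (a + b))

-- A retraction of ℕ rather than a bare injection: infinitary conjunctions and disjunctions range
-- over ℕ, so every number has to decode to some element.
record Coding (A : Set) : Set where
  field
    enc : A → ℕ
    dec : ℕ → A
    dec-enc : ∀ a → dec (enc a) ≡ a

  enc-injective : ∀ {a b} → enc a ≡ enc b → a ≡ b
  enc-injective {a} {b} e = trans (sym (dec-enc a)) (trans (cong dec e) (dec-enc b))
open Coding public

ℕ-coding : Coding ℕ
ℕ-coding = record { enc = id ; dec = id ; dec-enc = λ _ → refl }

×-coding : ∀ {A B} → Coding A → Coding B → Coding (A × B)
×-coding c d .enc (a , b) = pair (enc c a) (enc d b)
×-coding c d .dec n = dec c (proj₁ (unpair n)) , dec d (proj₂ (unpair n))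
×-coding c d .dec-enc (a , b)
  rewrite unpair-pair (enc c a) (enc d b) = cong₂ _,_ (dec-enc c a) (dec-enc d b)

Vec-coding : ∀ {A} → Coding A → ∀ k → Coding (Vec A k)
Vec-coding c zero = record { enc = λ _ → 0 ; dec = λ _ → [] ; dec-enc = λ { [] → refl } }
Vec-coding c (suc k) .enc (a ∷ v) = pair (enc c a) (enc (Vec-coding c k) v)
Vec-coding c (suc k) .dec n = dec c (proj₁ (unpair n)) ∷ dec (Vec-coding c k) (proj₂ (unpair n))
Vec-coding c (suc k) .dec-enc (a ∷ v)
  rewrite unpair-pair (enc c a) (enc (Vec-coding c k) v) =
  cong₂ _∷_ (dec-enc c a) (dec-enc (Vec-coding c k) v)

List-coding : ∀ {A} → Coding A → Coding (List A)
List-coding {A} c .enc l = pair (List.length l) (enc (Vec-coding c _) (Vec.fromList l))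
List-coding c .dec n = Vec.toList (dec (Vec-coding c (proj₁ (unpair n))) (proj₂ (unpair n)))
List-coding {A} c .dec-enc l
  rewrite unpair-pair (List.length l) (enc (Vec-coding c _) (Vec.fromList l))
        | dec-enc (Vec-coding c _) (Vec.fromList l) = Vecₚ.toList∘fromList l

-- Slot numbers will be derived from codes of lists; appending a large entry therefore leads to an
-- arbitrarily far slot.
List-enc-≥last : ∀ {A} (c : Coding A) l a → enc c a ≤ enc (List-coding c) (l ∷ʳ a)
List-enc-≥last {A} c l a = ℕₚ.≤-trans (go l) (pair-≥ʳ (List.length (l ∷ʳ a)) _)
  where
  go : ∀ l → enc c a ≤ enc (Vec-coding c (List.length (l ∷ʳ a))) (Vec.fromList (l ∷ʳ a))
  go [] = pair-≥ˡ (enc c a) 0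
  go (x ∷ l) = ℕₚ.≤-trans (go l) (pair-≥ʳ (enc c x) _)

ℤ-coding : Coding ℤ
ℤ-coding .enc (+ n) = pair 0 n
ℤ-coding .enc -[1+ n ] = pair 1 n
ℤ-coding .dec n with unpair n
... | zero , m = + m
... | suc _ , m = -[1+ m ]
ℤ-coding .dec-enc (+ n) rewrite unpair-pair 0 n = refl
ℤ-coding .dec-enc -[1+ n ] rewrite unpair-pair 1 n = refl

data Comparison : Set where
  less same greater : Comparison

opposite : Comparison → Comparison
opposite less = greater
opposite same = same
opposite greater = less

infixr 5 _⊗_
_⊗_ : Comparison → Comparison → Comparison
less ⊗ y = less
same ⊗ y = y
greater ⊗ y = greater

opposite-⊗ : ∀ x y → opposite (x ⊗ y) ≡ opposite x ⊗ opposite y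
opposite-⊗ less y = refl
opposite-⊗ same y = refl
opposite-⊗ greater y = refl

-- A decidable strict linear order as a function with three values: lexicographic orders become
-- products with respect to `⊗`, and comparisons of composite objects reduce by computation.
record Comparator (A : Set) : Set where
  field
    cmp : A → A → Comparison
    cmp-refl : ∀ a → cmp a a ≡ same
    cmp-same : ∀ a b → cmp a b ≡ same → a ≡ b
    cmp-opp : ∀ a b → cmp b a ≡ opposite (cmp a b)
    cmp-trans : ∀ a b c → cmp a b ≡ less → cmp b c ≡ less → cmp a c ≡ less
open Comparator public

⊗-less : ∀ {x y} → x ⊗ y ≡ less → x ≡ less ⊎ (x ≡ same × y ≡ less)
⊗-less {less} e = inj₁ refl
⊗-less {same} e = inj₂ (refl , e)

⊗-same : ∀ {x y} → x ⊗ y ≡ same → x ≡ same × y ≡ same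
⊗-same {same} e = refl , e

⊗-lessˡ : ∀ {x y} → x ≡ less → x ⊗ y ≡ less
⊗-lessˡ refl = refl

⊗-lessʳ : ∀ {x y} → x ≡ same → y ≡ less → x ⊗ y ≡ less
⊗-lessʳ refl e = e

tri-cmp : ∀ {A : Set} {_<′_ : A → A → Set} → Trichotomous _≡_ _<′_ → A → A → Comparison
tri-cmp t a b with t a b
... | tri< _ _ _ = less
... | tri≈ _ _ _ = same
... | tri> _ _ _ = greater

module _ {A : Set} {_<′_ : A → A → Set} (t : Trichotomous _≡_ _<′_) where
  <⇒less : ∀ {a b} → a <′ b → tri-cmp t a b ≡ less
  <⇒less {a} {b} p with t a b
  ... | tri< _ _ _ = refl
  ... | tri≈ ¬p _ _ = ⊥-elim (¬p p)
  ... | tri> ¬p _ _ = ⊥-elim (¬p p)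

  less⇒< : ∀ {a b} → tri-cmp t a b ≡ less → a <′ b
  less⇒< {a} {b} e with t a b
  ... | tri< p _ _ = p

  tri-comparator : (∀ {a b c} → a <′ b → b <′ c → a <′ c) → Comparator A
  tri-comparator tr .cmp = tri-cmp t
  tri-comparator tr .cmp-refl a with t a a
  ... | tri< _ ¬e _ = ⊥-elim (¬e refl)
  ... | tri≈ _ _ _ = refl
  ... | tri> _ ¬e _ = ⊥-elim (¬e refl)
  tri-comparator tr .cmp-same a b e with t a b
  ... | tri≈ _ p _ = p
  tri-comparator tr .cmp-opp a b with t a b | t b a
  ... | tri< _ _ _ | tri> _ _ _ = refl
  ... | tri≈ _ _ _ | tri≈ _ _ _ = refl
  ... | tri> _ _ _ | tri< _ _ _ = refl
  ... | tri< p _ _ | tri< _ _ ¬p = ⊥-elim (¬p p)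
  ... | tri< _ ¬e _ | tri≈ _ e _ = ⊥-elim (¬e (sym e))
  ... | tri≈ _ e _ | tri< _ ¬e _ = ⊥-elim (¬e (sym e))
  ... | tri≈ _ e _ | tri> _ ¬e _ = ⊥-elim (¬e (sym e))
  ... | tri> _ ¬e _ | tri≈ _ e _ = ⊥-elim (¬e (sym e))
  ... | tri> _ _ p | tri> ¬p _ _ = ⊥-elim (¬p p)
  tri-comparator tr .cmp-trans a b c p q = <⇒less (tr (less⇒< p) (less⇒< q))

ℕ-comparator : Comparator ℕ
ℕ-comparator = tri-comparator ℕₚ.<-cmp ℕₚ.<-trans

ℤ-comparator : Comparator ℤ
ℤ-comparator = tri-comparator ℤₚ.<-cmp ℤₚ.<-trans

flip-comparator : ∀ {A} → Comparator A → Comparator A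
flip-comparator c .cmp a b = cmp c b a
flip-comparator c .cmp-refl = cmp-refl c
flip-comparator c .cmp-same a b e = sym (cmp-same c b a e)
flip-comparator c .cmp-opp a b = cmp-opp c b a
flip-comparator c .cmp-trans x y z p q = cmp-trans c z y x q p

×-comparator : ∀ {A B} → Comparator A → Comparator B → Comparator (A × B)
×-comparator c d .cmp (a , b) (a′ , b′) = cmp c a a′ ⊗ cmp d b b′
×-comparator c d .cmp-refl (a , b) rewrite cmp-refl c a = cmp-refl d b
×-comparator c d .cmp-same (a , b) (a′ , b′) e =
  cong₂ _,_ (cmp-same c a a′ (proj₁ (⊗-same e))) (cmp-same d b b′ (proj₂ (⊗-same {cmp c a a′} e)))
×-comparator c d .cmp-opp (a , b) (a′ , b′)
  rewrite cmp-opp c a a′ | cmp-opp d b b′ = sym (opposite-⊗ (cmp c a a′) (cmp d b b′))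
×-comparator c d .cmp-trans (a₁ , b₁) (a₂ , b₂) (a₃ , b₃) p q
  with ⊗-less {cmp c a₁ a₂} p | ⊗-less {cmp c a₂ a₃} q
... | inj₁ u | inj₁ v = ⊗-lessˡ (cmp-trans c a₁ a₂ a₃ u v)
... | inj₁ u | inj₂ (v , _) rewrite cmp-same c a₂ a₃ v = ⊗-lessˡ u
... | inj₂ (u , _) | inj₁ v rewrite cmp-same c a₁ a₂ u = ⊗-lessˡ v
... | inj₂ (u , u′) | inj₂ (v , v′)
  rewrite cmp-same c a₁ a₂ u | cmp-same c a₂ a₃ v | cmp-refl c a₃ = cmp-trans d b₁ b₂ b₃ u′ v′

list-cmp : ∀ {A} → Comparator A → List A → List A → Comparison
list-cmp c [] [] = same
list-cmp c [] (_ ∷ _) = less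
list-cmp c (_ ∷ _) [] = greater
list-cmp c (a ∷ l) (b ∷ m) = cmp c a b ⊗ list-cmp c l m

List-comparator : ∀ {A} → Comparator A → Comparator (List A)
List-comparator c .cmp = list-cmp c
List-comparator c .cmp-refl [] = refl
List-comparator c .cmp-refl (a ∷ l) rewrite cmp-refl c a = cmp-refl (List-comparator c) l
List-comparator c .cmp-same [] [] e = refl
List-comparator c .cmp-same (a ∷ l) (b ∷ m) e =
  cong₂ _∷_ (cmp-same c a b (proj₁ (⊗-same e)))
            (cmp-same (List-comparator c) l m (proj₂ (⊗-same {cmp c a b} e)))
List-comparator c .cmp-opp [] [] = refl
List-comparator c .cmp-opp [] (_ ∷ _) = refl
List-comparator c .cmp-opp (_ ∷ _) [] = refl
List-comparator c .cmp-opp (a ∷ l) (b ∷ m)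
  rewrite cmp-opp c a b | cmp-opp (List-comparator c) l m = sym (opposite-⊗ (cmp c a b) (list-cmp c l m))
List-comparator c .cmp-trans [] (_ ∷ _) (_ ∷ _) p q = refl
List-comparator c .cmp-trans (a₁ ∷ l₁) (a₂ ∷ l₂) (a₃ ∷ l₃) p q
  with ⊗-less {cmp c a₁ a₂} p | ⊗-less {cmp c a₂ a₃} q
... | inj₁ u | inj₁ v = ⊗-lessˡ (cmp-trans c a₁ a₂ a₃ u v)
... | inj₁ u | inj₂ (v , _) rewrite cmp-same c a₂ a₃ v = ⊗-lessˡ u
... | inj₂ (u , _) | inj₁ v rewrite cmp-same c a₁ a₂ u = ⊗-lessˡ v
... | inj₂ (u , u′) | inj₂ (v , v′)
  rewrite cmp-same c a₁ a₂ u | cmp-same c a₂ a₃ v | cmp-refl c a₃ =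
  cmp-trans (List-comparator c) l₁ l₂ l₃ u′ v′

-- Back-and-forth relations and formulas

exs alls : ∀ k {n} → Form (k + n) → Form n
exs zero φ = φ
exs (suc k) φ = exs k (ex φ)
alls zero φ = φ
alls (suc k) φ = alls k (all φ)

module _ (M : Str) where
  Sat-exs⇒ : ∀ k {n} (φ : Form (k + n)) e → Sat M (exs k φ) e → Σ (Vec (Carrier M) k) λ v → Sat M φ (v ++ᵛ e)
  Sat-exs⇒ zero φ e s = [] , s
  Sat-exs⇒ (suc k) φ e s with v , a , t ← Sat-exs⇒ k (ex φ) e s = a ∷ v , t

  Sat-exs⇐ : ∀ k {n} (φ : Form (k + n)) e (v : Vec (Carrier M) k) → Sat M φ (v ++ᵛ e) → Sat M (exs k φ) e
  Sat-exs⇐ zero φ e [] s = s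
  Sat-exs⇐ (suc k) φ e (a ∷ v) s = Sat-exs⇐ k (ex φ) e v (a , s)

  Sat-alls⇒ : ∀ k {n} (φ : Form (k + n)) e → Sat M (alls k φ) e → (v : Vec (Carrier M) k) → Sat M φ (v ++ᵛ e)
  Sat-alls⇒ zero φ e s [] = s
  Sat-alls⇒ (suc k) φ e s (a ∷ v) = Sat-alls⇒ k (all φ) e s v a

  Sat-alls⇐ : ∀ k {n} (φ : Form (k + n)) e → ((v : Vec (Carrier M) k) → Sat M φ (v ++ᵛ e)) → Sat M (alls k φ) e
  Sat-alls⇐ zero φ e s = s []
  Sat-alls⇐ (suc k) φ e s = Sat-alls⇐ k (all φ) e (λ v a → s (a ∷ v))

AllBlock-mono : ∀ {α β n} {φ : Form n} → α ≤ₒ β → AllBlock α φ → AllBlock β φ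
AllBlock-mono {α} {β} p (base {β = γ} q s) = base {β = γ} (<-≤ₒ-trans γ α β q p) s
AllBlock-mono p (step b) = step (AllBlock-mono p b)

AllBlock-alls : ∀ {α} k {n} {φ : Form (k + n)} → AllBlock α φ → AllBlock α (alls k φ)
AllBlock-alls zero b = b
AllBlock-alls (suc k) b = AllBlock-alls k (step b)

ExBlock-exs : ∀ {α} k {n} {φ : Form (k + n)} → ExBlock α φ → ExBlock α (exs k φ)
ExBlock-exs zero b = b
ExBlock-exs (suc k) b = ExBlock-exs k (step b)

zipᵛ : ∀ {A B : Set} {k} → Vec A k → Vec B k → List (A × B)
zipᵛ [] [] = []
zipᵛ (a ∷ v) (b ∷ u) = (a , b) ∷ zipᵛ v u

zipᵛ-++ : ∀ {A B : Set} {k n} (v : Vec A k) (v′ : Vec A n) (u : Vec B k) (u′ : Vec B n) →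
  zipᵛ (v ++ᵛ v′) (u ++ᵛ u′) ≡ zipᵛ v u ++ zipᵛ v′ u′
zipᵛ-++ [] v′ [] u′ = refl
zipᵛ-++ (a ∷ v) v′ (b ∷ u) u′ = cong ((a , b) ∷_) (zipᵛ-++ v v′ u u′)

∈-zipᵛ : ∀ {A B : Set} {k} (v : Vec A k) (u : Vec B k) {p} → p ∈ zipᵛ v u →
  Σ (Fin k) λ i → p ≡ (lookup v i , lookup u i)
∈-zipᵛ [] [] ()
∈-zipᵛ (a ∷ v) (b ∷ u) (here e) = fz , e
∈-zipᵛ (a ∷ v) (b ∷ u) (there m) with i , e ← ∈-zipᵛ v u m = fs i , e

zipᵛ-∈ : ∀ {A B : Set} {k} (v : Vec A k) (u : Vec B k) i → (lookup v i , lookup u i) ∈ zipᵛ v u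
zipᵛ-∈ (a ∷ v) (b ∷ u) fz = here refl
zipᵛ-∈ (a ∷ v) (b ∷ u) (fs i) = there (zipᵛ-∈ v u i)

Agree : (N M : Str) → (p q : Carrier N × Carrier M) → Set
Agree N M (a , b) (a′ , b′) = (R N a a′ ⇔ R M b b′) × (a ≡ a′ ⇔ b ≡ b′)

-- In every round the side of the move is chosen anew. The formulas that describe M come from this
-- symmetric game; the game of `Preserves` below, where the sides alternate, fits the classes of
-- formulas exactly and serves for transfer.
Bf : (N M : Str) → Ord → List (Carrier N × Carrier M) → Set
Bf N M ozero ps = ∀ p q → p ∈ ps → q ∈ ps → Agree N M p q
Bf N M (osuc β) ps =
  (∀ k (v : Vec (Carrier N) k) → Σ (Vec (Carrier M) k) λ u → Bf N M β (zipᵛ v u ++ ps)) ×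
  (∀ k (u : Vec (Carrier M) k) → Σ (Vec (Carrier N) k) λ v → Bf N M β (zipᵛ v u ++ ps))
Bf N M (olim f) ps = ∀ i → Bf N M (f i) ps

module _ (N M : Str) where
  Bf-agree : ∀ β ps → Bf N M β ps → Bf N M ozero ps
  Bf-agree ozero ps b = b
  Bf-agree (osuc β) ps (f , _) with [] , b ← f 0 [] = Bf-agree β ps b
  Bf-agree (olim f) ps b = Bf-agree (f 0) ps (b 0)

  mutual
    Bf-mono : ∀ α β ps → α ≤ₒ β → Bf N M β ps → Bf N M α ps
    Bf-mono ozero β ps p b = Bf-agree β ps b
    Bf-mono (osuc α) β ps p b = Bf-mono-< α β ps p b
    Bf-mono (olim f) β ps p b = λ i → Bf-mono (f i) β ps (p i) b

    Bf-mono-< : ∀ α β ps → α <ₒ β → Bf N M β ps → Bf N M (osuc α) ps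
    Bf-mono-< α (osuc β) ps p (f , g) =
      (λ k v → let u , b = f k v in u , Bf-mono α β _ p b) ,
      (λ k u → let v , b = g k u in v , Bf-mono α β _ p b)
    Bf-mono-< α (olim h) ps (i , p) b = Bf-mono-< α (h i) ps p (b i)

  Bf-⊆ : ∀ β ps qs → (∀ {p} → p ∈ qs → p ∈ ps) → Bf N M β ps → Bf N M β qs
  Bf-⊆ ozero ps qs s b p q m n = b p q (s m) (s n)
  Bf-⊆ (osuc β) ps qs s (f , g) =
    (λ k v → let u , b = f k v in u , Bf-⊆ β _ _ (sub (zipᵛ v u)) b) ,
    (λ k u → let v , b = g k u in v , Bf-⊆ β _ _ (sub (zipᵛ v u)) b)
    where
    sub : ∀ rs {p} → p ∈ rs ++ qs → p ∈ rs ++ ps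
    sub rs m = [ ∈ₚ.∈-++⁺ˡ , (λ n → ∈ₚ.∈-++⁺ʳ rs (s n)) ] (∈ₚ.∈-++⁻ rs m)
  Bf-⊆ (olim f) ps qs s b = λ i → Bf-⊆ (f i) ps qs s (b i)

  Bf-iso : (i : N ≅ M) → ∀ β (ps : List (Carrier N × Carrier M)) →
    All (λ p → Inverse.to (proj₁ i) (proj₁ p) ≡ proj₂ p) ps → Bf N M β ps
  Bf-iso (h , r) ozero ps a (x , y) (x′ , y′) m n
    rewrite sym (All.lookup a m)
          | sym (All.lookup a n) =
    r x x′ , mk⇔ (cong to)
      (λ e → trans (sym (strictlyInverseʳ x)) (trans (cong from e) (strictlyInverseʳ x′)))
    where open Inverse h
  Bf-iso i@(h , r) (osuc β) ps a =
    (λ k v → Vec.map to v , Bf-iso i β _ (forth v)) ,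
    (λ k u → Vec.map from u , Bf-iso i β _ (back u))
    where
    open Inverse h
    forth : ∀ {k} (v : Vec (Carrier N) k) → All (λ p → to (proj₁ p) ≡ proj₂ p) (zipᵛ v (Vec.map to v) ++ ps)
    forth [] = a
    forth (x ∷ v) = refl ∷ forth v
    back : ∀ {k} (u : Vec (Carrier M) k) → All (λ p → to (proj₁ p) ≡ proj₂ p) (zipᵛ (Vec.map from u) u ++ ps)
    back [] = a
    back (y ∷ u) = strictlyInverseˡ y ∷ back u
  Bf-iso i (olim f) ps a = λ n → Bf-iso i (f n) ps a

-- The complexity of the formulas below: each back-and-forth step costs two alternations.
double : Ord → Ord
double ozero = fin 1
double (osuc β) = osuc (osuc (double β))
double (olim f) = olim (λ i → double (f i))

ozero<double : ∀ β → ozero <ₒ double β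
ozero<double ozero = tt
ozero<double (osuc β) = tt
ozero<double (olim f) = 0 , ozero<double (f 0)

module ScottFormulas (M : Str) (code : Coding (Carrier M)) (R? : ∀ a b → Dec (R M a b)) where

  literal : ∀ {P : Set} {n} → Dec P → Form n → Form n
  literal (yes _) φ = φ
  literal (no _) φ = neg φ

  _≟ᴹ_ : ∀ (a b : Carrier M) → Dec (a ≡ b)
  a ≟ᴹ b with enc code a ℕ.≟ enc code b
  ... | yes e = yes (enc-injective code e)
  ... | no ¬e = no (λ e → ¬e (cong (enc code) e))

  diagram : ∀ {n} → Vec (Carrier M) n → Fin n → Fin n → Form n
  diagram ms i j = and (literal (R? (lookup ms i) (lookup ms j)) (rel i j))
                       (literal (lookup ms i ≟ᴹ lookup ms j) (eq i j))

  atomic : ∀ {n} → Vec (Carrier M) n → ℕ × ℕ → Form n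
  atomic {n} ms (a , b) with a ℕ.<? n | b ℕ.<? n
  ... | yes p | yes q = diagram ms (fromℕ< p) (fromℕ< q)
  -- Numbers that name no pair of variables contribute a truth. Without variables there is no
  -- quantifier-free formula at all, so even a truth needs a quantifier.
  ... | _ | _ = all (eq fz fz)

  -- The Scott formula of rank `β`, given by its conjuncts so that each can be classified as a block
  -- of universal quantifiers. A code (0 , k) stands for the forth clause for `k`-tuples, and (k + 1
  -- , s) for the back clause for the tuple coded by `s`; the constant disjunction in the latter
  -- supplies the normal form of a Σ formula.
  conjunct : Ord → ∀ {n} → Vec (Carrier M) n → ℕ → Form n
  conjunct ozero ms t = atomic ms (unpair t)
  conjunct (osuc β) ms t with unpair t
  ... | zero , k = alls k (⋁ λ s → ⋀ (conjunct β (dec (Vec-coding code k) s ++ᵛ ms)))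
  ... | suc k , s = ⋁ λ _ → exs k (⋀ (conjunct β (dec (Vec-coding code k) s ++ᵛ ms)))
  conjunct (olim f) ms t = conjunct (f (proj₁ (unpair t))) ms (proj₂ (unpair t))

  literal-QF : ∀ {P : Set} {n} (d : Dec P) {φ : Form n} → QF φ → QF (literal d φ)
  literal-QF (yes _) q = q
  literal-QF (no _) q = neg q

  conjunct-AllBlock : ∀ β {n} (ms : Vec (Carrier M) n) t → AllBlock (double β) (conjunct β ms t)
  conjunct-AllBlock ozero {n} ms t with proj₁ (unpair t) ℕ.<? n | proj₂ (unpair t) ℕ.<? n
  ... | yes p | yes q = base {β = ozero} tt (qf (and (literal-QF (R? _ _) (rel _ _)) (literal-QF (_ ≟ᴹ _) (eq _ _))))
  ... | yes _ | no _ = step (base {β = ozero} tt (qf (eq _ _)))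
  ... | no _ | yes _ = step (base {β = ozero} tt (qf (eq _ _)))
  ... | no _ | no _ = step (base {β = ozero} tt (qf (eq _ _)))
  conjunct-AllBlock (osuc β) ms t with unpair t
  ... | zero , k = AllBlock-alls k (base {β = osuc (double β)} (≤ₒ-refl (double β)) (disj _ λ s →
          base {β = double β} (≤ₒ-refl (double β)) (conj _ (conjunct-AllBlock β _))))
  ... | suc k , s = base {β = osuc (double β)} (≤ₒ-refl (double β)) (disj _ λ _ →
          ExBlock-exs k (base {β = double β} (≤ₒ-refl (double β)) (conj _ (conjunct-AllBlock β _))))
  conjunct-AllBlock (olim f) ms t =
    AllBlock-mono (≤ₒ-lim (λ i → double (f i)) (proj₁ (unpair t))) (conjunct-AllBlock (f (proj₁ (unpair t))) ms _)

  module _ (N : Str) where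
    diagram⇒Agree : ∀ {n} (ns : Vec (Carrier N) n) (ms : Vec (Carrier M) n) i j → Sat N (diagram ms i j) ns →
      Agree N M (lookup ns i , lookup ms i) (lookup ns j , lookup ms j)
    diagram⇒Agree ns ms i j (p , q) with R? (lookup ms i) (lookup ms j) | lookup ms i ≟ᴹ lookup ms j
    ... | yes r | yes e = mk⇔ (λ _ → r) (λ _ → p) , mk⇔ (λ _ → e) (λ _ → q)
    ... | yes r | no ¬e = mk⇔ (λ _ → r) (λ _ → p) , mk⇔ (λ x → ⊥-elim (q x)) (λ x → ⊥-elim (¬e x))
    ... | no ¬r | yes e = mk⇔ (λ x → ⊥-elim (p x)) (λ x → ⊥-elim (¬r x)) , mk⇔ (λ _ → e) (λ _ → q)
    ... | no ¬r | no ¬e = mk⇔ (λ x → ⊥-elim (p x)) (λ x → ⊥-elim (¬r x)) , mk⇔ (λ x → ⊥-elim (q x)) (λ x → ⊥-elim (¬e x))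

    Agree⇒diagram : ∀ {n} (ns : Vec (Carrier N) n) (ms : Vec (Carrier M) n) i j →
      Agree N M (lookup ns i , lookup ms i) (lookup ns j , lookup ms j) → Sat N (diagram ms i j) ns
    Agree⇒diagram ns ms i j (p , q) with R? (lookup ms i) (lookup ms j) | lookup ms i ≟ᴹ lookup ms j
    ... | yes r | yes e = Equivalence.from p r , Equivalence.from q e
    ... | yes r | no ¬e = Equivalence.from p r , λ x → ¬e (Equivalence.to q x)
    ... | no ¬r | yes e = (λ x → ¬r (Equivalence.to p x)) , Equivalence.from q e
    ... | no ¬r | no ¬e = (λ x → ¬r (Equivalence.to p x)) , λ x → ¬e (Equivalence.to q x)

    conjuncts⇒Bf : ∀ β {n} (ns : Vec (Carrier N) n) (ms : Vec (Carrier M) n) →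
      (∀ t → Sat N (conjunct β ms t) ns) → Bf N M β (zipᵛ ns ms)
    conjuncts⇒Bf ozero {n} ns ms s p q m m′ with ∈-zipᵛ ns ms m | ∈-zipᵛ ns ms m′
    ... | i , refl | j , refl = diagram⇒Agree ns ms i j lit
      where
      lit : Sat N (diagram ms i j) ns
      lit with subst (λ x → Sat N (atomic ms x) ns) (unpair-pair (toℕ i) (toℕ j)) (s (pair (toℕ i) (toℕ j)))
      ... | h with toℕ i ℕ.<? n | toℕ j ℕ.<? n
      ... | yes u | yes v = subst₂ (λ i j → Sat N (diagram ms i j) ns) (Finₚ.fromℕ<-toℕ i u) (Finₚ.fromℕ<-toℕ j v) h
      ... | no ¬u | _ = ⊥-elim (¬u (Finₚ.toℕ<n i))
      ... | yes _ | no ¬v = ⊥-elim (¬v (Finₚ.toℕ<n j))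
    conjuncts⇒Bf (osuc β) {n} ns ms s = forth , back
      where
      forth : ∀ k (v : Vec (Carrier N) k) → Σ (Vec (Carrier M) k) λ u → Bf N M β (zipᵛ v u ++ zipᵛ ns ms)
      forth k v with s (pair 0 k)
      ... | h rewrite unpair-pair 0 k with Sat-alls⇒ N k (⋁ λ s → ⋀ (conjunct β (dec (Vec-coding code k) s ++ᵛ ms))) ns h v
      ... | t , h′ = dec (Vec-coding code k) t ,
        subst (Bf N M β) (zipᵛ-++ v ns _ ms) (conjuncts⇒Bf β (v ++ᵛ ns) _ h′)
      back : ∀ k (u : Vec (Carrier M) k) → Σ (Vec (Carrier N) k) λ v → Bf N M β (zipᵛ v u ++ zipᵛ ns ms)
      back k u with s (pair (suc k) (enc (Vec-coding code k) u))
      ... | h rewrite unpair-pair (suc k) (enc (Vec-coding code k) u) | dec-enc (Vec-coding code k) u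
        with Sat-exs⇒ N k (⋀ (conjunct β (u ++ᵛ ms))) ns (proj₂ h)
      ... | v , h′ = v , subst (Bf N M β) (zipᵛ-++ v ns u ms) (conjuncts⇒Bf β (v ++ᵛ ns) _ h′)
    conjuncts⇒Bf (olim f) ns ms s i = conjuncts⇒Bf (f i) ns ms λ t →
      subst (λ x → Sat N (conjunct (f (proj₁ x)) ms (proj₂ x)) ns) (unpair-pair i t) (s (pair i t))

    Bf⇒conjuncts : ∀ β {n} (ns : Vec (Carrier N) n) (ms : Vec (Carrier M) n) →
      Bf N M β (zipᵛ ns ms) → ∀ t → Sat N (conjunct β ms t) ns
    Bf⇒conjuncts ozero {n} ns ms b t with proj₁ (unpair t) ℕ.<? n | proj₂ (unpair t) ℕ.<? n
    ... | yes p | yes q = Agree⇒diagram ns ms _ _ (b _ _ (zipᵛ-∈ ns ms _) (zipᵛ-∈ ns ms _))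
    ... | yes _ | no _ = λ a → refl
    ... | no _ | yes _ = λ a → refl
    ... | no _ | no _ = λ a → refl
    Bf⇒conjuncts (osuc β) ns ms (f , g) t with unpair t
    ... | zero , k = Sat-alls⇐ N k (⋁ λ s → ⋀ (conjunct β (dec (Vec-coding code k) s ++ᵛ ms))) ns λ v →
      let u , b = f k v in enc (Vec-coding code k) u ,
        Bf⇒conjuncts β (v ++ᵛ ns) _ (subst (Bf N M β)
          (trans (sym (zipᵛ-++ v ns u ms)) (cong (λ u → zipᵛ (v ++ᵛ ns) (u ++ᵛ ms)) (sym (dec-enc (Vec-coding code k) u)))) b)
    ... | suc k , s = 0 , (let u = dec (Vec-coding code k) s ; v , b = g k u in
      Sat-exs⇐ N k (⋀ (conjunct β (u ++ᵛ ms))) ns v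
        (Bf⇒conjuncts β (v ++ᵛ ns) (u ++ᵛ ms) (subst (Bf N M β) (sym (zipᵛ-++ v ns u ms)) b)))
    Bf⇒conjuncts (olim f) ns ms b t = Bf⇒conjuncts (f (proj₁ (unpair t))) ns ms (b _) _

-- Since the classes count blocks of quantifiers, a move is a tuple of arbitrary finite length.
Preserves : Ord → (M N : Str) → ∀ {n} → Vec (Carrier M) n → Vec (Carrier N) n → Set
Preserves ozero M N e e′ = ∀ i j → Agree M N (lookup e i , lookup e′ i) (lookup e j , lookup e′ j)
Preserves (osuc β) M N e e′ = ∀ k (v : Vec (Carrier N) k) → Σ (Vec (Carrier M) k) λ u →
  Preserves β N M (v ++ᵛ e′) (u ++ᵛ e)
Preserves (olim f) M N e e′ = ∀ i → Preserves (f i) M N e e′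

⇔-sym : ∀ {A B : Set} → A ⇔ B → B ⇔ A
⇔-sym p = mk⇔ (Equivalence.from p) (Equivalence.to p)

Preserves-agree : ∀ β M N {n} (e : Vec (Carrier M) n) (e′ : Vec (Carrier N) n) →
  Preserves β M N e e′ → Preserves ozero M N e e′
Preserves-agree ozero M N e e′ p = p
Preserves-agree (osuc β) M N e e′ p i j with [] , b ← p 0 [] =
  let r , q = Preserves-agree β N M e′ e b i j in ⇔-sym r , ⇔-sym q
Preserves-agree (olim f) M N e e′ p = Preserves-agree (f 0) M N e e′ (p 0)

mutual
  Preserves-mono : ∀ α β M N {n} (e : Vec (Carrier M) n) (e′ : Vec (Carrier N) n) →
    α ≤ₒ β → Preserves β M N e e′ → Preserves α M N e e′
  Preserves-mono ozero β M N e e′ p b = Preserves-agree β M N e e′ b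
  Preserves-mono (osuc α) β M N e e′ p b = Preserves-mono-< α β M N e e′ p b
  Preserves-mono (olim f) β M N e e′ p b = λ i → Preserves-mono (f i) β M N e e′ (p i) b

  Preserves-mono-< : ∀ α β M N {n} (e : Vec (Carrier M) n) (e′ : Vec (Carrier N) n) →
    α <ₒ β → Preserves β M N e e′ → Preserves (osuc α) M N e e′
  Preserves-mono-< α (osuc β) M N e e′ p f k v = let u , b = f k v in u , Preserves-mono α β N M _ _ p b
  Preserves-mono-< α (olim h) M N e e′ (i , p) b = Preserves-mono-< α (h i) M N e e′ p (b i)

QF-transfer : ∀ M N {n} {φ : Form n} {e e′} → QF φ → Preserves ozero M N e e′ → Sat M φ e ⇔ Sat N φ e′
QF-transfer M N (rel i j) a = proj₁ (a i j)
QF-transfer M N (eq i j) a = proj₂ (a i j)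
QF-transfer M N (neg q) a = let i = QF-transfer M N q a in
  mk⇔ (λ ¬s s → ¬s (Equivalence.from i s)) (λ ¬s s → ¬s (Equivalence.to i s))
QF-transfer M N (and p q) a = let i = QF-transfer M N p a ; j = QF-transfer M N q a in
  mk⇔ (λ (s , t) → Equivalence.to i s , Equivalence.to j t) (λ (s , t) → Equivalence.from i s , Equivalence.from j t)
QF-transfer M N (or p q) a = let i = QF-transfer M N p a ; j = QF-transfer M N q a in
  mk⇔ [ inj₁ ∘ Equivalence.to i , inj₂ ∘ Equivalence.to j ] [ inj₁ ∘ Equivalence.from i , inj₂ ∘ Equivalence.from j ]

mutual
  Π-transfer : ∀ {β n} {φ : Form n} M N e e′ → IsΠ β φ → Preserves β M N e e′ → Sat M φ e → Sat N φ e′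
  Π-transfer {β} M N e e′ (qf q) p s = Equivalence.to (QF-transfer M N q (Preserves-agree β M N e e′ p)) s
  Π-transfer M N e e′ (conj f b) p s i = AllBlock-transfer M N e e′ [] (b i) p (λ { [] → s i })

  -- The instantiations of a block are collected in `v` and answered together, so that a block costs
  -- one move however long it is. The move exchanges the structures, which is why the matrix is
  -- transferred by `Σ-transfer` with `N` and `M` interchanged.
  AllBlock-transfer : ∀ {α n k} {φ : Form (k + n)} M N (e : Vec (Carrier M) n) (e′ : Vec (Carrier N) n)
    (v : Vec (Carrier N) k) → AllBlock α φ → Preserves α M N e e′ →
    ((u : Vec (Carrier M) k) → Sat M φ (u ++ᵛ e)) → Sat N φ (v ++ᵛ e′)
  AllBlock-transfer {α} M N e e′ v (base {β = β} q b) p s =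
    let u , h = Preserves-mono (osuc β) α M N e e′ q p _ v in Σ-transfer N M _ _ b h (s u)
  AllBlock-transfer M N e e′ v (step b) p s a = AllBlock-transfer M N e e′ (a ∷ v) b p λ { (c ∷ u) → s u c }

  Σ-transfer : ∀ {β n} {φ : Form n} M N e e′ → IsΣ β φ → Preserves β M N e e′ → Sat N φ e′ → Sat M φ e
  Σ-transfer {β} M N e e′ (qf q) p s = Equivalence.from (QF-transfer M N q (Preserves-agree β M N e e′ p)) s
  Σ-transfer M N e e′ (disj f b) p (i , s) with [] , t ← ExBlock-transfer M N e e′ [] (b i) p s = i , t

  ExBlock-transfer : ∀ {α n k} {φ : Form (k + n)} M N (e : Vec (Carrier M) n) (e′ : Vec (Carrier N) n)
    (v : Vec (Carrier N) k) → ExBlock α φ → Preserves α M N e e′ →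
    Sat N φ (v ++ᵛ e′) → Σ (Vec (Carrier M) k) λ u → Sat M φ (u ++ᵛ e)
  ExBlock-transfer {α} M N e e′ v (base {β = β} q b) p s =
    let u , h = Preserves-mono (osuc β) α M N e e′ q p _ v in u , Π-transfer N M _ _ b h s
  ExBlock-transfer M N e e′ v (step b) p (a , s) with c ∷ u , t ← ExBlock-transfer M N e e′ (a ∷ v) b p s = u , c , t

-- The dense order of blocks

-- One index set for two purposes: the ℤ-chain of M uses the indices with empty list (see
-- `entry-ok`), the dense sums inside the trees use the lists as well.
Ix : Set
Ix = ℤ × List ℕ

-- Prefix first, larger entries earlier: appending a large last entry gives an index immediately above.
opaque
  Ix-comparator : Comparator Ix
  Ix-comparator = ×-comparator ℤ-comparator (List-comparator (flip-comparator ℕ-comparator))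

opaque
  Ix-coding : Coding Ix
  Ix-coding = ×-coding ℤ-coding (List-coding ℕ-coding)

cmpᴵ : Ix → Ix → Comparison
cmpᴵ = cmp Ix-comparator

_≟ᴵ_ : (i j : Ix) → Dec (i ≡ j)
_≟ᴵ_ = ×ₚ.≡-dec ℤ._≟_ (Listₚ.≡-dec ℕ._≟_)

root : Ix
root = + 0 , []

is-root : Ix → Bool
is-root i = does (i ≟ᴵ root)

even : ℕ → Bool
even zero = true
even (suc n) = not (even n)

even-double : ∀ n → even (n + n) ≡ true
even-double zero = refl
even-double (suc n) rewrite ℕₚ.+-suc n n | Boolₚ.not-involutive (even (n + n)) = even-double n

opaque
  unfolding Ix-coding

  tag : Ix → ℕ
  tag i = enc Ix-coding i + enc Ix-coding i

  even-tag : ∀ i → even (tag i) ≡ true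
  even-tag i = even-double (enc Ix-coding i)

  untag : ℕ → Ix
  untag n = dec Ix-coding ℕ.⌊ n /2⌋

  untag-tag : ∀ i → untag (tag i) ≡ i
  untag-tag i = trans (cong (dec Ix-coding) (sym (ℕₚ.n≡⌊n+n/2⌋ (enc Ix-coding i)))) (dec-enc Ix-coding i)

  tag-injective : ∀ {i j} → tag i ≡ tag j → i ≡ j
  tag-injective {i} {j} e = trans (sym (untag-tag i)) (trans (cong untag e) (untag-tag j))

  tag-≥last : ∀ z l a → a ≤ tag (z , l ∷ʳ a)
  tag-≥last z l a = ℕₚ.≤-trans (List-enc-≥last ℕ-coding l a) (ℕₚ.≤-trans (pair-≥ʳ (enc ℤ-coding z) _) (ℕₚ.m≤m+n _ _))

last-entry : List ℕ → ℕ
last-entry [] = 0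
last-entry (a ∷ []) = a
last-entry (_ ∷ b ∷ l) = last-entry (b ∷ l)

last-entry-∷ʳ : ∀ l a → last-entry (l ∷ʳ a) ≡ a
last-entry-∷ʳ [] a = refl
last-entry-∷ʳ (_ ∷ []) a = refl
last-entry-∷ʳ (_ ∷ b ∷ l) a = last-entry-∷ʳ (b ∷ l) a

-- The last entry of an index carries a finite set of slots, a tree number and a number used only to make it large.
Datum-coding : Coding (List ℕ × ℕ × ℕ)
Datum-coding = ×-coding (List-coding ℕ-coding) (×-coding ℕ-coding ℕ-coding)

opaque
  datum : Ix → List ℕ × ℕ × ℕ
  datum (_ , l) = dec Datum-coding (last-entry l)

  datum-∷ʳ : ∀ z l a → datum (z , l ∷ʳ a) ≡ dec Datum-coding a
  datum-∷ʳ z l a = cong (dec Datum-coding) (last-entry-∷ʳ l a)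

  large-datum : ∀ F k b → Σ ℕ λ a → b ≤ a × dec Datum-coding a ≡ (F , k , b)
  large-datum F k b = enc Datum-coding (F , k , b) ,
    ℕₚ.≤-trans (pair-≥ʳ k b) (pair-≥ʳ (enc (List-coding ℕ-coding) F) (pair k b)) , dec-enc Datum-coding (F , k , b)

  -- Blocks may differ only in their marks, so the tree in a slot must depend on the slot number
  -- alone. Reading it off the index whose tag is that number provides slots with any given tree
  -- number arbitrarily far out.
  tree-number : ℕ → ℕ
  tree-number j = proj₁ (proj₂ (datum (untag j)))

  tree-number-tag : ∀ i → tree-number (tag i) ≡ proj₁ (proj₂ (datum i))
  tree-number-tag i = cong (λ i → proj₁ (proj₂ (datum i))) (untag-tag i)

member : ℕ → List ℕ → Bool
member j [] = false
member j (x ∷ l) = (j ≡ᵇ x) ∨ member j l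

-- The slots marked in block i; the largest one is tag i, so distinct blocks have distinct marks.
bit : Ix → ℕ → Bool
bit i j = not (is-root i) ∧ ((j ≡ᵇ tag i) ∨ ((j <ᵇ tag i) ∧ member j (proj₁ (datum i))))

support : ℕ → (ℕ → Bool) → List ℕ
support zero f = []
support (suc n) f = if f n then n ∷ support n f else support n f

T⇒true : ∀ {b} → T b → b ≡ true
T⇒true {true} _ = refl

true⇒T : ∀ {b} → b ≡ true → T b
true⇒T refl = tt

≡ᵇ-refl : ∀ n → (n ≡ᵇ n) ≡ true
≡ᵇ-refl n = T⇒true (ℕₚ.≡⇒≡ᵇ n n refl)

≡ᵇ-false : ∀ {m n} → m ≢ n → (m ≡ᵇ n) ≡ false
≡ᵇ-false {m} {n} ne with m ≡ᵇ n in e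
... | false = refl
... | true = ⊥-elim (ne (ℕₚ.≡ᵇ⇒≡ m n (true⇒T e)))

<ᵇ-true : ∀ {m n} → m < n → (m <ᵇ n) ≡ true
<ᵇ-true p = T⇒true (ℕₚ.<⇒<ᵇ p)

<ᵇ-false : ∀ {m n} → n ≤ m → (m <ᵇ n) ≡ false
<ᵇ-false {m} {n} p with m <ᵇ n in e
... | false = refl
... | true = ⊥-elim (ℕₚ.<⇒≱ (ℕₚ.<ᵇ⇒< m n (true⇒T e)) p)

member-support : ∀ n f j → j < n → member j (support n f) ≡ f j
member-support-≥ : ∀ n f j → n ≤ j → member j (support n f) ≡ false
member-support-≥ zero f j p = refl
member-support-≥ (suc n) f j p with f n
... | true rewrite ≡ᵇ-false {j} {n} (λ { refl → ℕₚ.<-irrefl refl p }) = member-support-≥ n f j (ℕₚ.<⇒≤ p)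
... | false = member-support-≥ n f j (ℕₚ.<⇒≤ p)
member-support (suc n) f j (s≤s p) with j ℕ.≟ n
member-support (suc n) f n (s≤s p) | yes refl with f n
... | true rewrite ≡ᵇ-refl n = refl
... | false = member-support-≥ n f n ℕₚ.≤-refl
member-support (suc n) f j (s≤s p) | no ne with f n
... | true rewrite ≡ᵇ-false ne = member-support n f j (ℕₚ.≤∧≢⇒< p ne)
... | false = member-support n f j (ℕₚ.≤∧≢⇒< p ne)

not-root : ∀ {i} → i ≢ root → is-root i ≡ false
not-root {i} ne with i ≟ᴵ root
... | yes e = ⊥-elim (ne e)
... | no _ = refl

bit-tag : ∀ {i} → i ≢ root → bit i (tag i) ≡ true
bit-tag {i} ne rewrite not-root ne | ≡ᵇ-refl (tag i) = refl

bit-above : ∀ i j → tag i < j → bit i j ≡ false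
bit-above i j p with is-root i
... | true = refl
... | false rewrite ≡ᵇ-false {j} {tag i} (λ { refl → ℕₚ.<-irrefl refl p }) | <ᵇ-false (ℕₚ.<⇒≤ p) = refl

-- Distinct blocks differ in the slot tagged by the larger one, unless that one is the root.
differing-slot : ∀ i i′ → i ≢ i′ → Σ ℕ λ t → even t ≡ true × bit i t ≢ bit i′ t
differing-slot i i′ ne = by-tag (ℕₚ.<-cmp (tag i) (tag i′))
  where
  from-larger : ∀ i i′ → i ≢ i′ → tag i < tag i′ → Dec (i′ ≡ root) → Σ ℕ λ t → even t ≡ true × bit i t ≢ bit i′ t
  from-larger i i′ ne p (no ¬r) = tag i′ , even-tag i′ , λ e → case trans (sym (bit-above i _ p)) (trans e (bit-tag ¬r)) of λ ()
  from-larger i i′ ne p (yes refl) = tag i , even-tag i , λ e → case trans (sym (bit-tag ne)) e of λ ()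
  by-tag : Tri (tag i < tag i′) (tag i ≡ tag i′) (tag i′ < tag i) → Σ ℕ λ t → even t ≡ true × bit i t ≢ bit i′ t
  by-tag (tri< p _ _) = from-larger i i′ ne p (i′ ≟ᴵ root)
  by-tag (tri≈ _ e _) = ⊥-elim (ne (tag-injective e))
  by-tag (tri> _ _ p) = let t , e , d = from-larger i′ i (ne ∘ sym) p (i ≟ᴵ root) in t , e , d ∘ sym

listᴵ : Comparator (List ℕ)
listᴵ = List-comparator (flip-comparator ℕ-comparator)

<-∷ʳ : ∀ l a → cmp listᴵ l (l ∷ʳ a) ≡ less
<-∷ʳ [] a = refl
<-∷ʳ (x ∷ l) a rewrite cmp-refl (flip-comparator ℕ-comparator) x = <-∷ʳ l a

-- If `m` continues `l`, its next entry is smaller than `a` and hence later in the flipped order; if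
-- `m` departs from `l` earlier, the appended entry does not matter.
∷ʳ-< : ∀ l m a → All (_< a) m → cmp listᴵ l m ≡ less → cmp listᴵ (l ∷ʳ a) m ≡ less
∷ʳ-< [] (c ∷ m) a (p ∷ _) e = ⊗-lessˡ (<⇒less ℕₚ.<-cmp p)
∷ʳ-< (x ∷ l) (c ∷ m) a (_ ∷ p) e with cmp ℕ-comparator c x
... | less = refl
... | same = ∷ʳ-< l m a p e

entries : List Ix → List ℕ
entries [] = []
entries ((_ , l) ∷ bs) = l ++ entries bs

entries-< : ∀ bs {b a} → All (_< a) (entries bs) → b ∈ bs → All (_< a) (proj₂ b)
entries-< ((_ , l) ∷ bs) p (here refl) = Allₚ.++⁻ˡ l p
entries-< ((_ , l) ∷ bs) p (there m) = entries-< bs (Allₚ.++⁻ʳ l p) m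

bound : List ℕ → ℕ
bound [] = 0
bound (x ∷ l) = suc x ⊔ bound l

bound-< : ∀ l a → bound l ≤ a → All (_< a) l
bound-< [] a p = []
bound-< (x ∷ l) a p =
  ℕₚ.≤-trans (ℕₚ.m≤m⊔n (suc x) (bound l)) p ∷ bound-< l a (ℕₚ.≤-trans (ℕₚ.m≤n⊔m (suc x) (bound l)) p)

record Variant (i′ : Ix) (k K : ℕ) (lo : Ix) (bs : List Ix) : Set where
  field
    index : Ix
    above : cmpᴵ lo index ≡ less
    below : ∀ {b} → b ∈ bs → cmpᴵ lo b ≡ less → cmpᴵ index b ≡ less
    nonroot : index ≢ root
    large : K ≤ tag index
    carries : tree-number (tag index) ≡ k
    new : bit i′ (tag index) ≡ false
    others : ∀ j → j ≢ tag index → bit index j ≡ bit i′ j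

bit-copy : ∀ {i i′} → i ≢ root → tag i′ < tag i → proj₁ (datum i) ≡ support (suc (tag i′)) (bit i′) →
  ∀ j → j ≢ tag i → bit i j ≡ bit i′ j
bit-copy {i} {i′} nonroot tag< e j ne rewrite not-root nonroot | ≡ᵇ-false ne | e with j ℕ.≤? tag i′
... | yes p rewrite <ᵇ-true (ℕₚ.≤-<-trans p tag<) = member-support (suc (tag i′)) (bit i′) j (s≤s p)
... | no ¬p rewrite member-support-≥ (suc (tag i′)) (bit i′) j (ℕₚ.≰⇒> ¬p) | Boolₚ.∧-zeroʳ (j <ᵇ tag i) =
      sym (bit-above i′ j (ℕₚ.≰⇒> ¬p))

∷ʳ-nonroot : ∀ z l a → (z , l ∷ʳ a) ≢ root
∷ʳ-nonroot z [] a ()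
∷ʳ-nonroot z (_ ∷ _) a ()

opaque
  unfolding Ix-comparator

  -- The block i′ can be imitated arbitrarily closely above lo by adding a single mark at a slot carrying tree k.
  variant : ∀ i′ k K lo bs → Variant i′ k K lo bs
  variant i′ k K lo@(z , l) bs = build (large-datum (support (suc (tag i′)) (bit i′)) k filler)
    where
    filler : ℕ
    -- Three demands: the slots below `K` remain untouched, all marks of `i′` lie below the new
    -- slot, and `a` exceeds all entries of `bs`, which keeps the new index below every member of
    -- `bs` that is above `lo`.
    filler = (K ⊔ suc (tag i′)) ⊔ bound (entries bs)
    build : (Σ ℕ λ a → filler ≤ a × dec Datum-coding a ≡ (support (suc (tag i′)) (bit i′) , k , filler)) → Variant i′ k K lo bs
    build (a , filler≤a , e) = record
      { index = i
      ; above = above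
      ; below = below
      ; nonroot = ∷ʳ-nonroot z l a
      ; large = ℕₚ.≤-trans (ℕₚ.m≤m⊔n K (suc (tag i′))) (ℕₚ.≤-trans (ℕₚ.m≤m⊔n _ _) a≤tag)
      ; carries = trans (tree-number-tag i) (cong (proj₁ ∘ proj₂) datum-i)
      ; new = bit-above i′ (tag i) tag<
      ; others = bit-copy (∷ʳ-nonroot z l a) tag< (cong proj₁ datum-i)
      }
      where
      i : Ix
      i = z , l ∷ʳ a
      a≤tag : filler ≤ tag i
      a≤tag = ℕₚ.≤-trans filler≤a (tag-≥last z l a)
      tag< : tag i′ < tag i
      tag< = ℕₚ.≤-trans (ℕₚ.m≤n⊔m K (suc (tag i′))) (ℕₚ.≤-trans (ℕₚ.m≤m⊔n _ _) a≤tag)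
      datum-i : datum i ≡ (support (suc (tag i′)) (bit i′) , k , filler)
      datum-i = trans (datum-∷ʳ z l a) e
      above : cmpᴵ lo i ≡ less
      above rewrite cmp-refl ℤ-comparator z = <-∷ʳ l a
      below : ∀ {b} → b ∈ bs → cmpᴵ lo b ≡ less → cmpᴵ i b ≡ less
      below {z′ , m} b∈ e with cmp ℤ-comparator z z′
      ... | less = refl
      ... | same = ∷ʳ-< l m a (entries-< bs (bound-< (entries bs) a (ℕₚ.≤-trans (ℕₚ.m≤n⊔m (K ⊔ suc (tag i′)) _) filler≤a)) b∈) e

  cmpᴵ-integers : ∀ {z z′} → cmpᴵ (z , []) (z′ , []) ≡ cmp ℤ-comparator z z′
  cmpᴵ-integers {z} {z′} with cmp ℤ-comparator z z′
  ... | less = refl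
  ... | same = refl
  ... | greater = refl

  cmpᴵ-translate : ∀ {z z′} d l l′ → cmpᴵ (z +ℤ d , l) (z′ +ℤ d , l′) ≡ cmpᴵ (z , l) (z′ , l′)
  cmpᴵ-translate {z} {z′} d l l′ = cong (_⊗ cmp listᴵ l l′) (translate (cmp ℤ-comparator z z′) refl)
    where
    translate : ∀ x → cmp ℤ-comparator z z′ ≡ x → cmp ℤ-comparator (z +ℤ d) (z′ +ℤ d) ≡ cmp ℤ-comparator z z′
    translate less e = trans (<⇒less ℤₚ.<-cmp (ℤₚ.+-monoˡ-< d (less⇒< ℤₚ.<-cmp {z} {z′} e))) (sym e)
    translate same e rewrite cmp-same ℤ-comparator z z′ e = trans (cmp-refl ℤ-comparator (z′ +ℤ d)) (sym (cmp-refl ℤ-comparator z′))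
    translate greater e = trans (trans (cmp-opp ℤ-comparator (z′ +ℤ d) (z +ℤ d)) (cong opposite
      (<⇒less ℤₚ.<-cmp (ℤₚ.+-monoˡ-< d (less⇒< ℤₚ.<-cmp {z′} {z} (trans (cmp-opp ℤ-comparator z z′) (cong opposite e))))))) (sym e)

  below-all : ∀ (bs : List Ix) → Σ Ix λ lo → ∀ {b} → b ∈ bs → cmpᴵ lo b ≡ less
  below-all [] = root , λ ()
  below-all ((z , l) ∷ bs) with below-all bs
  ... | (z₀ , l₀) , p = (lo , []) , λ { (here refl) → ⊗-lessˡ (<⇒less ℤₚ.<-cmp lo<z) ; (there m) → low m (p m) }
    where
    lo : ℤ
    lo = ℤ.pred (z₀ ℤ.⊓ z)
    lo<z : lo <ℤ z
    lo<z = ℤₚ.<-≤-trans (ℤₚ.i≤pred[j]⇒i<j ℤₚ.≤-refl) (ℤₚ.i⊓j≤j z₀ z)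
    lo<z₀ : lo <ℤ z₀
    lo<z₀ = ℤₚ.<-≤-trans (ℤₚ.i≤pred[j]⇒i<j ℤₚ.≤-refl) (ℤₚ.i⊓j≤i z₀ z)
    low : ∀ {b} → b ∈ bs → cmpᴵ (z₀ , l₀) b ≡ less → cmpᴵ (lo , []) b ≡ less
    low {b} m e = cmp-trans Ix-comparator (lo , []) (z₀ , l₀) b (⊗-lessˡ (<⇒less ℤₚ.<-cmp lo<z₀)) e

Compatible : List (Ix × Ix) → Set
Compatible [] = ⊤
Compatible ((i , i′) ∷ l) =
  All (λ q → cmpᴵ i (proj₁ q) ≡ cmpᴵ i′ (proj₂ q) × cmpᴵ i (proj₁ q) ≢ same) l × Compatible l

compatible-cmp : ∀ l → Compatible l → ∀ {p q} → p ∈ l → q ∈ l → cmpᴵ (proj₁ p) (proj₁ q) ≡ cmpᴵ (proj₂ p) (proj₂ q)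
compatible-cmp (p ∷ l) (a , c) (here refl) (here refl) =
  trans (cmp-refl Ix-comparator (proj₁ p)) (sym (cmp-refl Ix-comparator (proj₂ p)))
compatible-cmp (p ∷ l) (a , c) (here refl) (there n) = proj₁ (All.lookup a n)
compatible-cmp (p ∷ l) (a , c) {q} (there n) (here refl) =
  trans (cmp-opp Ix-comparator (proj₁ p) (proj₁ q)) (trans (cong opposite (proj₁ (All.lookup a n)))
    (sym (cmp-opp Ix-comparator (proj₂ p) (proj₂ q))))
compatible-cmp (p ∷ l) (a , c) (there m) (there n) = compatible-cmp l c m n

-- `lo` marks the gap among the first components that corresponds to the position of `i′`. It may
-- itself be one of them, hence `≢ greater`; the partner of `i′` is then placed immediately above
-- it.
Cut : List (Ix × Ix) → Ix → Ix → Set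
Cut l i′ lo = (∀ {p} → p ∈ l → cmpᴵ (proj₂ p) i′ ≡ less → cmpᴵ (proj₁ p) lo ≢ greater) ×
              (∀ {p} → p ∈ l → cmpᴵ (proj₂ p) i′ ≡ greater → cmpᴵ lo (proj₁ p) ≡ less)

cut : ∀ l → Compatible l → ∀ i′ → Σ Ix (Cut l i′)
cut l c i′ = let lo , p , q = go l (λ m → m) in lo , p , q
  where
  go : ∀ s → (∀ {p} → p ∈ s → p ∈ l) → Σ Ix λ lo →
    (∀ {p} → p ∈ s → cmpᴵ (proj₂ p) i′ ≡ less → cmpᴵ (proj₁ p) lo ≢ greater) ×
    (∀ {p} → p ∈ l → cmpᴵ (proj₂ p) i′ ≡ greater → cmpᴵ lo (proj₁ p) ≡ less)
  go [] s⊆ = let lo , b = below-all (map proj₁ l) in lo , (λ ()) , (λ m _ → b (∈ₚ.∈-map⁺ proj₁ m))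
  go ((a , a′) ∷ s) s⊆ with go s (s⊆ ∘ there) | cmpᴵ a′ i′ in e
  ... | lo , p , q | same = lo , (λ { (here refl) e′ → λ _ → case trans (sym e) e′ of λ () ; (there m) → p m }) , q
  ... | lo , p , q | greater = lo , (λ { (here refl) e′ → λ _ → case trans (sym e) e′ of λ () ; (there m) → p m }) , q
  ... | lo , p , q | less with cmpᴵ a lo in f
  ...   | less = lo , (λ { (here refl) _ g → case trans (sym f) g of λ () ; (there m) → p m }) , q
  ...   | same = lo , (λ { (here refl) _ g → case trans (sym f) g of λ () ; (there m) → p m }) , q
  ...   | greater = a , (λ { (here refl) _ g → case trans (sym (cmp-refl Ix-comparator a)) g of λ ()
                          ; (there {x = x} m) e′ g → p m e′ (above-lo m g) }) ,
                    (λ {x} m e′ → trans (compatible-cmp l c (s⊆ (here refl)) m)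
                       (cmp-trans Ix-comparator a′ i′ (proj₂ x) e (trans (cmp-opp Ix-comparator (proj₂ x) i′) (cong opposite e′))))
    where
    above-lo : ∀ {x} → x ∈ s → cmpᴵ (proj₁ x) a ≡ greater → cmpᴵ (proj₁ x) lo ≡ greater
    above-lo {x} m g = trans (cmp-opp Ix-comparator lo (proj₁ x)) (cong opposite
      (cmp-trans Ix-comparator lo a (proj₁ x) (trans (cmp-opp Ix-comparator a lo) (cong opposite f))
        (trans (cmp-opp Ix-comparator (proj₁ x) a) (cong opposite g))))

-- The linear orders

data Tree : Set where
  leaf : Tree
  node : (ℕ → Tree) → Tree

-- A world assigns to each slot n of each top-level block k a tree and one of its two variants.
World : Set
World = ℤ → ℕ → Tree × Bool

-- tree α true and tree α false are the two back-and-forth equivalent orders attached to α;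
-- they differ in the block root, which is missing from the former.
data Content : Set where
  top : World → Content
  tree : Tree → Bool → Content
  none : Content

Entry : Set
Entry = Ix × ℕ

Path : Set
Path = List Entry

allowed : Bool → Ix → Bool
allowed true i = not (is-root i)
allowed false i = true

null : ∀ {A : Set} → List A → Bool
null [] = true
null (_ ∷ _) = false

-- Slots of nodes are even and the single slot of a leaf block is odd and names the block.
entry-ok : Content → Ix → ℕ → Bool
entry-ok (top w) (k , l) n = null l ∧ even n
entry-ok (tree leaf x) i j = allowed x i ∧ (j ≡ᵇ suc (tag i))
entry-ok (tree (node f) x) i j = allowed x i ∧ even j
entry-ok none i j = false

sub : Content → Ix → ℕ → Content
sub (top w) (k , _) n = uncurry tree (w k n)
sub (tree leaf x) i j = none
sub (tree (node f) x) i j = tree (f (tree-number j)) (bit i j)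
sub none i j = none

valid : Content → Path → Bool
valid c [] = true
valid c ((i , j) ∷ π) = entry-ok c i j ∧ valid (sub c i j) π

content : Content → Path → Content
content c [] = c
content c ((i , j) ∷ π) = content (sub c i j) π

slots : Path → List ℕ
slots = map proj₂

opaque
  slots-code : List ℕ → ℕ
  slots-code = enc (List-coding ℕ-coding)

  slots-code-injective : ∀ {l m} → slots-code l ≡ slots-code m → l ≡ m
  slots-code-injective = enc-injective (List-coding ℕ-coding)

size : Path → ℕ
size π = slots-code (slots π)

Entry-comparator : Comparator Entry
Entry-comparator = ×-comparator Ix-comparator ℕ-comparator

Path-comparator : Comparator Path
Path-comparator = List-comparator Entry-comparator

cmpᴾ : Path → Path → Comparison
cmpᴾ = cmp Path-comparator

Raw : Set
Raw = Path × ℕ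

Raw-comparator : Comparator Raw
Raw-comparator = ×-comparator Path-comparator ℕ-comparator

opaque
  Raw-coding : Coding Raw
  Raw-coding = ×-coding (List-coding (×-coding Ix-coding ℕ-coding)) ℕ-coding

elem-ok : World → Raw → Bool
elem-ok w (π , p) = (not (null π) ∧ valid (top w) π) ∧ (p ≤ᵇ size π)

-- Every path is replaced by a finite cluster whose length makes the slots of the path visible in the bare order.
record Elem (w : World) : Set where
  constructor elem
  field
    raw : Raw
    ok : T (elem-ok w raw)
open Elem public

raw-injective : ∀ {w} {e e′ : Elem w} → raw e ≡ raw e′ → e ≡ e′
raw-injective {e = elem r o} {elem _ o′} refl = cong (elem r) (T-irrelevant o o′)

path : ∀ {w} → Elem w → Path
path e = proj₁ (raw e)

pos : ∀ {w} → Elem w → ℕ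
pos e = proj₂ (raw e)

∧-T⁻ : ∀ {a b} → T (a ∧ b) → T a × T b
∧-T⁻ {true} {true} t = tt , tt

∧-T⁺ : ∀ {a b} → T a → T b → T (a ∧ b)
∧-T⁺ {true} {true} _ _ = tt

origin : ∀ {w} → Elem w
origin = elem ((root , 0) ∷ [] , 0) tt

Elem-coding : ∀ w → Coding (Elem w)
Elem-coding w .enc e = enc Raw-coding (raw e)
Elem-coding w .dec n with T? (elem-ok w (dec Raw-coding n))
... | yes o = elem (dec Raw-coding n) o
... | no _ = origin
Elem-coding w .dec-enc (elem r o) with T? (elem-ok w (dec Raw-coding (enc Raw-coding r)))
... | yes o′ = raw-injective (dec-enc Raw-coding r)
... | no ¬o = ⊥-elim (¬o (subst (T ∘ elem-ok w) (sym (dec-enc Raw-coding r)) o))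

cmpᴱ : ∀ {w w′} → Elem w → Elem w′ → Comparison
cmpᴱ e e′ = cmp Raw-comparator (raw e) (raw e′)

structure : World → Str
structure w .Carrier = Elem w
structure w .R e e′ = cmpᴱ e e′ ≡ less
structure w .countable = enc (Elem-coding w) , enc-injective (Elem-coding w)

_≟ᶜ_ : (x y : Comparison) → Dec (x ≡ y)
less ≟ᶜ less = yes refl
less ≟ᶜ same = no λ ()
less ≟ᶜ greater = no λ ()
same ≟ᶜ less = no λ ()
same ≟ᶜ same = yes refl
same ≟ᶜ greater = no λ ()
greater ≟ᶜ less = no λ ()
greater ≟ᶜ same = no λ ()
greater ≟ᶜ greater = yes refl

R? : ∀ w (e e′ : Elem w) → Dec (R (structure w) e e′)
R? w e e′ = cmpᴱ e e′ ≟ᶜ less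

structure-linear : ∀ w → IsLinearOrder (structure w)
structure-linear w = record
  { isStrictPartialOrder = record
    { isEquivalence = Relation.Binary.PropositionalEquality.isEquivalence
    ; irrefl = λ { {e} refl p → case trans (sym p) (cmp-refl Raw-comparator (raw e)) of λ () }
    ; trans = λ {e} {e′} {e″} → cmp-trans Raw-comparator (raw e) (raw e′) (raw e″)
    ; <-resp-≈ = (λ { refl p → p }) , (λ { refl p → p })
    }
  ; compare = compare
  }
  where
  compare : Trichotomous _≡_ (R (structure w))
  compare e e′ with cmpᴱ e e′ in q
  ... | less = tri< refl (λ { refl → case trans (sym q) (cmp-refl Raw-comparator (raw e)) of λ () })
                (λ p → case trans (sym (trans (cmp-opp Raw-comparator (raw e) (raw e′)) (cong opposite q))) p of λ ())
  ... | same = tri≈ (λ ()) (raw-injective (cmp-same Raw-comparator (raw e) (raw e′) q))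
                (λ p → case trans (sym (trans (cmp-opp Raw-comparator (raw e) (raw e′)) (cong opposite q))) p of λ ())
  ... | greater = tri> (λ ()) (λ { refl → case trans (sym q) (cmp-refl Raw-comparator (raw e)) of λ () })
                (trans (cmp-opp Raw-comparator (raw e) (raw e′)) (cong opposite q))

allowed-nonroot : ∀ x {i} → i ≢ root → T (allowed x i)
allowed-nonroot true ne rewrite not-root ne = tt
allowed-nonroot false ne = tt

first-slot : Tree → Ix → ℕ
first-slot leaf i = suc (tag i)
first-slot (node f) i = 0

first-slot-ok : ∀ α x {i} → i ≢ root → T (valid (tree α x) ((i , first-slot α i) ∷ []))
first-slot-ok leaf x {i} ne = ∧-T⁺ (∧-T⁺ (allowed-nonroot x ne) (true⇒T (≡ᵇ-refl (tag i)))) tt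
first-slot-ok (node f) x ne = ∧-T⁺ (∧-T⁺ (allowed-nonroot x ne) tt) tt

larger : ∀ α x ρ → Σ Path λ ρ′ → T (valid (tree α x) ρ′) × cmpᴾ ρ ρ′ ≡ less
larger α x [] = ((+ 1 , []) , first-slot α (+ 1 , [])) ∷ [] , first-slot-ok α x (λ ()) , refl
larger α x ((i , j) ∷ ρ) = (index , first-slot α index) ∷ [] , first-slot-ok α x nonroot ,
  ⊗-lessˡ (⊗-lessˡ above)
  where open Variant (variant i 0 0 i [])

between-indices : ∀ {i i′} → cmpᴵ i i′ ≡ less → Σ Ix λ m → cmpᴵ i m ≡ less × cmpᴵ m i′ ≡ less × m ≢ root
between-indices {i} {i′} p = index , above , below (here refl) p , nonroot
  where open Variant (variant i 0 0 i (i′ ∷ []))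

-- Density of the paths makes the clusters recognisable: only points of one cluster can be adjacent.
-- Within a node block, `larger` goes beyond `p` without leaving its slot; in a leaf, two nonempty
-- paths that differ lie in different blocks, and there is a block between.
dense-tree : ∀ α x p q → T (valid (tree α x) p) → T (valid (tree α x) q) → cmpᴾ p q ≡ less →
  Σ Path λ r → T (valid (tree α x) r) × cmpᴾ p r ≡ less × cmpᴾ r q ≡ less
dense-tree α x [] ((i , j) ∷ q) vp vq e =
  let lo , b = below-all (i ∷ []) ; m , _ , u , ne = between-indices (b (here refl)) in
  (m , first-slot α m) ∷ [] , first-slot-ok α x ne , refl , ⊗-lessˡ (⊗-lessˡ u)
dense-tree α x ((i , j) ∷ p) ((i′ , j′) ∷ q) vp vq e with ⊗-less {cmp Entry-comparator (i , j) (i′ , j′)} e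
... | inj₁ e₁ with ⊗-less {cmpᴵ i i′} e₁
...   | inj₁ i< = let m , l , u , ne = between-indices i< in
        (m , first-slot α m) ∷ [] , first-slot-ok α x ne , ⊗-lessˡ (⊗-lessˡ l) , ⊗-lessˡ (⊗-lessˡ u)
dense-tree leaf x ((i , j) ∷ p) ((i′ , j′) ∷ q) vp vq e | inj₁ e₁ | inj₂ (i≡ , j<)
  with refl ← cmp-same Ix-comparator i i′ i≡
     | refl ← ℕₚ.≡ᵇ⇒≡ j (suc (tag i)) (proj₂ (∧-T⁻ {allowed x i} (proj₁ (∧-T⁻ vp))))
     | refl ← ℕₚ.≡ᵇ⇒≡ j′ (suc (tag i′)) (proj₂ (∧-T⁻ {allowed x i′} (proj₁ (∧-T⁻ vq))))
  = case trans (sym (cmp-refl ℕ-comparator (suc (tag i)))) j< of λ ()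
dense-tree (node f) x ((i , j) ∷ p) ((i′ , j′) ∷ q) vp vq e | inj₁ e₁ | inj₂ (i≡ , j<) =
  let ρ , vρ , p<ρ = larger (f (tree-number j)) (bit i j) p in
  (i , j) ∷ ρ , ∧-T⁺ (proj₁ (∧-T⁻ vp)) vρ , ⊗-lessʳ (cmp-refl Entry-comparator (i , j)) p<ρ , ⊗-lessˡ e₁
dense-tree leaf x ((i , j) ∷ p) ((i′ , j′) ∷ (_ ∷ q)) vp vq e | inj₂ (_ , e₂) = ⊥-elim (proj₂ (∧-T⁻ {allowed x i′ ∧ (j′ ≡ᵇ suc (tag i′))} vq))
dense-tree leaf x ((i , j) ∷ []) ((i′ , j′) ∷ []) vp vq e | inj₂ (_ , ())
dense-tree leaf x ((i , j) ∷ (_ ∷ _)) ((i′ , j′) ∷ []) vp vq e | inj₂ (_ , ())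
dense-tree (node f) x ((i , j) ∷ p) ((i′ , j′) ∷ q) vp vq e | inj₂ (e₁ , e₂)
  with refl ← cmp-same Entry-comparator (i , j) (i′ , j′) e₁ =
  let r , vr , l , u = dense-tree (f (tree-number j)) (bit i j) p q
        (proj₂ (∧-T⁻ {allowed x i ∧ even j} vp)) (proj₂ (∧-T⁻ {allowed x i ∧ even j} vq)) e₂ in
  (i , j) ∷ r , ∧-T⁺ (proj₁ (∧-T⁻ vp)) vr , ⊗-lessʳ e₁ l , ⊗-lessʳ e₁ u

dense-top : ∀ w p q → T (not (null p) ∧ valid (top w) p) → T (not (null q) ∧ valid (top w) q) → cmpᴾ p q ≡ less →
  Σ Path λ r → T (not (null r) ∧ valid (top w) r) × cmpᴾ p r ≡ less × cmpᴾ r q ≡ less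
dense-top w ((i@(k , l) , n) ∷ p) ((i′ , n′) ∷ q) vp vq e with ⊗-less {cmp Entry-comparator (i , n) (i′ , n′)} e
... | inj₁ e₁ = let ρ , vρ , p<ρ = larger (proj₁ (w k n)) (proj₂ (w k n)) p in
  (i , n) ∷ ρ , ∧-T⁺ (proj₁ (∧-T⁻ {null l ∧ even n} vp)) vρ , ⊗-lessʳ (cmp-refl Entry-comparator (i , n)) p<ρ , ⊗-lessˡ e₁
... | inj₂ (e₁ , e₂) with refl ← cmp-same Entry-comparator (i , n) (i′ , n′) e₁ =
  let r , vr , l< , u< = dense-tree (proj₁ (w k n)) (proj₂ (w k n)) p q
        (proj₂ (∧-T⁻ {null l ∧ even n} vp)) (proj₂ (∧-T⁻ {null l ∧ even n} vq)) e₂ in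
  (i , n) ∷ r , ∧-T⁺ (proj₁ (∧-T⁻ {null l ∧ even n} vp)) vr , ⊗-lessʳ e₁ l< , ⊗-lessʳ e₁ u<

-- Equivalence of the two variants of a tree

-- tree α true and tree α false satisfy the same Π sentences of rank hidden α.
hidden : Tree → Ord
hidden leaf = ozero
hidden (node f) = olim λ k → osuc (osuc (hidden (f k)))

-- The extra rank for (false , true): the next move is made in `tree α true`, which merely lacks a
-- block, so that it can be copied into `tree α false` and this round is free.
Equivalent : Ord → Tree → Bool → Bool → Set
Equivalent β α false true = β ≤ₒ osuc (hidden α)
Equivalent β α _ _ = β ≤ₒ hidden α

-- A position of the back-and-forth game between two contents, of remaining rank β, the next move being
-- made in the second one.
mutual
  data State (β : Ord) : Content → Content → Set where
    idem : ∀ {c} → State β c c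
    tops : ∀ {w w′} → (∀ k n → State β (uncurry tree (w k n)) (uncurry tree (w′ k n))) → State β (top w) (top w′)
    fresh : ∀ {α x x′} → Equivalent β α x x′ → State β (tree α x) (tree α x′)
    exhausted : ∀ {x x′} → β ≤ₒ ozero → State β (tree leaf x) (tree leaf x′)
    opened : ∀ {f x x′ l} → β ≤ₒ hidden (node f) → Compatible l → Matches β f x x′ l →
      State β (tree (node f) x) (tree (node f) x′)

  -- Once two blocks are matched, each of their slots carries a game of its own; blocks outside the
  -- list have not been entered.
  data Matches (β : Ord) (f : ℕ → Tree) (x x′ : Bool) : List (Ix × Ix) → Set where
    [] : Matches β f x x′ []
    match : ∀ {i i′ l} → T (allowed x i) → T (allowed x′ i′) →
      (∀ j → State β (tree (f (tree-number j)) (bit i j)) (tree (f (tree-number j)) (bit i′ j))) →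
      Matches β f x x′ l → Matches β f x x′ ((i , i′) ∷ l)

mutual
  -- The paths that count as played against each other. A content not yet entered (`fresh`) relates
  -- the empty path only; this one is related at every position, since it stands for the separator
  -- in front of the content.
  Related : ∀ {β c c′} → State β c c′ → Path → Path → Set
  Related s [] [] = ⊤
  Related s [] (_ ∷ _) = ⊥
  Related s (_ ∷ _) [] = ⊥
  Related s (e ∷ p) (e′ ∷ q) = Related∷ s e p e′ q

  Related∷ : ∀ {β c c′} → State β c c′ → Entry → Path → Entry → Path → Set
  Related∷ idem e p e′ q = e ≡ e′ × p ≡ q
  Related∷ (tops t) (i , j) p e′ q = (i , j) ≡ e′ × Related (t (proj₁ i) j) p q
  Related∷ (fresh _) e p e′ q = ⊥
  Related∷ (exhausted _) e p e′ q = e ≡ e′ × p ≡ q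
  Related∷ (opened _ _ ms) (i , j) p (i′ , j′) q = j ≡ j′ × Matched ms i i′ j p q

  Matched : ∀ {β f x x′ l} → Matches β f x x′ l → Ix → Ix → ℕ → Path → Path → Set
  Matched [] i i′ j p q = ⊥
  Matched (match {i₀} {i₀′} _ _ t ms) i i′ j p q = (i ≡ i₀ × i′ ≡ i₀′ × Related (t j) p q) ⊎ Matched ms i i′ j p q

Matched-∈ : ∀ {β f x x′ l} (ms : Matches β f x x′ l) {i i′ j p q} → Matched ms i i′ j p q → (i , i′) ∈ l
Matched-∈ (match _ _ t ms) (inj₁ (refl , refl , _)) = here refl
Matched-∈ (match _ _ t ms) (inj₂ m) = there (Matched-∈ ms m)

mutual
  Related-slots : ∀ {β c c′} (s : State β c c′) p q → Related s p q → slots p ≡ slots q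
  Related-slots s [] [] r = refl
  Related-slots idem (e ∷ p) (.e ∷ .p) (refl , refl) = refl
  Related-slots (tops t) ((i , j) ∷ p) (_ ∷ q) (refl , r) = cong (j ∷_) (Related-slots (t _ _) p q r)
  Related-slots (exhausted _) (e ∷ p) (.e ∷ .p) (refl , refl) = refl
  Related-slots (opened _ _ ms) ((i , j) ∷ p) (_ ∷ q) (refl , r) = cong (j ∷_) (Matched-slots ms p q r)

  Matched-slots : ∀ {β f x x′ l} (ms : Matches β f x x′ l) {i i′ j} p q → Matched ms i i′ j p q → slots p ≡ slots q
  Matched-slots (match _ _ t ms) {j = j} p q (inj₁ (_ , _ , r)) = Related-slots (t j) p q r
  Matched-slots (match _ _ t ms) p q (inj₂ m) = Matched-slots ms p q m

⊗-congˡ : ∀ {x y y′} → (x ≡ same → y ≡ y′) → x ⊗ y ≡ x ⊗ y′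
⊗-congˡ {less} h = refl
⊗-congˡ {same} h = h refl
⊗-congˡ {greater} h = refl

mutual
  Related-cmp : ∀ {β c c′} (s : State β c c′) p q p₂ q₂ → Related s p q → Related s p₂ q₂ → cmpᴾ p p₂ ≡ cmpᴾ q q₂
  Related-cmp s [] [] [] [] r r₂ = refl
  Related-cmp s [] [] (_ ∷ _) (_ ∷ _) r r₂ = refl
  Related-cmp s (_ ∷ _) (_ ∷ _) [] [] r r₂ = refl
  Related-cmp idem (e ∷ p) (.e ∷ .p) (e₂ ∷ p₂) (.e₂ ∷ .p₂) (refl , refl) (refl , refl) = refl
  Related-cmp (tops t) ((i , j) ∷ p) (_ ∷ q) ((i₂ , j₂) ∷ p₂) (_ ∷ q₂) (refl , r) (refl , r₂) =
    ⊗-congˡ {cmp Entry-comparator (i , j) (i₂ , j₂)} λ e →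
      let e′ = cmp-same Entry-comparator (i , j) (i₂ , j₂) e in
      Related-cmp (t (proj₁ i) j) p q p₂ q₂ r
        (subst (λ x → Related (t (proj₁ (proj₁ x)) (proj₂ x)) p₂ q₂) (sym e′) r₂)
  Related-cmp (exhausted _) (e ∷ p) (.e ∷ .p) (e₂ ∷ p₂) (.e₂ ∷ .p₂) (refl , refl) (refl , refl) = refl
  Related-cmp (opened {l = l} _ c ms) ((i , j) ∷ p) ((i′ , _) ∷ q) ((i₂ , j₂) ∷ p₂) ((i₂′ , _) ∷ q₂) (refl , r) (refl , r₂) =
    Matched-cmp ms c j j₂ p q p₂ q₂ r r₂

  Matched-cmp : ∀ {β f x x′ l} (ms : Matches β f x x′ l) → Compatible l → ∀ {i i′ i₂ i₂′} j j₂ p q p₂ q₂ →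
    Matched ms i i′ j p q → Matched ms i₂ i₂′ j₂ p₂ q₂ →
    cmpᴾ ((i , j) ∷ p) ((i₂ , j₂) ∷ p₂) ≡ cmpᴾ ((i′ , j) ∷ q) ((i₂′ , j₂) ∷ q₂)
  Matched-cmp (match {i} {i′} _ _ t ms) c j j₂ p q p₂ q₂ (inj₁ (refl , refl , r)) (inj₁ (refl , refl , r₂))
    rewrite cmp-refl Ix-comparator i | cmp-refl Ix-comparator i′ =
    ⊗-congˡ {cmp ℕ-comparator j j₂} λ e →
      Related-cmp (t j) p q p₂ q₂ r
        (subst (λ j → Related (t j) p₂ q₂) (sym (cmp-same ℕ-comparator j j₂ e)) r₂)
  Matched-cmp (match _ _ t ms) (a , c) {i} {i′} {i₂} {i₂′} j j₂ p q p₂ q₂ (inj₁ (refl , refl , r)) (inj₂ m₂)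
    with e , ne ← All.lookup a (Matched-∈ ms m₂) = far e ne
    where
    far : ∀ {x x′ y y′} → x ≡ x′ → x ≢ same → (x ⊗ cmp ℕ-comparator j j₂) ⊗ y ≡ (x′ ⊗ cmp ℕ-comparator j j₂) ⊗ y′
    far {less} refl ne = refl
    far {same} refl ne = ⊥-elim (ne refl)
    far {greater} refl ne = refl
  Matched-cmp (match _ _ t ms) (a , c) {i} {i′} {i₂} {i₂′} j j₂ p q p₂ q₂ (inj₂ m) (inj₁ (refl , refl , r₂))
    with e , ne ← All.lookup a (Matched-∈ ms m)
    rewrite cmp-opp Ix-comparator i₂ i | cmp-opp Ix-comparator i₂′ i′ = far e ne
    where
    far : ∀ {x x′ y y′} → x ≡ x′ → x ≢ same →
      (opposite x ⊗ cmp ℕ-comparator j j₂) ⊗ y ≡ (opposite x′ ⊗ cmp ℕ-comparator j j₂) ⊗ y′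
    far {less} refl ne = refl
    far {same} refl ne = ⊥-elim (ne refl)
    far {greater} refl ne = refl
  Matched-cmp (match _ _ t ms) (a , c) j j₂ p q p₂ q₂ (inj₂ m) (inj₂ m₂) = Matched-cmp ms c j j₂ p q p₂ q₂ m m₂

Equivalent-mono : ∀ {β β′} α x x′ → β′ ≤ₒ β → Equivalent β α x x′ → Equivalent β′ α x x′
Equivalent-mono {β} {β′} α false true p q = ≤ₒ-trans β′ β _ p q
Equivalent-mono {β} {β′} α false false p q = ≤ₒ-trans β′ β _ p q
Equivalent-mono {β} {β′} α true true p q = ≤ₒ-trans β′ β _ p q
Equivalent-mono {β} {β′} α true false p q = ≤ₒ-trans β′ β _ p q

mutual
  lower : ∀ β β′ {c c′} → β′ ≤ₒ β → State β c c′ → State β′ c c′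
  lower β β′ p idem = idem
  lower β β′ p (tops t) = tops λ k n → lower β β′ p (t k n)
  lower β β′ p (fresh {α} {x} {x′} q) = fresh (Equivalent-mono {β} {β′} α x x′ p q)
  lower β β′ p (exhausted q) = exhausted (≤ₒ-trans β′ β ozero p q)
  lower β β′ p (opened {f} q c ms) = opened (≤ₒ-trans β′ β (hidden (node f)) p q) c (lowerᴹ β β′ p ms)

  lowerᴹ : ∀ β β′ {f x x′ l} → β′ ≤ₒ β → Matches β f x x′ l → Matches β′ f x x′ l
  lowerᴹ β β′ p [] = []
  lowerᴹ β β′ p (match a a′ t ms) = match a a′ (λ j → lower β β′ p (t j)) (lowerᴹ β β′ p ms)

mutual
  Related-lower : ∀ β β′ {c c′} (p : β′ ≤ₒ β) (s : State β c c′) π ρ → Related s π ρ → Related (lower β β′ p s) π ρ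
  Related-lower β β′ p s [] [] r = tt
  Related-lower β β′ p idem (_ ∷ _) (_ ∷ _) r = r
  Related-lower β β′ p (tops t) (_ ∷ π) (_ ∷ ρ) (e , r) = e , Related-lower β β′ p (t _ _) π ρ r
  Related-lower β β′ p (exhausted _) (_ ∷ _) (_ ∷ _) r = r
  Related-lower β β′ p (opened _ _ ms) (_ ∷ π) (_ ∷ ρ) (e , r) = e , Matched-lower β β′ p ms π ρ r

  Matched-lower : ∀ β β′ {f x x′ l} (p : β′ ≤ₒ β) (ms : Matches β f x x′ l) {i i′ j} π ρ →
    Matched ms i i′ j π ρ → Matched (lowerᴹ β β′ p ms) i i′ j π ρ
  Matched-lower β β′ p (match _ _ t ms) {j = j} π ρ (inj₁ (e , e′ , r)) = inj₁ (e , e′ , Related-lower β β′ p (t j) π ρ r)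
  Matched-lower β β′ p (match _ _ t ms) π ρ (inj₂ m) = inj₂ (Matched-lower β β′ p ms π ρ m)

_≟ᵉ_ : (e e′ : Entry) → Dec (e ≡ e′)
_≟ᵉ_ = ×ₚ.≡-dec _≟ᴵ_ ℕ._≟_

tails : Entry → List Path → List Path
tails e [] = []
tails e ([] ∷ qs) = tails e qs
tails e ((e′ ∷ q) ∷ qs) with e ≟ᵉ e′
... | yes _ = q ∷ tails e qs
... | no _ = tails e qs

∈-tails⁺ : ∀ {e q} qs → (e ∷ q) ∈ qs → q ∈ tails e qs
∈-tails⁺ {e} (_ ∷ qs) (here refl) with e ≟ᵉ e
... | yes _ = here refl
... | no ne = ⊥-elim (ne refl)
∈-tails⁺ ([] ∷ qs) (there m) = ∈-tails⁺ qs m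
∈-tails⁺ {e} ((e′ ∷ _) ∷ qs) (there m) with e ≟ᵉ e′
... | yes _ = there (∈-tails⁺ qs m)
... | no _ = ∈-tails⁺ qs m

∈-tails⁻ : ∀ {e q} qs → q ∈ tails e qs → (e ∷ q) ∈ qs
∈-tails⁻ ([] ∷ qs) m = there (∈-tails⁻ qs m)
∈-tails⁻ {e} ((e′ ∷ _) ∷ qs) m with e ≟ᵉ e′
∈-tails⁻ ((e′ ∷ _) ∷ qs) (here refl) | yes refl = here refl
∈-tails⁻ ((e′ ∷ _) ∷ qs) (there m) | yes refl = there (∈-tails⁻ qs m)
... | no _ = there (∈-tails⁻ qs m)

swapᴸ : List (Ix × Ix) → List (Ix × Ix)
swapᴸ [] = []
swapᴸ ((i , i′) ∷ l) = (i′ , i) ∷ swapᴸ l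

swapᴸ-∈ : ∀ l {i i′} → (i′ , i) ∈ swapᴸ l → (i , i′) ∈ l
swapᴸ-∈ (_ ∷ l) (here refl) = here refl
swapᴸ-∈ (_ ∷ l) (there m) = there (swapᴸ-∈ l m)

swapᴸ-compatible : ∀ l → Compatible l → Compatible (swapᴸ l)
swapᴸ-compatible [] c = tt
swapᴸ-compatible (_ ∷ l) (a , c) =
  All.tabulate (λ m →
    let e , ne = All.lookup a (swapᴸ-∈ l m) in sym e , λ s → ne (trans e s)) ,
  swapᴸ-compatible l c

_∈?ᴵ_ : ∀ i (l : List (Ix × Ix)) → Dec (i ∈ map proj₁ l)
i ∈?ᴵ l = ∈?._∈?_ _≟ᴵ_ i (map proj₁ l)

cmp-nonsame : ∀ {A} (c : Comparator A) {a b} → a ≢ b → cmp c a b ≢ same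
cmp-nonsame c ne e = ne (cmp-same c _ _ e)

cut-cmp : ∀ l i′ lo i {a a′} → Cut l i′ lo → cmpᴵ lo i ≡ less →
  (∀ {b} → b ∈ map proj₁ l → cmpᴵ lo b ≡ less → cmpᴵ i b ≡ less) →
  (a , a′) ∈ l → cmpᴵ a′ i′ ≢ same → cmpᴵ a i ≡ cmpᴵ a′ i′
cut-cmp l i′ lo i {a} {a′} (p , q) above below m ne with cmpᴵ a′ i′ in e
... | same = ⊥-elim (ne refl)
... | greater = trans (cmp-opp Ix-comparator i a) (cong opposite (below (∈ₚ.∈-map⁺ proj₁ m) (q m e)))
... | less with cmpᴵ a lo in f
...   | less = cmp-trans Ix-comparator a lo i f above
...   | same = trans (cong (λ x → cmpᴵ x i) (cmp-same Ix-comparator a lo f)) above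
...   | greater = ⊥-elim (p m e f)

idem′ : ∀ {β α b b′} → b ≡ b′ → State β (tree α b) (tree α b′)
idem′ refl = idem

Related-idem : ∀ {β c} q → Related (idem {β} {c}) q q
Related-idem [] = tt
Related-idem (_ ∷ _) = refl , refl

Related-idem′ : ∀ {β α b b′} (e : b ≡ b′) q → Related (idem′ {β} {α} e) q q
Related-idem′ refl q = Related-idem q

first-slots : List Path → List ℕ
first-slots [] = []
first-slots ([] ∷ qs) = first-slots qs
first-slots (((_ , j) ∷ _) ∷ qs) = j ∷ first-slots qs

∈-first-slots : ∀ qs {i j q} → ((i , j) ∷ q) ∈ qs → j ∈ first-slots qs
∈-first-slots (_ ∷ qs) (here refl) = here refl
∈-first-slots ([] ∷ qs) (there m) = ∈-first-slots qs m
∈-first-slots (((_ , _) ∷ _) ∷ qs) (there m) = there (∈-first-slots qs m)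

first-indices : List Path → List Ix
first-indices [] = []
first-indices ([] ∷ qs) = first-indices qs
first-indices (((i , _) ∷ _) ∷ qs) = i ∷ first-indices qs

∈-first-indices : ∀ qs {i j q} → ((i , j) ∷ q) ∈ qs → i ∈ first-indices qs
∈-first-indices (_ ∷ qs) (here refl) = here refl
∈-first-indices ([] ∷ qs) (there m) = ∈-first-indices qs m
∈-first-indices (((_ , _) ∷ _) ∷ qs) (there m) = there (∈-first-indices qs m)

first-indices-∈ : ∀ qs {i} → i ∈ first-indices qs → Σ ℕ λ j → Σ Path λ q → ((i , j) ∷ q) ∈ qs
first-indices-∈ ([] ∷ qs) m = let j , q , n = first-indices-∈ qs m in j , q , there n
first-indices-∈ (((_ , j) ∷ q) ∷ qs) (here refl) = j , q , here refl
first-indices-∈ (((_ , _) ∷ _) ∷ qs) (there m) = let j , q , n = first-indices-∈ qs m in j , q , there n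

module _ {β : Ord} {f : ℕ → Tree} {x x′ : Bool} (qs : List Path) (Good : Ix → Ix → Set) where
  Covered : ∀ {l} → Matches β f x x′ l → Set
  Covered {l} ms = ∀ {i j q} → ((i , j) ∷ q) ∈ qs → i ∈ map proj₁ l →
    Σ Ix λ i′ → Σ Path λ p → T (allowed x′ i′) × T (valid (tree (f (tree-number j)) (bit i′ j)) p) × Matched ms i i′ j q p

  record Extension {l} (ms : Matches β f x x′ l) (hs : List Ix) : Set where
    field
      pairs : List (Ix × Ix)
      compatible : Compatible pairs
      matches : Matches β f x x′ pairs
      extends : ∀ {i i′ j p q} → Matched ms i i′ j p q → Matched matches i i′ j p q
      covered : Covered matches
      contains : ∀ {h} → h ∈ hs ⊎ h ∈ map proj₁ l → h ∈ map proj₁ pairs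

  record Partner (l : List (Ix × Ix)) (h : Ix) : Set where
    field
      index : Ix
      allowedˡ : T (allowed x h)
      allowedʳ : T (allowed x′ index)
      states : ∀ j → State β (tree (f (tree-number j)) (bit h j)) (tree (f (tree-number j)) (bit index j))
      copies : ∀ {j q} → ((h , j) ∷ q) ∈ qs → Related (states j) q q × bit h j ≡ bit index j
      consistent : All (λ q → cmpᴵ h (proj₁ q) ≡ cmpᴵ index (proj₂ q)) l
      good : Good h index

  -- Provides a partner for every block entered by the move, one after another. `Good` is the
  -- invariant on which the choice of partners may rely: nothing when variants are used, equality
  -- when the move is copied.
  extend : (valid-qs : ∀ {q} → q ∈ qs → T (valid (tree (node f) x) q)) →
    (∀ {l} → Compatible l → All (uncurry Good) l → ∀ {h} → h ∈ first-indices qs → ¬ (h ∈ map proj₁ l) → Partner l h) →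
    ∀ hs → (∀ {h} → h ∈ hs → h ∈ first-indices qs) → ∀ {l} → Compatible l → All (uncurry Good) l → (ms : Matches β f x x′ l) → Covered ms → Extension ms hs
  extend vq partner [] hs⊆ c g ms cov = record { pairs = _ ; compatible = c ; matches = ms ; extends = λ m → m ; covered = cov ; contains = λ { (inj₂ m) → m } }
  extend vq partner (h ∷ hs) hs⊆ {l} c g ms cov with h ∈?ᴵ l
  ... | yes m = record { pairs = pairs ; compatible = compatible ; matches = matches ; extends = extends ; covered = covered
                       ; contains = λ { (inj₁ (here refl)) → contains (inj₂ m) ; (inj₁ (there n)) → contains (inj₁ n) ; (inj₂ n) → contains (inj₂ n) } }
    where open Extension (extend vq partner hs (hs⊆ ∘ there) c g ms cov)
  ... | no ∉ = record { pairs = pairs ; compatible = compatible ; matches = matches ; extends = λ m → extends (inj₂ m) ; covered = covered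
                      ; contains = λ { (inj₁ (here refl)) → contains (inj₂ (here refl)) ; (inj₁ (there n)) → contains (inj₁ n) ; (inj₂ n) → contains (inj₂ (there n)) } }
    where
    open Partner (partner c g (hs⊆ (here refl)) ∉)
    c′ : Compatible ((h , index) ∷ l)
    c′ = All.tabulate (λ m → All.lookup consistent m ,
           cmp-nonsame Ix-comparator (λ e → ∉ (subst (_∈ map proj₁ l) (sym e) (∈ₚ.∈-map⁺ proj₁ m)))) , c
    cov′ : Covered (match allowedˡ allowedʳ states ms)
    cov′ {j = j} {q} m (here refl) = let r , e = copies m in
      index , q , allowedʳ , subst (λ b → T (valid (tree (f (tree-number j)) b) q)) e (proj₂ (∧-T⁻ {allowed x h ∧ even j} (vq m))) , inj₁ (refl , refl , r)
    cov′ m (there n) = let i′ , p , a , v , r = cov m n in i′ , p , a , v , inj₂ r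
    open Extension (extend vq partner hs (hs⊆ ∘ there) c′ (good ∷ g) (match allowedˡ allowedʳ states ms) cov′)

record Move {β c c′} (s : State (osuc β) c c′) (qs : List Path) : Set where
  field
    result : State β c′ c
    keeps : ∀ p q → Related s p q → Related result q p
    answers : ∀ {q} → q ∈ qs → Σ Path λ p → T (valid c p) × Related result q p

module _ {β : Ord} {f : ℕ → Tree} where
  entry-allowed : ∀ {x qs i} → (∀ {q} → q ∈ qs → T (valid (tree (node f) x) q)) → i ∈ first-indices qs → T (allowed x i)
  entry-allowed {x} {qs} {i} vq m = let j , q , n = first-indices-∈ qs m in
    proj₁ (∧-T⁻ {allowed x i} (proj₁ (∧-T⁻ {allowed x i ∧ even j} (vq n))))

  -- The bound on `osuc β` yields a `k` with `β ≤ₒ osuc (hidden (f k))`, and the additional mark is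
  -- put in a slot with tree `f k`. There `h` is unmarked and its partner marked, the favourable
  -- direction of `Equivalent`. The round spent here and the free round there are the two successors
  -- in `hidden`.
  variant-partner : ∀ {x x′ qs l h} → osuc β ≤ₒ hidden (node f) → (∀ {q} → q ∈ qs → T (valid (tree (node f) x) q)) →
    Compatible l → h ∈ first-indices qs → ¬ (h ∈ map proj₁ l) → Partner {β} {f} {x} {x′} qs (λ _ _ → ⊤) l h
  variant-partner {x} {x′} {qs} {l} {h} (k , q) vq c m ∉ = record
    { index = index
    ; allowedˡ = entry-allowed vq m
    ; allowedʳ = allowed-nonroot x′ nonroot
    ; states = states
    ; copies = λ {j} {q} n → copies j {q} (All.lookup (bound-< (first-slots qs) K ℕₚ.≤-refl) (∈-first-slots qs n))
    ; consistent = All.tabulate λ {p} n → trans (cmp-opp Ix-comparator (proj₁ p) h) (trans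
        (cong opposite (sym (cut-cmp (swapᴸ l) h lo index cut-lo above (λ b → below b) (swap-∈ n)
          (cmp-nonsame Ix-comparator λ e → ∉ (subst (_∈ map proj₁ l) e (∈ₚ.∈-map⁺ proj₁ n))))))
        (sym (cmp-opp Ix-comparator (proj₂ p) index)))
    ; good = tt
    }
    where
    -- Beyond every slot entered by the present move, so that the tails of the played paths can be
    -- copied literally.
    K = bound (first-slots qs)
    lo = proj₁ (cut (swapᴸ l) (swapᴸ-compatible l c) h)
    cut-lo = proj₂ (cut (swapᴸ l) (swapᴸ-compatible l c) h)
    open Variant (variant h k K lo (map proj₁ (swapᴸ l)))
    swap-∈ : ∀ {l p} → p ∈ l → (proj₂ p , proj₁ p) ∈ swapᴸ l
    swap-∈ (here refl) = here refl
    swap-∈ (there n) = there (swap-∈ n)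
    state : ∀ j → Dec (j ≡ tag index) → State β (tree (f (tree-number j)) (bit h j)) (tree (f (tree-number j)) (bit index j))
    state j (yes refl) rewrite new | bit-tag nonroot =
      fresh (subst (λ k → β ≤ₒ osuc (hidden (f k))) (sym carries) q)
    state j (no ne) = idem′ (sym (others j ne))
    states : ∀ j → State β (tree (f (tree-number j)) (bit h j)) (tree (f (tree-number j)) (bit index j))
    states j = state j (j ℕ.≟ tag index)
    copies : ∀ j {q} → j < K → Related (states j) q q × bit h j ≡ bit index j
    copies j {q} j<K with j ℕ.≟ tag index
    ... | yes refl = ⊥-elim (ℕₚ.<⇒≱ j<K large)
    ... | no ne = Related-idem′ (sym (others j ne)) q , sym (others j ne)

  identity-partner : ∀ {qs l h} → (∀ {q} → q ∈ qs → T (valid (tree (node f) true) q)) →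
    All (uncurry _≡_) l → h ∈ first-indices qs → Partner {β} {f} {true} {false} qs _≡_ l h
  identity-partner {h = h} vq diag m = record
    { index = h
    ; allowedˡ = entry-allowed vq m
    ; allowedʳ = tt
    ; states = λ j → idem
    ; copies = λ {_} {q} _ → Related-idem q , refl
    ; consistent = All.tabulate λ n → cong (cmpᴵ h) (All.lookup diag n)
    ; good = refl
    }

no-suc≤zero : ∀ {β} {A : Set} → osuc β ≤ₒ ozero → A
no-suc≤zero ()

valid-leaf-⊆ : ∀ q → T (valid (tree leaf true) q) → T (valid (tree leaf false) q)
valid-leaf-⊆ [] v = tt
valid-leaf-⊆ ((i , j) ∷ q) v =
  ∧-T⁺ (proj₂ (∧-T⁻ {allowed true i} (proj₁ (∧-T⁻ {allowed true i ∧ (j ≡ᵇ suc (tag i))} v)))) (proj₂ (∧-T⁻ {allowed true i ∧ (j ≡ᵇ suc (tag i))} v))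

module _ {β : Ord} {f : ℕ → Tree} {x x′ : Bool} where
  record Flip {l} (ms : Matches (osuc β) f x x′ l) (qs : List Path) : Set where
    field
      matches : Matches β f x′ x (swapᴸ l)
      keeps : ∀ {i i′ j p q} → Matched ms i i′ j p q → Matched matches i′ i j q p
      covered : Covered qs (λ _ _ → ⊤) matches

  node-move : ∀ {l} → osuc β ≤ₒ hidden (node f) → Compatible l → (ms : Matches (osuc β) f x x′ l) →
    (bound : osuc β ≤ₒ hidden (node f)) (c : Compatible l) → ∀ qs →
    (∀ {q} → q ∈ qs → T (valid (tree (node f) x′) q)) → Flip ms qs → Move (opened bound c ms) qs
  node-move {l} b c ms bound c₁ qs vq fl = record
    { result = opened (<⇒≤ₒ β (hidden (node f)) b) compatible matches
    ; keeps = keeps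
    ; answers = λ {q} → answers q
    }
    where
    module F = Flip fl
    open Extension (extend {x = x′} {x} qs (λ _ _ → ⊤) vq (λ c′ _ → variant-partner {x = x′} {x} b vq c′) (first-indices qs) (λ m → m)
      (swapᴸ-compatible l c) (All.tabulate (λ _ → tt)) F.matches F.covered)
    keeps : ∀ p q → Related (opened {l = l} bound c₁ ms) p q → Related (opened (<⇒≤ₒ β (hidden (node f)) b) compatible matches) q p
    keeps [] [] r = tt
    keeps (_ ∷ _) (_ ∷ _) (refl , r) = refl , extends (F.keeps r)
    answers : ∀ q → q ∈ qs → Σ Path λ p → T (valid (tree (node f) x) p) × Related (opened (<⇒≤ₒ β (hidden (node f)) b) compatible matches) q p
    answers [] m = [] , tt , tt
    answers ((i , j) ∷ q) m = let i′ , p , a , v , r = covered m (contains (inj₁ (∈-first-indices qs m))) in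
      (i′ , j) ∷ p ,
      ∧-T⁺ (∧-T⁺ a (proj₂ (∧-T⁻ {allowed x′ i} (proj₁ (∧-T⁻ {allowed x′ i ∧ even j} (vq m)))))) v ,
      refl , r

module _ {β : Ord} where
  -- The free round: each entered block is matched with itself. The hypothesis `e` reduces to
  -- `β ≤ₒ hidden α`, just what the following position, with the variants exchanged, requires.
  identity-move : ∀ α (e : Equivalent (osuc β) α false true) qs → (∀ {q} → q ∈ qs → T (valid (tree α true) q)) →
    Move (fresh {osuc β} {α} {false} {true} e) qs
  identity-move leaf e qs vq = record
    { result = exhausted e
    ; keeps = λ { [] [] r → tt ; [] (_ ∷ _) () ; (_ ∷ _) [] () ; (_ ∷ _) (_ ∷ _) () }
    ; answers = λ { {[]} m → [] , tt , tt ; {q@(_ ∷ _)} m → q , valid-leaf-⊆ q (vq m) , refl , refl }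
    }
  identity-move (node f) e qs vq = record
    { result = opened e compatible matches
    ; keeps = λ { [] [] r → tt ; [] (_ ∷ _) () ; (_ ∷ _) [] () ; (_ ∷ _) (_ ∷ _) () }
    ; answers = λ {q} → answers q
    }
    where
    open Extension (extend {β} {f} {true} {false} qs _≡_ vq (λ _ g m _ → identity-partner vq g m) (first-indices qs) (λ m → m) {[]} tt [] [] (λ _ ()))
    answers : ∀ q → q ∈ qs → Σ Path λ p → T (valid (tree (node f) false) p) × Related (opened {β} e compatible matches) q p
    answers [] m = [] , tt , tt
    answers ((i , j) ∷ q) m = let i′ , p , a , v , r = covered m (contains (inj₁ (∈-first-indices qs m))) in
      (i′ , j) ∷ p ,
      ∧-T⁺ (∧-T⁺ a (proj₂ (∧-T⁻ {allowed true i} (proj₁ (∧-T⁻ {allowed true i ∧ even j} (vq m)))))) v ,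
      refl , r

  fresh-move : ∀ α x x′ (e : Equivalent (osuc β) α x x′) → osuc β ≤ₒ hidden α → ∀ qs →
    (∀ {q} → q ∈ qs → T (valid (tree α x′) q)) → Move (fresh {osuc β} {α} {x} {x′} e) qs
  fresh-move leaf x x′ e b qs vq = no-suc≤zero {β} b
  fresh-move (node f) x x′ e b qs vq = record
    { result = result
    ; keeps = λ { [] [] r → tt ; [] (_ ∷ _) () ; (_ ∷ _) [] () ; (_ ∷ _) (_ ∷ _) () }
    ; answers = answers
    }
    where
    nothing-matched : Flip {β} {f} {x} {x′} [] qs
    nothing-matched = record { matches = [] ; keeps = λ () ; covered = λ _ () }
    open Move (node-move {β} {f} {x} {x′} {[]} b tt [] b tt qs vq nothing-matched)

  mutual
    move : ∀ {c c′} (s : State (osuc β) c c′) qs → (∀ {q} → q ∈ qs → T (valid c′ q)) → Move s qs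
    move idem qs vq = record
      { result = idem
      ; keeps = λ { [] [] r → tt ; [] (_ ∷ _) () ; (_ ∷ _) [] () ; (_ ∷ _) (_ ∷ _) (refl , refl) → refl , refl }
      ; answers = λ {q} m → q , vq m , Related-idem q }
    move (tops {w} {w′} t) qs vq = record
      { result = tops λ k n → Move.result (moves k n)
      ; keeps = λ { [] [] r → tt ; [] (_ ∷ _) () ; (_ ∷ _) [] () ; (_ ∷ p) (_ ∷ q) (refl , r) → refl , Move.keeps (moves _ _) p q r }
      ; answers = λ {q} → answers q }
      where
      vt : ∀ k n {q} → q ∈ tails ((k , []) , n) qs → T (valid (uncurry tree (w′ k n)) q)
      vt k n m = proj₂ (∧-T⁻ {even n} (vq (∈-tails⁻ qs m)))
      moves : ∀ k n → Move (t k n) (tails ((k , []) , n) qs)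
      moves k n = move (t k n) (tails ((k , []) , n) qs) (vt k n)
      answers : ∀ q → q ∈ qs → Σ Path λ p → T (valid (top w) p) × Related (tops λ k n → Move.result (moves k n)) q p
      answers [] m = [] , tt , tt
      answers (((k , []) , n) ∷ q) m = let p , v , r = Move.answers (moves k n) (∈-tails⁺ qs m) in
        ((k , []) , n) ∷ p , ∧-T⁺ (proj₁ (∧-T⁻ {even n} (vq m))) v , refl , r
      answers (((k , _ ∷ _) , n) ∷ q) m = ⊥-elim (vq m)
    move (fresh {α} {false} {true} e) qs vq = identity-move α e qs vq
    move (fresh {α} {false} {false} e) qs vq = fresh-move α false false e e qs vq
    move (fresh {α} {true} {true} e) qs vq = fresh-move α true true e e qs vq
    move (fresh {α} {true} {false} e) qs vq = fresh-move α true false e e qs vq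
    move (exhausted b) qs vq = no-suc≤zero {β} b
    move (opened b c ms) qs vq = node-move b c ms b c qs vq (flip-matches ms qs vq)

    flip-matches : ∀ {f x x′ l} (ms : Matches (osuc β) f x x′ l) qs → (∀ {q} → q ∈ qs → T (valid (tree (node f) x′) q)) → Flip ms qs
    flip-matches [] qs vq = record { matches = [] ; keeps = λ () ; covered = λ _ () }
    flip-matches {f} {x} {x′} (match {i} {i′} a a′ t ms) qs vq = record
      { matches = match a′ a (λ j → Move.result (moves j)) (Flip.matches rest)
      ; keeps = λ { {j = j} {p} {q} (inj₁ (refl , refl , r)) → inj₁ (refl , refl , Move.keeps (moves j) p q r) ; (inj₂ m) → inj₂ (Flip.keeps rest m) }
      ; covered = λ { {j = j} m (here refl) → let p , v , r = Move.answers (moves j) (∈-tails⁺ qs m) in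
                        i , p , a , v , inj₁ (refl , refl , r)
                    ; m (there n) → let k , p , a , v , r = Flip.covered rest m n in k , p , a , v , inj₂ r } }
      where
      rest = flip-matches ms qs vq
      vt : ∀ j {q} → q ∈ tails (i′ , j) qs → T (valid (tree (f (tree-number j)) (bit i′ j)) q)
      vt j m = proj₂ (∧-T⁻ {allowed x′ i′ ∧ even j} (vq (∈-tails⁻ qs m)))
      moves : ∀ j → Move (t j) (tails (i′ , j) qs)
      moves j = move (t j) (tails (i′ , j) qs) (vt j)

module _ {β : Ord} {w w′ : World} where
  Paired : State β (top w) (top w′) → Elem w → Elem w′ → Set
  Paired s e e′ = Related s (path e) (path e′) × pos e ≡ pos e′

  Paired-cmp : ∀ s e e′ d d′ → Paired s e e′ → Paired s d d′ → cmpᴱ e d ≡ cmpᴱ e′ d′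
  Paired-cmp s e e′ d d′ (r , p) (r′ , p′) =
    cong₂ _⊗_ (Related-cmp s (path e) (path e′) (path d) (path d′) r r′) (cong₂ (cmp ℕ-comparator) p p′)

cmpᴱ-≡ : ∀ {w} (e d : Elem w) → e ≡ d ⇔ cmpᴱ e d ≡ same
cmpᴱ-≡ e d = mk⇔ (λ { refl → cmp-refl Raw-comparator (raw e) }) (raw-injective ∘ cmp-same Raw-comparator (raw e) (raw d))

cmpᴱ-agree : ∀ {w w′} (e d : Elem w) (e′ d′ : Elem w′) → cmpᴱ e d ≡ cmpᴱ e′ d′ → Agree (structure w) (structure w′) (e , e′) (d , d′)
cmpᴱ-agree e d e′ d′ h =
  mk⇔ (λ p → trans (sym h) p) (λ p → trans h p) ,
  mk⇔ (λ p → Equivalence.from (cmpᴱ-≡ e′ d′) (trans (sym h) (Equivalence.to (cmpᴱ-≡ e d) p)))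
      (λ p → Equivalence.from (cmpᴱ-≡ e d) (trans h (Equivalence.to (cmpᴱ-≡ e′ d′) p)))

same-slots-null : ∀ {π ρ} → slots π ≡ slots ρ → null π ≡ null ρ
same-slots-null {[]} {[]} e = refl
same-slots-null {_ ∷ _} {_ ∷ _} e = refl

-- Related paths have the same slots, hence clusters of equal length, so the position within a
-- cluster can be copied.
state-preserves : ∀ β {w w′} (s : State β (top w) (top w′)) {n} (e : Vec (Elem w) n) (e′ : Vec (Elem w′) n) →
  (∀ i → Paired s (lookup e i) (lookup e′ i)) → Preserves β (structure w) (structure w′) e e′
state-preserves ozero s e e′ r i j = cmpᴱ-agree (lookup e i) (lookup e j) (lookup e′ i) (lookup e′ j) (Paired-cmp s (lookup e i) (lookup e′ i) (lookup e j) (lookup e′ j) (r i) (r j))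
state-preserves (osuc β) {w} {w′} s {n} e e′ r k v = u , state-preserves β result (v ++ᵛ e′) (u ++ᵛ e) (pointwise v (λ m → m))
  where
  paths : ∀ {k} → Vec (Elem w′) k → List Path
  paths [] = []
  paths (a ∷ v) = path a ∷ paths v
  paths-valid : ∀ {k} (v : Vec (Elem w′) k) {q} → q ∈ paths v → T (valid (top w′) q)
  paths-valid (a ∷ v) (here refl) = proj₂ (∧-T⁻ {not (null (path a))} (proj₁ (∧-T⁻ {not (null (path a)) ∧ valid (top w′) (path a)} (ok a))))
  paths-valid (a ∷ v) (there m) = paths-valid v m
  open Move (move s (paths v) (paths-valid v))
  respond : ∀ (a : Elem w′) → path a ∈ paths v → Σ (Elem w) λ b → Paired result a b
  respond a m = let p , vp , r = answers m ; sl = Related-slots result (path a) p r in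
    elem (p , pos a) (∧-T⁺ (∧-T⁺ (subst (T ∘ not) (same-slots-null {path a} {p} sl)
                                 (proj₁ (∧-T⁻ {not (null (path a))} (proj₁ (∧-T⁻ {not (null (path a)) ∧ valid (top w′) (path a)} (ok a)))))) vp)
                           (subst (λ l → T (pos a ≤ᵇ slots-code l)) sl
                             (proj₂ (∧-T⁻ {not (null (path a)) ∧ valid (top w′) (path a)} (ok a))))) , r , refl
  responds : ∀ {k} (v₁ : Vec (Elem w′) k) → (∀ {q} → q ∈ paths v₁ → q ∈ paths v) → Vec (Elem w) k
  responds [] ⊆ = []
  responds (a ∷ v₁) ⊆ = proj₁ (respond a (⊆ (here refl))) ∷ responds v₁ (⊆ ∘ there)
  u = responds v (λ m → m)
  pointwise : ∀ {k} (v₁ : Vec (Elem w′) k) (⊆ : ∀ {q} → q ∈ paths v₁ → q ∈ paths v) →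
    ∀ i → Paired result (lookup (v₁ ++ᵛ e′) i) (lookup (responds v₁ ⊆ ++ᵛ e) i)
  pointwise [] ⊆ i = keeps (path (lookup e i)) (path (lookup e′ i)) (proj₁ (r i)) , sym (proj₂ (r i))
  pointwise (a ∷ v₁) ⊆ fz = proj₂ (respond a (⊆ (here refl)))
  pointwise (a ∷ v₁) ⊆ (fs i) = pointwise v₁ (⊆ ∘ there) i
state-preserves (olim f) s e e′ r i = state-preserves (f i) (lower (olim f) (f i) (≤ₒ-lim f i) s) e e′
  λ j → Related-lower (olim f) (f i) (≤ₒ-lim f i) s (path (lookup e j)) (path (lookup e′ j)) (proj₁ (r j)) , proj₂ (r j)

-- Distinguishing the two variants of a tree

valid-++⁻ : ∀ c π ρ → T (valid c (π ++ ρ)) → T (valid c π) × T (valid (content c π) ρ)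
valid-++⁻ c [] ρ v = tt , v
valid-++⁻ c ((i , j) ∷ π) ρ v with a , b ← ∧-T⁻ {entry-ok c i j} v =
  let p , q = valid-++⁻ (sub c i j) π ρ b in ∧-T⁺ a p , q

valid-++⁺ : ∀ c π ρ → T (valid c π) → T (valid (content c π) ρ) → T (valid c (π ++ ρ))
valid-++⁺ c [] ρ v q = q
valid-++⁺ c ((i , j) ∷ π) ρ v q with a , b ← ∧-T⁻ {entry-ok c i j} v = ∧-T⁺ a (valid-++⁺ (sub c i j) π ρ b q)

content-++ : ∀ c π ρ → content c (π ++ ρ) ≡ content (content c π) ρ
content-++ c [] ρ = refl
content-++ c ((i , j) ∷ π) ρ = content-++ (sub c i j) π ρ

even-suc-false : ∀ {n} → T (even n) → T (even (suc n)) → ⊥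
even-suc-false {n} p q with even n
even-suc-false p () | true

entry-ok-even : ∀ c i {s} t → T (even s) → T (even t) → T (entry-ok c i s) → T (entry-ok c i t)
entry-ok-even (top w) (k , l) {s} t p q r = ∧-T⁺ (proj₁ (∧-T⁻ {null l} r)) q
entry-ok-even (tree leaf x) i {s} t p q r
  with refl ← ℕₚ.≡ᵇ⇒≡ s (suc (tag i)) (proj₂ (∧-T⁻ {allowed x i} r)) =
  ⊥-elim (even-suc-false {tag i} (true⇒T (even-tag i)) p)
entry-ok-even (tree (node f) x) i t p q r = ∧-T⁺ (proj₁ (∧-T⁻ {allowed x i} r)) q

null-∷ʳ : ∀ (π : Path) e ρ → T (not (null (π ++ e ∷ ρ)))
null-∷ʳ [] e ρ = tt
null-∷ʳ (_ ∷ π) e ρ = tt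

pt : ∀ {w} π → T (not (null π) ∧ valid (top w) π) → Elem w
pt π v = elem (π , 0) (∧-T⁺ v tt)

path-valid : ∀ {w} (e : Elem w) → T (not (null (path e)) ∧ valid (top w) (path e))
path-valid {w} e = proj₁ (∧-T⁻ {not (null (path e)) ∧ valid (top w) (path e)} (ok e))

pos≤size : ∀ {w} (e : Elem w) → pos e ≤ size (path e)
pos≤size {w} e = ℕₚ.≤ᵇ⇒≤ _ _ (proj₂ (∧-T⁻ {not (null (path e)) ∧ valid (top w) (path e)} (ok e)))

at : ∀ {w} (e : Elem w) q → q ≤ size (path e) → Elem w
at e q p = elem (path e , q) (∧-T⁺ (path-valid e) (ℕₚ.≤⇒≤ᵇ p))

less⇒greater : ∀ {A} (c : Comparator A) a b → cmp c a b ≡ less → cmp c b a ≡ greater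
less⇒greater c a b e = trans (cmp-opp c a b) (cong opposite e)

greater⇒less : ∀ {A} (c : Comparator A) a b → cmp c a b ≡ greater → cmp c b a ≡ less
greater⇒less c a b e = trans (cmp-opp c a b) (cong opposite e)

less-asym : ∀ {A} (c : Comparator A) a b → cmp c a b ≡ less → cmp c b a ≡ less → ⊥
less-asym c a b p q = case trans (sym (less⇒greater c a b p)) q of λ ()

module _ {w : World} where
  no-between : ∀ (e d f : Elem w) → path e ≡ path f → pos f ≡ suc (pos e) → cmpᴱ e d ≡ less → cmpᴱ d f ≡ less → ⊥
  no-between e d f pe qe l u with ⊗-less {cmpᴾ (path e) (path d)} l | ⊗-less {cmpᴾ (path d) (path f)} u
  ... | inj₁ a | inj₁ b rewrite pe = less-asym Path-comparator (path f) (path d) a b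
  ... | inj₁ a | inj₂ (b , _) rewrite pe | cmp-same Path-comparator (path d) (path f) b =
        case trans (sym a) (cmp-refl Path-comparator (path f)) of λ ()
  ... | inj₂ (a , _) | inj₁ b rewrite pe | cmp-same Path-comparator (path f) (path d) a =
        case trans (sym b) (cmp-refl Path-comparator (path d)) of λ ()
  ... | inj₂ (_ , a) | inj₂ (_ , b) = ℕₚ.<⇒≱ (less⇒< ℕₚ.<-cmp {pos e} {pos d} a)
        (ℕₚ.≤-pred (subst (pos d <_) qe (less⇒< ℕₚ.<-cmp {pos d} {pos f} b)))

  successor : ∀ (e f : Elem w) → cmpᴱ e f ≡ less →
    (path e ≡ path f × pos f ≡ suc (pos e)) ⊎ Σ (Elem w) λ d → cmpᴱ e d ≡ less × cmpᴱ d f ≡ less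
  successor e f l with ⊗-less {cmpᴾ (path e) (path f)} l
  ... | inj₁ a = let r , v , p , q = dense-top w (path e) (path f) (path-valid e) (path-valid f) a in
        inj₂ (pt r v , ⊗-lessˡ p , ⊗-lessˡ q)
  ... | inj₂ (a , b) with pos f ℕ.≟ suc (pos e)
  ...   | yes q = inj₁ (cmp-same Path-comparator (path e) (path f) a , q)
  ...   | no ¬q = inj₂ (d , ⊗-lessʳ (cmp-refl Path-comparator (path e)) (<⇒less ℕₚ.<-cmp (ℕₚ.n<1+n (pos e))) ,
                  ⊗-lessʳ a (<⇒less ℕₚ.<-cmp (ℕₚ.≤∧≢⇒< pe<pf (¬q ∘ sym))))
    where
    pe<pf : pos e < pos f
    pe<pf = less⇒< ℕₚ.<-cmp {pos e} {pos f} b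
    d : Elem w
    d = at e (suc (pos e)) (ℕₚ.≤-trans pe<pf (subst (λ π → pos f ≤ size π)
          (sym (cmp-same Path-comparator (path e) (path f) a)) (pos≤size f)))

-- Chains of equivalences, and what the clusters reveal

swapᵖ : ∀ {A B : Set} → A × B → B × A
swapᵖ (a , b) = b , a

-- Constructively, two ranks x and y need not have a usable minimum; a chain of two equivalences of these ranks,
-- through an arbitrary structure N, takes the place of an equivalence of rank min x y.
module Chains (N : Str) where
  record Chain (w w′ : World) (x y : Ord) (ps : List (Elem w × Elem w′)) : Set where
    constructor chain
    field
      {arity} : ℕ
      middle : Vec (Carrier N) arity
      left : Vec (Elem w) arity
      right : Vec (Elem w′) arity
      ends : ps ≡ zipᵛ left right
      bfˡ : Bf N (structure w) x (zipᵛ middle left)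
      bfʳ : Bf N (structure w′) y (zipᵛ middle right)

  zipᵛ-swap : ∀ {A B : Set} {k} (u : Vec A k) (v : Vec B k) → map swapᵖ (zipᵛ u v) ≡ zipᵛ v u
  zipᵛ-swap [] [] = refl
  zipᵛ-swap (a ∷ u) (b ∷ v) = cong ((b , a) ∷_) (zipᵛ-swap u v)

  module _ {w w′ : World} where
    chain-swap : ∀ {x y ps} → Chain w w′ x y ps → Chain w′ w y x (map swapᵖ ps)
    chain-swap (chain m l r e b b′) = chain m r l (trans (cong (map swapᵖ) e) (zipᵛ-swap l r)) b′ b

    chain-stepˡ : ∀ {x y ps} → Chain w w′ (osuc x) (osuc y) ps → ∀ {k} (u : Vec (Elem w) k) →
      Σ (Vec (Elem w′) k) λ u′ → Chain w w′ x y (zipᵛ u u′ ++ ps)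
    chain-stepˡ {x} {y} (chain m l r refl b b′) {k} u with proj₂ b k u
    ... | v , c with proj₁ b′ k v
    ... | u′ , c′ = u′ , chain (v ++ᵛ m) (u ++ᵛ l) (u′ ++ᵛ r) (sym (zipᵛ-++ u l u′ r))
          (subst (Bf N (structure w) x) (sym (zipᵛ-++ v m u l)) c)
          (subst (Bf N (structure w′) y) (sym (zipᵛ-++ v m u′ r)) c′)

    chain-stepʳ : ∀ {x y ps} → Chain w w′ (osuc x) (osuc y) ps → ∀ {k} (u′ : Vec (Elem w′) k) →
      Σ (Vec (Elem w) k) λ u → Chain w w′ x y (zipᵛ u u′ ++ ps)
    chain-stepʳ {x} {y} (chain m l r refl b b′) {k} u′ with proj₂ b′ k u′
    ... | v , c′ with proj₁ b k v
    ... | u , c = u , chain (v ++ᵛ m) (u ++ᵛ l) (u′ ++ᵛ r) (sym (zipᵛ-++ u l u′ r))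
          (subst (Bf N (structure w) x) (sym (zipᵛ-++ v m u l)) c)
          (subst (Bf N (structure w′) y) (sym (zipᵛ-++ v m u′ r)) c′)

    chain-mono : ∀ x y x′ y′ {ps} → x′ ≤ₒ x → y′ ≤ₒ y → Chain w w′ x y ps → Chain w w′ x′ y′ ps
    chain-mono x y x′ y′ p q (chain m l r e b b′) = chain m l r e (Bf-mono N _ x′ x _ p b) (Bf-mono N _ y′ y _ q b′)

    chain-⊆ : ∀ {x y ps} qs → (∀ {p} → p ∈ qs → p ∈ ps) → Chain w w′ x y ps → Chain w w′ x y qs
    chain-⊆ {x} {y} qs s (chain {k} m l r refl b b′) = go qs s (λ m n l r e ⊆ ⊆′ →
        chain m l r e (Bf-⊆ N _ x _ _ ⊆ b) (Bf-⊆ N _ y _ _ ⊆′ b′))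
      where
      go : ∀ qs → (∀ {p} → p ∈ qs → p ∈ zipᵛ l r) → ∀ {A : Set} →
        (∀ {n} (m′ : Vec (Carrier N) n) (_ : ℕ) l′ r′ → qs ≡ zipᵛ l′ r′ →
          (∀ {p} → p ∈ zipᵛ m′ l′ → p ∈ zipᵛ m l) → (∀ {p} → p ∈ zipᵛ m′ r′ → p ∈ zipᵛ m r) → A) → A
      go [] s k = k [] 0 [] [] refl (λ ()) (λ ())
      go (q ∷ qs) s k with ∈-zipᵛ l r (s (here refl))
      ... | i , refl = go qs (s ∘ there) λ m′ _ l′ r′ e ⊆ ⊆′ →
            k (lookup m i ∷ m′) 0 (lookup l i ∷ l′) (lookup r i ∷ r′) (cong (q ∷_) e)
              (λ { (here refl) → zipᵛ-∈ m l i ; (there n) → ⊆ n }) (λ { (here refl) → zipᵛ-∈ m r i ; (there n) → ⊆′ n })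

    chain-cmp : ∀ {x y ps} → Chain w w′ x y ps → ∀ {e e′ d d′} → (e , e′) ∈ ps → (d , d′) ∈ ps → cmpᴱ e d ≡ cmpᴱ e′ d′
    chain-cmp {x} {y} (chain m l r refl b b′) p q with ∈-zipᵛ l r p | ∈-zipᵛ l r q
    ... | i , refl | j , refl = compare (cmpᴱ (lookup l i) (lookup l j)) (cmpᴱ (lookup r i) (lookup r j)) refl refl
      where
      A = λ i j → Bf-agree N _ x _ b _ _ (zipᵛ-∈ m l i) (zipᵛ-∈ m l j)
      A′ = λ i j → Bf-agree N _ y _ b′ _ _ (zipᵛ-∈ m r i) (zipᵛ-∈ m r j)
      less⇒ : ∀ i j → cmpᴱ (lookup l i) (lookup l j) ≡ less → cmpᴱ (lookup r i) (lookup r j) ≡ less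
      less⇒ i j e = Equivalence.to (proj₁ (A′ i j)) (Equivalence.from (proj₁ (A i j)) e)
      same⇒ : ∀ i j → cmpᴱ (lookup l i) (lookup l j) ≡ same → cmpᴱ (lookup r i) (lookup r j) ≡ same
      same⇒ i j e = Equivalence.to (cmpᴱ-≡ (lookup r i) (lookup r j)) (Equivalence.to (proj₂ (A′ i j))
        (Equivalence.from (proj₂ (A i j)) (Equivalence.from (cmpᴱ-≡ (lookup l i) (lookup l j)) e)))
      compare : ∀ x y → cmpᴱ (lookup l i) (lookup l j) ≡ x → cmpᴱ (lookup r i) (lookup r j) ≡ y →
        cmpᴱ (lookup l i) (lookup l j) ≡ cmpᴱ (lookup r i) (lookup r j)
      compare less y p q = trans p (sym (less⇒ i j p))
      compare same y p q = trans p (sym (same⇒ i j p))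
      compare greater y p q = trans p (sym (less⇒greater Raw-comparator (raw (lookup r j)) (raw (lookup r i))
        (less⇒ j i (greater⇒less Raw-comparator (raw (lookup l i)) (raw (lookup l j)) p))))

    -- This takes the spare round: a point between `e′` and `f′` could be played and would need an
    -- answer between two neighbours of a cluster.
    chain-adjacent : ∀ {x y ps} → Chain w w′ (osuc x) (osuc y) ps → ∀ {e e′ f f′} → (e , e′) ∈ ps → (f , f′) ∈ ps →
      path e ≡ path f → pos f ≡ suc (pos e) → path e′ ≡ path f′ × pos f′ ≡ suc (pos e′)
    chain-adjacent c {e} {e′} {f} {f′} m n pe qe
      with successor e′ f′ (trans (sym (chain-cmp c m n))
        (⊗-lessʳ (subst (λ π → cmpᴾ (path e) π ≡ same) pe (cmp-refl Path-comparator (path e)))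
                 (<⇒less ℕₚ.<-cmp (subst (pos e <_) (sym qe) (ℕₚ.n<1+n (pos e))))))
    ... | inj₁ h = h
    ... | inj₂ (d , l , u) with chain-stepʳ c (d ∷ [])
    ... | d₀ ∷ [] , c′ = ⊥-elim (no-between e d₀ f pe qe
          (trans (chain-cmp c′ (there m) (here refl)) l) (trans (chain-cmp c′ (here refl) (there n)) u))

    descending : (e : Elem w) → ∀ p → p ≤ size (path e) → Vec (Elem w) p
    descending e zero q = []
    descending e (suc p) q = at e p (ℕₚ.<⇒≤ q) ∷ descending e p (ℕₚ.<⇒≤ q)

    pos-from-below : ∀ {x y ps} → Chain w w′ (osuc x) (osuc y) ps → (e : Elem w) → ∀ p q {d d′} (u : Vec (Elem w′) p) →
      (d , d′) ∈ ps → raw d ≡ (path e , p) → (∀ {r} → r ∈ zipᵛ (descending e p q) u → r ∈ ps) → p ≤ pos d′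
    pos-from-below c e zero q [] m h s = z≤n
    pos-from-below c e (suc p) q {d} {d′} (h′ ∷ u) m h s =
      let _ , b = chain-adjacent c (s (here refl)) m (sym (cong proj₁ h)) (cong proj₂ h) in
      subst (suc p ≤_) (sym b) (s≤s (pos-from-below c e p (ℕₚ.<⇒≤ q) u (s (here refl)) refl (s ∘ there)))

    ascending : (e : Elem w) → ∀ p c → p + c ≤ size (path e) → Vec (Elem w) c
    ascending e p zero q = []
    ascending e p (suc c) q = at e (suc p) (ℕₚ.≤-trans (s≤s (ℕₚ.m≤m+n p c)) (subst (_≤ size (path e)) (ℕₚ.+-suc p c) q))
      ∷ ascending e (suc p) c (subst (_≤ size (path e)) (ℕₚ.+-suc p c) q)

    size-from-above : ∀ {x y ps} → Chain w w′ (osuc x) (osuc y) ps → (e : Elem w) → ∀ p c q {d d′} (u : Vec (Elem w′) c) →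
      (d , d′) ∈ ps → raw d ≡ (path e , p) → (∀ {r} → r ∈ zipᵛ (ascending e p c q) u → r ∈ ps) → pos d′ + c ≤ size (path d′)
    size-from-above ch e p zero q {d′ = d′} [] m h s = subst (_≤ size (path d′)) (sym (ℕₚ.+-identityʳ (pos d′))) (pos≤size d′)
    size-from-above ch e p (suc c) q {d} {d′} (h′ ∷ u) m h s =
      let a , b = chain-adjacent ch m (s (here refl)) (cong proj₁ h) (cong suc (sym (cong proj₂ h)))
          r = size-from-above ch e (suc p) c _ u (s (here refl)) refl (s ∘ there) in
      subst₂ _≤_ (trans (cong (_+ c) b) (sym (ℕₚ.+-suc (pos d′) c))) (cong size (sym a)) r

    -- One round plays all points preceding `e` in its cluster at once; the other one is for
    -- adjacency, which makes the answers a run of neighbours ending in `e′`.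
    pos-≤ : ∀ {x y ps} → Chain w w′ (osuc (osuc x)) (osuc (osuc y)) ps → ∀ {e e′} → (e , e′) ∈ ps → pos e ≤ pos e′
    pos-≤ c {e} m with chain-stepˡ c (descending e (pos e) (pos≤size e))
    ... | u , c′ = pos-from-below c′ e (pos e) (pos≤size e) u (∈ₚ.∈-++⁺ʳ (zipᵛ (descending e (pos e) (pos≤size e)) u) m) refl ∈ₚ.∈-++⁺ˡ

    size-≤ : ∀ {x y ps} → Chain w w′ (osuc (osuc x)) (osuc (osuc y)) ps → ∀ {e e′} → (e , e′) ∈ ps →
      pos e ≡ pos e′ → size (path e) ≤ size (path e′)
    size-≤ c {e} {e′} m p≡ with chain-stepˡ c (ascending e (pos e) (size (path e) ∸ pos e) (ℕₚ.≤-reflexive (ℕₚ.m+[n∸m]≡n (pos≤size e))))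
    ... | u , c′ = subst (_≤ size (path e′)) (trans (cong (_+ (size (path e) ∸ pos e)) (sym p≡)) (ℕₚ.m+[n∸m]≡n (pos≤size e)))
          (size-from-above c′ e (pos e) _ _ u (∈ₚ.∈-++⁺ʳ (zipᵛ (ascending e (pos e) (size (path e) ∸ pos e) _) u) m) refl ∈ₚ.∈-++⁺ˡ)

  -- The length of a cluster codes the list of slots injectively, and both inequalities hold because
  -- a chain can be reversed. The cost is finite, so it is the same at all ranks.
  chain-visible : ∀ {w w′ x y ps} → Chain w w′ (osuc (osuc x)) (osuc (osuc y)) ps → ∀ {e e′} → (e , e′) ∈ ps →
    pos e ≡ pos e′ × slots (path e) ≡ slots (path e′)
  chain-visible c m = p , slots-code-injective (ℕₚ.≤-antisym (size-≤ c m p) (size-≤ (chain-swap c) (∈ₚ.∈-map⁺ swapᵖ m) (sym p)))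
    where p = ℕₚ.≤-antisym (pos-≤ c m) (pos-≤ (chain-swap c) (∈ₚ.∈-map⁺ swapᵖ m))

Ixs-comparator : Comparator (List Ix)
Ixs-comparator = List-comparator Ix-comparator

indices : Path → List Ix
indices = map proj₁

cmp-∷ʳ : ∀ π i j ρ i′ j′ → slots π ≡ slots ρ →
  cmpᴾ (π ∷ʳ (i , j)) (ρ ∷ʳ (i′ , j′)) ≡ cmp Ixs-comparator (indices π ∷ʳ i) (indices ρ ∷ʳ i′) ⊗ cmp ℕ-comparator j j′
cmp-∷ʳ [] i j [] i′ j′ e with cmpᴵ i i′
... | less = refl
... | same = ⊗-identityʳ (cmp ℕ-comparator j j′)
  where
  ⊗-identityʳ : ∀ x → x ⊗ same ≡ x
  ⊗-identityʳ less = refl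
  ⊗-identityʳ same = refl
  ⊗-identityʳ greater = refl
... | greater = refl
cmp-∷ʳ ((k , n) ∷ π) i j ((k′ , n′) ∷ ρ) i′ j′ e
  with refl ← Listₚ.∷-injectiveˡ e | h ← cmp-∷ʳ π i j ρ i′ j′ (Listₚ.∷-injectiveʳ e)
  rewrite cmp-refl ℕ-comparator n with cmpᴵ k k′
... | less = refl
... | same = h
... | greater = refl

same-indices : ∀ π ρ → slots π ≡ slots ρ → indices π ≡ indices ρ → π ≡ ρ
same-indices [] [] e f = refl
same-indices ((i , j) ∷ π) ((i′ , j′) ∷ ρ) e f
  with refl ← Listₚ.∷-injectiveˡ e | refl ← Listₚ.∷-injectiveˡ f =
  cong ((i , j) ∷_) (same-indices π ρ (Listₚ.∷-injectiveʳ e) (Listₚ.∷-injectiveʳ f))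

split-last : ∀ ρ l s → slots ρ ≡ l ∷ʳ s → Σ Path λ π → Σ Ix λ i → ρ ≡ π ∷ʳ (i , s) × slots π ≡ l
split-last [] [] s ()
split-last [] (_ ∷ _) s ()
split-last ((i , j) ∷ []) [] s e with refl ← Listₚ.∷-injectiveˡ e = [] , i , refl , refl
split-last ((i , j) ∷ (_ ∷ ρ)) [] s e with () ← Listₚ.∷-injectiveʳ e
split-last ((i , j) ∷ ρ) (n ∷ l) s e with refl ← Listₚ.∷-injectiveˡ e =
  let π , k , p , q = split-last ρ l s (Listₚ.∷-injectiveʳ e) in (i , j) ∷ π , k , cong ((i , j) ∷_) p , cong (j ∷_) q

slots-++ : ∀ π ρ → slots (π ++ ρ) ≡ slots π ++ slots ρ
slots-++ π ρ = Listₚ.map-++ proj₂ π ρ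

slots-∷ʳ-injective : ∀ π i s π′ i′ s′ → slots (π ∷ʳ (i , s)) ≡ slots (π′ ∷ʳ (i′ , s′)) → slots π ≡ slots π′ × s ≡ s′
slots-∷ʳ-injective π i s π′ i′ s′ e =
  Listₚ.∷ʳ-injective (slots π) (slots π′) (trans (sym (slots-++ π _)) (trans e (slots-++ π′ _)))

⊗-not-greater : ∀ {x y} → x ⊗ y ≢ greater → x ≢ greater
⊗-not-greater ne refl = ne refl

⊗-assoc : ∀ x y z → (x ⊗ y) ⊗ z ≡ x ⊗ y ⊗ z
⊗-assoc less y z = refl
⊗-assoc same y z = refl
⊗-assoc greater y z = refl

squeezed : ∀ {A} (c : Comparator A) a b {x y} → cmp c a b ⊗ x ≢ greater → cmp c b a ⊗ y ≡ less → a ≡ b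
squeezed c a b p q with cmp c a b in e
... | greater = ⊥-elim (p refl)
... | same = cmp-same c a b e
... | less rewrite less⇒greater c a b e = case q of λ ()

-- The two bounds agree up to the index `i`, so each entry of `w` up to there is squeezed; the slot
-- number following `i` is not, and is supplied by the list of slots instead.
sandwich : ∀ π {i s s′} w {ls} → cmpᴾ (π ∷ʳ (i , s)) w ≢ greater → cmpᴾ w (π ∷ʳ (i , s′)) ≡ less →
  slots w ≡ slots π ++ s ∷ ls → Σ Path λ ρ → w ≡ π ++ (i , s) ∷ ρ × slots ρ ≡ ls
sandwich [] {i} {s} {s′} ((k , t) ∷ w) p q e with refl ← Listₚ.∷-injectiveˡ e
  with refl ← squeezed Ix-comparator i k (⊗-not-greater p) (trans (sym (⊗-assoc (cmpᴵ k i) (cmp ℕ-comparator s s′) (list-cmp Entry-comparator w []))) q) =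
  w , refl , Listₚ.∷-injectiveʳ e
sandwich (e₀ ∷ π) (e₁ ∷ w) p q e
  with refl ← squeezed Entry-comparator e₀ e₁ p q
  rewrite cmp-refl Entry-comparator e₀ =
  let ρ , a , b = sandwich π w p q (Listₚ.∷-injectiveʳ e) in ρ , cong (e₀ ∷_) a , b

-- The rank needed to distinguish tree α true from tree α false in the symmetric game; its double, which is what
-- counts for formulas, exceeds hidden α by a finite amount only (visible-bound).
visible : Tree → Ord
visible leaf = ozero
visible (node f) = osuc (olim λ k → visible (f k))

-- e is the separator preceding the content of slot s of the block i at π.
IsSlot : ∀ {w} → Elem w → Path → Ix → ℕ → Set
IsSlot e π i s = raw e ≡ (π ∷ʳ (i , s) , 0)

select : Bool → Ord → Ord → Ord
select true a c = a
select false a c = c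

prefix-≤ : ∀ π x ρ → cmpᴾ (π ∷ʳ x) (π ++ x ∷ ρ) ≢ greater
prefix-≤ [] x ρ e rewrite cmp-refl Entry-comparator x with ρ
... | [] = case e of λ ()
... | _ ∷ _ = case e of λ ()
prefix-≤ (y ∷ π) x ρ e rewrite cmp-refl Entry-comparator y = prefix-≤ π x ρ e

next-slot-above : ∀ π i {s t} ρ → s < t → cmpᴾ (π ++ (i , s) ∷ ρ) (π ∷ʳ (i , t)) ≡ less
next-slot-above [] i ρ p = ⊗-lessˡ (⊗-lessʳ (cmp-refl Ix-comparator i) (<⇒less ℕₚ.<-cmp p))
next-slot-above (y ∷ π) i ρ p = ⊗-lessʳ (cmp-refl Entry-comparator y) (next-slot-above π i ρ p)

valid-other-slot : ∀ {w} π i s t → T (even s) → T (even t) →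
  T (valid (top w) (π ∷ʳ (i , s))) → T (not (null (π ∷ʳ (i , t))) ∧ valid (top w) (π ∷ʳ (i , t)))
valid-other-slot {w} π i s t p q v = let v₁ , v₂ = valid-++⁻ (top w) π ((i , s) ∷ []) v in
  ∧-T⁺ (null-∷ʳ π _ []) (valid-++⁺ (top w) π ((i , t) ∷ []) v₁
    (∧-T⁺ (entry-ok-even (content (top w) π) i {s} t p q (proj₁ (∧-T⁻ {entry-ok (content (top w) π) i s} v₂))) tt))

valid-extend : ∀ {w} π c ρ → T (valid (top w) π) → content (top w) π ≡ c → T (not (null ρ) ∧ valid c ρ) →
  T (not (null (π ++ ρ)) ∧ valid (top w) (π ++ ρ))
valid-extend {w} π _ (e ∷ ρ) v refl r = ∧-T⁺ (null-∷ʳ π e ρ) (valid-++⁺ (top w) π (e ∷ ρ) v r)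

even-+2 : ∀ s → T (even s) → T (even (suc (suc s)))
even-+2 s p rewrite Boolₚ.not-involutive (even s) = p

content-∷ʳ : ∀ c π e → content c (π ∷ʳ e) ≡ sub (content c π) (proj₁ e) (proj₂ e)
content-∷ʳ c π (i , j) = content-++ c π ((i , j) ∷ [])

module Comparison-by-chains (N : Str) where
  open Chains N public

  module _ {w w′ : World} where
    point-of : ∀ {x y ps} → Chain w w′ (osuc (osuc x)) (osuc (osuc y)) ps → ∀ {e e′} → (e , e′) ∈ ps → ∀ {π i s} → IsSlot e π i s →
      Σ Path λ π′ → Σ Ix λ i′ → IsSlot e′ π′ i′ s × slots π ≡ slots π′
    point-of c {e} {e′} m {π} {i} {s} h =
      let p , q = chain-visible c m
          π′ , i′ , a , b = split-last (path e′) (slots π) s (trans (sym q) (trans (cong (slots ∘ proj₁) h) (slots-++ π _))) in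
      π′ , i′ , cong₂ _,_ a (trans (sym p) (cong proj₂ h)) , sym b

    <-preserved : ∀ {x y ps} → Chain w w′ x y ps → ∀ {e e′ d d′} → (e , e′) ∈ ps → (d , d′) ∈ ps → pos d ≡ 0 → pos d′ ≡ 0 →
      cmpᴾ (path e) (path d) ≡ less → cmpᴾ (path e′) (path d′) ≡ less
    <-preserved c {e} {e′} {d} {d′} m n z z′ l with ⊗-less {cmpᴾ (path e′) (path d′)} (trans (sym (chain-cmp c m n)) (⊗-lessˡ l))
    ... | inj₁ a = a
    ... | inj₂ (_ , b) = ⊥-elim (ℕₚ.n≮0 (subst (pos e′ <_) z′ (less⇒< ℕₚ.<-cmp {pos e′} {pos d′} b)))

  cmpᴱ-points : ∀ {w} {e d : Elem w} {π ρ} → raw e ≡ (π , 0) → raw d ≡ (ρ , 0) → cmpᴱ e d ≡ cmpᴾ π ρ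
  cmpᴱ-points {π = π} {ρ} refl refl with cmpᴾ π ρ
  ... | less = refl
  ... | same = refl
  ... | greater = refl

  -- Separators of one block are matched with separators of one block: otherwise the first separator of the block
  -- of e′ would lie strictly between, and there is nothing in w to match it.
  block-preserved : ∀ {w w′ x y ps} → Chain w w′ (osuc (osuc (osuc x))) (osuc (osuc (osuc y))) ps →
    ∀ {b b′ e e′ π i π′ i′ s} → (b , b′) ∈ ps → (e , e′) ∈ ps → IsSlot b π i 0 → IsSlot b′ π′ i′ 0 →
    IsSlot e π i s → T (even s) → IsSlot e′ π′ i′ s
  block-preserved {w} {w′} {x} {y} {ps} c {b} {b′} {e} {e′} {π} {i} {π′} {i′} {zero} m n hb hb′ he ev =
    trans (cong raw (Equivalence.from (cmpᴱ-≡ e′ b′) (trans (sym (chain-cmp c n m))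
      (trans (cmpᴱ-points {e = e} {b} he hb) (cmp-refl Path-comparator (π ∷ʳ (i , 0))))))) hb′
  block-preserved {w} {w′} {x} {y} {ps} c {b} {b′} {e} {e′} {π} {i} {π′} {i′} {suc s} m n hb hb′ he ev
    with point-of {w} {w′} {osuc x} {osuc y} c n {π} {i} he
       | slots-∷ʳ-injective π i 0 π′ i′ 0 (trans (sym (cong (slots ∘ proj₁) hb)) (trans (proj₂ (chain-visible {x = osuc x} {osuc y} c m)) (cong (slots ∘ proj₁) hb′)))
  ... | π″ , i″ , he′ , sl | sl′ , _ = by-order (cmp Ixs-comparator (indices π′ ∷ʳ i′) (indices π″ ∷ʳ i″)) refl
    where
    sl″ : slots π′ ≡ slots π″
    sl″ = trans (sym sl′) sl
    b<e : cmpᴱ b e ≡ less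
    b<e = trans (cmpᴱ-points {e = b} {e} hb he) (trans (cmp-∷ʳ π i 0 π i (suc s) refl)
      (⊗-lessʳ (cmp-refl Ixs-comparator (indices π ∷ʳ i)) refl))
    b′<e′ : cmp Ixs-comparator (indices π′ ∷ʳ i′) (indices π″ ∷ʳ i″) ⊗ less ≡ less
    b′<e′ = trans (sym (cmp-∷ʳ π′ i′ 0 π″ i″ (suc s) sl″)) (trans (sym (cmpᴱ-points {e = b′} {e′} hb′ he′)) (trans (sym (chain-cmp c m n)) b<e))
    start-valid : T (not (null (π″ ∷ʳ (i″ , 0))) ∧ valid (top w′) (π″ ∷ʳ (i″ , 0)))
    start-valid =
      let v = proj₂ (∧-T⁻ {not (null (path e′))} (path-valid e′))
          v₁ , v₂ = valid-++⁻ (top w′) π″ ((i″ , suc s) ∷ []) (subst (T ∘ valid (top w′)) (cong proj₁ he′) v) in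
      ∧-T⁺ (null-∷ʳ π″ _ []) (valid-++⁺ (top w′) π″ ((i″ , 0) ∷ []) v₁
        (∧-T⁺ (entry-ok-even (content (top w′) π″) i″ {suc s} 0 ev tt (proj₁ (∧-T⁻ {entry-ok (content (top w′) π″) i″ (suc s)} v₂))) tt))
    start : Elem w′
    start = pt (π″ ∷ʳ (i″ , 0)) start-valid
    nothing-between : cmp Ixs-comparator (indices π′ ∷ʳ i′) (indices π″ ∷ʳ i″) ≡ less → ⊥
    nothing-between l with chain-stepʳ c (start ∷ [])
    ... | d ∷ [] , c′ with point-of {w′} {w} {y} {x} (chain-swap c′) (∈ₚ.∈-map⁺ swapᵖ (here refl)) {π″} {i″} {0} refl
    ... | ρ , k , hd , sd =
      less-asym Ixs-comparator (indices π ∷ʳ i) (indices ρ ∷ʳ k) b<d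
        (not-same (trans (sym (cmp-∷ʳ ρ k 0 π i (suc s) (sym (trans sl sd)))) (trans (sym (cmpᴱ-points {e = d} {e} hd he))
          (trans (chain-cmp c′ (here refl) (there n)) (trans (cmpᴱ-points {e = start} {e′} refl he′)
            (trans (cmp-∷ʳ π″ i″ 0 π″ i″ (suc s) refl) (⊗-lessʳ (cmp-refl Ixs-comparator (indices π″ ∷ʳ i″)) refl)))))))
      where
      ⊗-same-less : ∀ {x} → x ⊗ same ≡ less → x ≡ less
      ⊗-same-less {less} e = refl
      b<d : cmp Ixs-comparator (indices π ∷ʳ i) (indices ρ ∷ʳ k) ≡ less
      b<d = ⊗-same-less (trans (sym (cmp-∷ʳ π i 0 ρ k 0 (trans sl sd))) (trans (sym (cmpᴱ-points {e = b} {d} hb hd))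
          (trans (chain-cmp c′ (there m) (here refl)) (trans (cmpᴱ-points {e = b′} {start} hb′ refl)
            (trans (cmp-∷ʳ π′ i′ 0 π″ i″ 0 sl″) (⊗-lessˡ l))))))
      not-same : cmp Ixs-comparator (indices ρ ∷ʳ k) (indices π ∷ʳ i) ⊗ less ≡ less → cmp Ixs-comparator (indices ρ ∷ʳ k) (indices π ∷ʳ i) ≡ less
      not-same h rewrite less⇒greater Ixs-comparator (indices π ∷ʳ i) (indices ρ ∷ʳ k) b<d = case h of λ ()
    by-order : ∀ o → cmp Ixs-comparator (indices π′ ∷ʳ i′) (indices π″ ∷ʳ i″) ≡ o → IsSlot e′ π′ i′ (suc s)
    by-order less q = ⊥-elim (nothing-between q)
    by-order greater q = case trans (sym (cong (_⊗ less) q)) b′<e′ of λ ()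
    by-order same q with a , b ← Listₚ.∷ʳ-injective (indices π′) (indices π″) (cmp-same Ixs-comparator _ _ q)
      with refl ← same-indices π′ π″ sl″ a | refl ← b = he′

  -- `u` and `v` are the separators that enclose slot `s`, the next even slot being two further.
  -- Their answers belong to the block of `b′`, and by order they enclose `e′`.
  enter : ∀ {w w′ x y ps} → Chain w w′ (osuc (osuc (osuc x))) (osuc (osuc (osuc y))) ps →
    ∀ {b b′ u u′ v v′ e e′ π i π′ i′ s} → (b , b′) ∈ ps → (u , u′) ∈ ps → (v , v′) ∈ ps → (e , e′) ∈ ps →
    IsSlot b π i 0 → IsSlot b′ π′ i′ 0 → IsSlot u π i s → IsSlot v π i (suc (suc s)) → T (even s) →
    ∀ {ρ} → path e ≡ (π ∷ʳ (i , s)) ++ ρ → Σ Path λ ρ′ → path e′ ≡ (π′ ∷ʳ (i′ , s)) ++ ρ′ × slots ρ ≡ slots ρ′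
  enter {w} {w′} {x} {y} c {b} {b′} {u} {u′} {v} {v′} {e} {e′} {π} {i} {π′} {i′} {s} mb mu mv me hb hb′ hu hv ev {ρ} he =
    let ρ′ , p , q = sandwich π′ {i′} {s} {suc (suc s)} (path e′) {slots ρ} lower-bound upper-bound slots-e′ in
    ρ′ , trans p (sym (Listₚ.∷ʳ-++ π′ (i′ , s) ρ′)) , sym q
    where
    hu′ : IsSlot u′ π′ i′ s
    hu′ = block-preserved {x = x} {y} c {b = b} {b′} {u} {u′} {π} {i} mb mu hb hb′ hu ev
    hv′ : IsSlot v′ π′ i′ (suc (suc s))
    hv′ = block-preserved {x = x} {y} c {b = b} {b′} {v} {v′} {π} {i} mb mv hb hb′ hv (even-+2 s ev)
    he₁ : path e ≡ π ++ (i , s) ∷ ρ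
    he₁ = trans he (Listₚ.∷ʳ-++ π (i , s) ρ)
    slots-π : slots π ≡ slots π′
    slots-π = proj₁ (slots-∷ʳ-injective π i 0 π′ i′ 0 (trans (sym (cong (slots ∘ proj₁) hb))
      (trans (proj₂ (chain-visible {x = osuc x} {osuc y} c mb)) (cong (slots ∘ proj₁) hb′))))
    slots-e′ : slots (path e′) ≡ slots π′ ++ s ∷ slots ρ
    slots-e′ = trans (sym (proj₂ (chain-visible {x = osuc x} {osuc y} c me))) (trans (cong slots he₁)
      (trans (slots-++ π _) (cong (_++ s ∷ slots ρ) slots-π)))
    lower-bound : cmpᴾ (π′ ∷ʳ (i′ , s)) (path e′) ≢ greater
    lower-bound g = prefix-≤ π (i , s) ρ (less⇒greater Path-comparator (π ++ (i , s) ∷ ρ) (π ∷ʳ (i , s))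
      (subst₂ (λ p q → cmpᴾ p q ≡ less) he₁ (cong proj₁ hu)
        (<-preserved {w′} {w} (chain-swap c) {e′} {e} {u′} {u} (∈ₚ.∈-map⁺ swapᵖ me) (∈ₚ.∈-map⁺ swapᵖ mu) (cong proj₂ hu′) (cong proj₂ hu)
          (greater⇒less Path-comparator (path u′) (path e′) (subst (λ p → cmpᴾ p (path e′) ≡ greater) (sym (cong proj₁ hu′)) g)))))
    upper-bound : cmpᴾ (path e′) (π′ ∷ʳ (i′ , suc (suc s))) ≡ less
    upper-bound = subst (λ p → cmpᴾ (path e′) p ≡ less) (cong proj₁ hv′)
      (<-preserved {w} {w′} c {e} {e′} {v} {v′} me mv (cong proj₂ hv) (cong proj₂ hv′)
        (subst₂ (λ p q → cmpᴾ p q ≡ less) (sym he₁) (sym (cong proj₁ hv)) (next-slot-above π i ρ (ℕₚ.m≤n⇒m≤1+n (ℕₚ.n<1+n s)))))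

  -- The rank that is to be bounded belongs to w if s is true, and to w′ otherwise.
  RankedChain : Bool → (w w′ : World) → Ord → Ord → List (Elem w × Elem w′) → Set
  RankedChain s w w′ a c = Chain w w′ (pad 4 (select s a c)) (pad 4 (select s c a))

  ranked-swap : ∀ s {w w′ a c ps} → RankedChain s w w′ a c ps → RankedChain (not s) w′ w a c (map swapᵖ ps)
  ranked-swap true h = chain-swap h
  ranked-swap false h = chain-swap h

  ranked-mono : ∀ s {w w′} a c a₁ c₁ {ps} → a₁ ≤ₒ a → c₁ ≤ₒ c → RankedChain s w w′ a c ps → RankedChain s w w′ a₁ c₁ ps
  ranked-mono true a c a₁ c₁ p q = chain-mono _ _ (pad 4 a₁) (pad 4 c₁) (pad-mono 4 a₁ a p) (pad-mono 4 c₁ c q)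
  ranked-mono false a c a₁ c₁ p q = chain-mono _ _ (pad 4 c₁) (pad 4 a₁) (pad-mono 4 c₁ c q) (pad-mono 4 a₁ a p)

  ranked-finite : ∀ s {w w′} a c {ps} → RankedChain s w w′ a c ps → Chain w w′ (fin 4) (fin 4) ps
  ranked-finite s a c = chain-mono _ _ (fin 4) (fin 4) (fin≤pad 4 (select s a c)) (fin≤pad 4 (select s c a))

first-entry : ∀ c ρ {j} → T (valid c ρ) → j ∷ [] ≡ slots ρ → Σ Ix λ i → ρ ≡ (i , j) ∷ [] × T (entry-ok c i j)
first-entry c ((i , j) ∷ []) v refl = i , refl , proj₁ (∧-T⁻ {entry-ok c i j} v)

is-root⇒ : ∀ {i} → T (not (is-root i)) → i ≢ root
is-root⇒ {i} t refl = t

valid-inside : ∀ {w π c} ρ → T (valid (top w) (π ++ ρ)) → content (top w) π ≡ c → T (valid c ρ)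
valid-inside {w} {π} ρ v refl = proj₂ (valid-++⁻ (top w) π ρ v)

path-valid′ : ∀ {w} (e : Elem w) → T (valid (top w) (path e))
path-valid′ e = proj₂ (∧-T⁻ {not (null (path e))} (path-valid e))

module Separation (N : Str) where
  open Comparison-by-chains N public

  record Probe (w w′ : World) (x y : Ord) (b : Elem w) (b′ : Elem w′) (ps : List (Elem w × Elem w′)) (π ρ π′ : Path) : Set where
    constructor probed
    field
      {sent} : Elem w
      {answer} : Elem w′
      {tail} : Path
      sent-raw : raw sent ≡ (π ++ ρ , 0)
      answer-raw : raw answer ≡ (π′ ++ tail , 0)
      same-slots : slots ρ ≡ slots tail
      chain′ : Chain w w′ x y ((sent , answer) ∷ (b , b′) ∷ ps)

  -- The point at `ρ` is played together with the two separators around slot `t`, which force the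
  -- answer into the corresponding slot and are forgotten afterwards.
  probe : ∀ {w w′ x y b b′ ps} π i π′ i′ t ρ → Chain w w′ (osuc x) (osuc y) ((b , b′) ∷ ps) → fin 3 ≤ₒ x → fin 3 ≤ₒ y →
    IsSlot b π i 0 → IsSlot b′ π′ i′ 0 → T (even t) → T (valid (top w) (π ∷ʳ (i , t))) →
    T (not (null ((π ∷ʳ (i , t)) ++ ρ)) ∧ valid (top w) ((π ∷ʳ (i , t)) ++ ρ)) →
    Probe w w′ x y b b′ ps (π ∷ʳ (i , t)) ρ (π′ ∷ʳ (i′ , t))
  probe {w} {w′} {x} {y} {b} {b′} {ps} π i π′ i′ t ρ c p q hb hb′ ev v vρ =
    go u u₂ e refl refl refl (chain-stepˡ c (u ∷ u₂ ∷ e ∷ []))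
    where
    u u₂ e : Elem w
    u = pt (π ∷ʳ (i , t)) (valid-other-slot π i t t ev ev v)
    u₂ = pt (π ∷ʳ (i , suc (suc t))) (valid-other-slot π i t (suc (suc t)) ev (even-+2 t ev) v)
    e = pt ((π ∷ʳ (i , t)) ++ ρ) vρ
    go : ∀ u u₂ e → IsSlot u π i t → IsSlot u₂ π i (suc (suc t)) → raw e ≡ ((π ∷ʳ (i , t)) ++ ρ , 0) →
      Σ (Vec (Elem w′) 3) (λ z → Chain w w′ x y (zipᵛ (u ∷ u₂ ∷ e ∷ []) z ++ (b , b′) ∷ ps)) →
      Probe w w′ x y b b′ ps (π ∷ʳ (i , t)) ρ (π′ ∷ʳ (i′ , t))
    go u u₂ e hu hu₂ he (u′ ∷ u₂′ ∷ e′ ∷ [] , c′) =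
      let c₃ = chain-mono x y (fin 3) (fin 3) p q c′
          ρ′ , r , sl = enter {w} {w′} {ozero} {ozero} c₃ {b} {b′} {u} {u′} {u₂} {u₂′} {e} {e′} {π} {i} {π′} {i′} {t}
            (there (there (there (here refl)))) (here refl) (there (here refl)) (there (there (here refl))) hb hb′ hu hu₂ ev {ρ} (cong proj₁ he)
      in probed {sent = e} {e′} {ρ′} he
           (cong₂ _,_ r (trans (sym (proj₁ (chain-visible {x = fin 1} {fin 1} c₃ {e} {e′} (there (there (here refl)))))) (cong proj₂ he)))
           sl (chain-⊆ _ (there ∘ there) c′)

  ranked-probe : ∀ s {w w′ a c b b′ ps} π i π′ i′ t ρ → RankedChain s w w′ (osuc a) (osuc c) ((b , b′) ∷ ps) →
    IsSlot b π i 0 → IsSlot b′ π′ i′ 0 → T (even t) → T (valid (top w) (π ∷ʳ (i , t))) →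
    T (not (null ((π ∷ʳ (i , t)) ++ ρ)) ∧ valid (top w) ((π ∷ʳ (i , t)) ++ ρ)) →
    Probe w w′ (pad 4 (select s a c)) (pad 4 (select s c a)) b b′ ps (π ∷ʳ (i , t)) ρ (π′ ∷ʳ (i′ , t))
  ranked-probe true {a = a} {c} π i π′ i′ t ρ r = probe π i π′ i′ t ρ r
    (≤ₒ-trans (fin 3) (fin 4) (pad 4 a) tt (fin≤pad 4 a)) (≤ₒ-trans (fin 3) (fin 4) (pad 4 c) tt (fin≤pad 4 c))
  ranked-probe false {a = a} {c} π i π′ i′ t ρ r = probe π i π′ i′ t ρ r
    (≤ₒ-trans (fin 3) (fin 4) (pad 4 c) tt (fin≤pad 4 c)) (≤ₒ-trans (fin 3) (fin 4) (pad 4 a) tt (fin≤pad 4 a))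

  -- The slot number in a leaf names the block, and the block with the name of `root` is missing on
  -- the other side. The rank 4, found again in `pad 4`, is one round for the probe and three for
  -- `enter`.
  leaf-variants-differ : ∀ {w w′ b b′} π i π′ i′ t → Chain w w′ (fin 4) (fin 4) ((b , b′) ∷ []) →
    IsSlot b π i 0 → IsSlot b′ π′ i′ 0 → T (even t) →
    T (valid (top w) (π ∷ʳ (i , t))) → T (valid (top w′) (π′ ∷ʳ (i′ , t))) →
    content (top w) (π ∷ʳ (i , t)) ≡ tree leaf false → content (top w′) (π′ ∷ʳ (i′ , t)) ≡ tree leaf true → ⊥
  leaf-variants-differ {w} {w′} {b} {b′} π i π′ i′ t c hb hb′ ev v v′ k k′ =
    contradict (probe {x = fin 3} {fin 3} π i π′ i′ t _ c tt tt hb hb′ ev v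
      (valid-extend (π ∷ʳ (i , t)) (tree leaf false) ((root , suc (tag root)) ∷ []) v k (∧-T⁺ (∧-T⁺ {true} tt (true⇒T (≡ᵇ-refl (tag root)))) tt)))
    where
    contradict : Probe w w′ (fin 3) (fin 3) b b′ [] (π ∷ʳ (i , t)) ((root , suc (tag root)) ∷ []) (π′ ∷ʳ (i′ , t)) → ⊥
    contradict (probed {answer = e′} {ρ′} _ he′ sl _)
      with j , _ , o ← first-entry (tree leaf true) ρ′ (valid-inside {π = π′ ∷ʳ (i′ , t)} ρ′ (subst (T ∘ valid (top w′)) (cong proj₁ he′) (path-valid′ e′)) k′) sl =
      is-root⇒ {j} (proj₁ (∧-T⁻ {not (is-root j)} o)) (sym (tag-injective {root} {j} (ℕₚ.≡ᵇ⇒≡ (tag root) (tag j) (proj₂ (∧-T⁻ {not (is-root j)} o)))))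

  -- It is essential that comparability a ≤ visible α is the conclusion: ordinals need not be comparable constructively.
  -- In the false variant the root block has no mark, and whatever answers it in the true variant has one;
  -- the marked slots again contain the two variants of a smaller tree.
  variants-differ : ∀ α s a c {w w′ b b′} π i π′ i′ t → RankedChain s w w′ a c ((b , b′) ∷ []) →
    IsSlot b π i 0 → IsSlot b′ π′ i′ 0 → T (even t) →
    T (valid (top w) (π ∷ʳ (i , t))) → T (valid (top w′) (π′ ∷ʳ (i′ , t))) →
    content (top w) (π ∷ʳ (i , t)) ≡ tree α false → content (top w′) (π′ ∷ʳ (i′ , t)) ≡ tree α true →
    osuc (visible α) ≤ₒ c → a ≤ₒ visible α
  variants-differ leaf s a c π i π′ i′ t r hb hb′ ev v v′ k k′ h =
    ⊥-elim (leaf-variants-differ π i π′ i′ t (ranked-finite s a c r) hb hb′ ev v v′ k k′)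
  variants-differ (node f) s ozero c π i π′ i′ t r hb hb′ ev v v′ k k′ h = tt
  variants-differ (node f) s (olim g) c π i π′ i′ t r hb hb′ ev v v′ k k′ h = λ n →
    variants-differ (node f) s (g n) c π i π′ i′ t (ranked-mono s (olim g) c (g n) c (≤ₒ-lim g n) (≤ₒ-refl c) r) hb hb′ ev v v′ k k′ h
  variants-differ (node f) s (osuc a) c {w} {w′} {b} {b′} π i π′ i′ t r hb hb′ ev v v′ k k′ h =
    -- The other rank is first lowered to `osuc vis`, so that `vis` is left after the round; being a
    -- successor of a limit, `vis` is at least `osuc (visible (f n))` for whichever `n` the answer
    -- produces.
    continue (ranked-probe s π i π′ i′ t _ (ranked-mono s (osuc a) c (osuc a) (osuc vis) (≤ₒ-refl a) h r) hb hb′ ev v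
      (valid-extend (π ∷ʳ (i , t)) (tree (node f) false) ((root , 0) ∷ []) v k tt))
    where
    vis : Ord
    vis = visible (node f)
    slot-valid : ∀ {w} π x (j : Ix) → T (valid (top w) π) → content (top w) π ≡ tree (node f) x → T (allowed x j) →
      T (valid (top w) (π ∷ʳ (j , tag j)))
    slot-valid π x j v k al = proj₂ (∧-T⁻ {not (null (π ∷ʳ (j , tag j)))}
      (valid-extend π (tree (node f) x) ((j , tag j) ∷ []) v k (∧-T⁺ (∧-T⁺ al (true⇒T (even-tag j))) tt)))
    root-slot-valid : ∀ {w} π (t : ℕ) → T (even t) → T (valid (top w) π) → content (top w) π ≡ tree (node f) false →
      T (valid (top w) (π ∷ʳ (root , t)))
    root-slot-valid π t ev v k = proj₂ (∧-T⁻ {not (null (π ∷ʳ (root , t)))}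
      (valid-extend π (tree (node f) false) ((root , t) ∷ []) v k (∧-T⁺ ev tt)))
    continue : Probe w w′ (pad 4 (select s a vis)) (pad 4 (select s vis a)) b b′ [] (π ∷ʳ (i , t)) ((root , 0) ∷ []) (π′ ∷ʳ (i′ , t)) → osuc a ≤ₒ vis
    continue (probed {e} {e′} {ρ′} he he′ sl c′)
      with j , refl , o ← first-entry (tree (node f) true) ρ′ (valid-inside {π = π′ ∷ʳ (i′ , t)} ρ′ (subst (T ∘ valid (top w′)) (cong proj₁ he′) (path-valid′ e′)) k′) sl =
      ≤ₒ-trans a (visible (f n)) (olim λ k → visible (f k))
        (variants-differ (f n) s a (osuc (visible (f n))) (π ∷ʳ (i , t)) root (π′ ∷ʳ (i′ , t)) j (tag j)
          (ranked-mono s a vis a (osuc (visible (f n))) (≤ₒ-refl a) (≤ₒ-lim (λ k → visible (f k)) n)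
            (chain-⊆ _ (λ { (here refl) → here refl }) c′))
          he he′
          (true⇒T (even-tag j))
          (root-slot-valid (π ∷ʳ (i , t)) (tag j) (true⇒T (even-tag j)) v k)
          (slot-valid (π′ ∷ʳ (i′ , t)) true j v′ k′ al)
          (trans (content-∷ʳ (top w) (π ∷ʳ (i , t)) (root , tag j)) (cong (λ c → sub c root (tag j)) k))
          (trans (content-∷ʳ (top w′) (π′ ∷ʳ (i′ , t)) (j , tag j)) (trans (cong (λ c → sub c j (tag j)) k′)
            (cong (tree (f n)) (bit-tag (is-root⇒ {j} al)))))
          (≤ₒ-refl (visible (f n))))
        (≤ₒ-lim (λ k → visible (f k)) n)
      where
      n = tree-number (tag j)
      al : T (not (is-root j))
      al = proj₁ (∧-T⁻ {not (is-root j)} o)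

  variants-differ′ : ∀ α x x′ → x ≢ x′ → ∀ s a c {w w′ b b′} π i π′ i′ t → RankedChain s w w′ a c ((b , b′) ∷ []) →
    IsSlot b π i 0 → IsSlot b′ π′ i′ 0 → T (even t) →
    T (valid (top w) (π ∷ʳ (i , t))) → T (valid (top w′) (π′ ∷ʳ (i′ , t))) →
    content (top w) (π ∷ʳ (i , t)) ≡ tree α x → content (top w′) (π′ ∷ʳ (i′ , t)) ≡ tree α x′ →
    osuc (visible α) ≤ₒ c → a ≤ₒ visible α
  variants-differ′ α false false ne = ⊥-elim (ne refl)
  variants-differ′ α true true ne = ⊥-elim (ne refl)
  variants-differ′ α false true ne s a c π i π′ i′ t r hb hb′ ev v v′ k k′ h = variants-differ α s a c π i π′ i′ t r hb hb′ ev v v′ k k′ h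
  variants-differ′ α true false ne s a c π i π′ i′ t r hb hb′ ev v v′ k k′ h = variants-differ α (not s) a c π′ i′ π i t (ranked-swap s r) hb′ hb ev v′ v k′ k h

leaf-paths : ∀ x i₁ j₁ ρ₁ i₂ j₂ ρ₂ → T (valid (tree leaf x) ((i₁ , j₁) ∷ ρ₁)) → T (valid (tree leaf x) ((i₂ , j₂) ∷ ρ₂)) →
  slots ((i₁ , j₁) ∷ ρ₁) ≡ slots ((i₂ , j₂) ∷ ρ₂) → (i₁ , j₁) ∷ ρ₁ ≡ (i₂ , j₂) ∷ ρ₂
leaf-paths x i₁ j₁ [] i₂ .j₁ [] p q refl = cong (λ i → (i , j₁) ∷ []) (tag-injective (ℕₚ.suc-injective
  (trans (sym (ℕₚ.≡ᵇ⇒≡ j₁ (suc (tag i₁)) (proj₂ (∧-T⁻ {allowed x i₁} (proj₁ (∧-T⁻ {entry-ok (tree leaf x) i₁ j₁} p))))))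
    (ℕₚ.≡ᵇ⇒≡ j₁ (suc (tag i₂)) (proj₂ (∧-T⁻ {allowed x i₂} (proj₁ (∧-T⁻ {entry-ok (tree leaf x) i₂ j₁} q))))))))
leaf-paths x i₁ j₁ (_ ∷ _) i₂ j₂ ρ₂ p q e = ⊥-elim (proj₂ (∧-T⁻ {entry-ok (tree leaf x) i₁ j₁} p))
leaf-paths x i₁ j₁ ρ₁ i₂ j₂ (_ ∷ _) p q e = ⊥-elim (proj₂ (∧-T⁻ {entry-ok (tree leaf x) i₂ j₂} q))

module Positions (N : Str) where
  open Separation N public

  record Located (w w′ : World) (x y : Ord) (e : Elem w) (e′ : Elem w′) (ps : List (Elem w × Elem w′))
      (π : Path) (i : Ix) (j : ℕ) (ρ π′ : Path) : Set where
    constructor located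
    field
      {start} : Elem w
      {start′} : Elem w′
      {index′} : Ix
      {rest′} : Path
      is-start : IsSlot start π i 0
      is-start′ : IsSlot start′ π′ index′ 0
      path-e′ : path e′ ≡ (π′ ∷ʳ (index′ , j)) ++ rest′
      rest-slots : slots ρ ≡ slots rest′
      chain′ : Chain w w′ x y ((start , start′) ∷ (e , e′) ∷ ps)

  module _ {w w′ : World} {x y : Ord} {e : Elem w} {e′ : Elem w′} {ps : List (Elem w × Elem w′)} where

    locate-top : ∀ k j ρ → Chain w w′ (osuc x) (osuc y) ((e , e′) ∷ ps) → fin 3 ≤ₒ x → fin 3 ≤ₒ y →
      path e ≡ (k , j) ∷ ρ → Located w w′ x y e e′ ps [] k j ρ []
    locate-top k j ρ c p q he =
      go st₀ v₀ v₁ refl refl refl (chain-stepˡ c (st₀ ∷ v₀ ∷ v₁ ∷ []))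
      where
      ve : T (valid (top w) ((k , j) ∷ ρ))
      ve = subst (T ∘ valid (top w)) he (path-valid′ e)
      vk : T (valid (top w) ((k , j) ∷ []))
      vk = proj₁ (valid-++⁻ (top w) ((k , j) ∷ []) ρ ve)
      ev : T (even j)
      ev = proj₂ (∧-T⁻ {null (proj₂ k)} (proj₁ (∧-T⁻ {entry-ok (top w) k j} ve)))
      st₀ v₀ v₁ : Elem w
      st₀ = pt {w} ((k , 0) ∷ []) (valid-other-slot {w} [] k j 0 ev tt vk)
      v₀ = pt {w} ((k , j) ∷ []) (valid-other-slot {w} [] k j j ev ev vk)
      v₁ = pt {w} ((k , suc (suc j)) ∷ []) (valid-other-slot {w} [] k j (suc (suc j)) ev (even-+2 j ev) vk)
      go : ∀ st v v₂ → IsSlot st [] k 0 → IsSlot v [] k j → IsSlot v₂ [] k (suc (suc j)) →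
        Σ (Vec (Elem w′) 3) (λ z → Chain w w′ x y (zipᵛ (st ∷ v ∷ v₂ ∷ []) z ++ (e , e′) ∷ ps)) → Located w w′ x y e e′ ps [] k j ρ []
      go st v v₂ hst hv hv₂ (st′ ∷ v′ ∷ v₂′ ∷ [] , c′)
        with c₃ ← chain-mono x y (fin 3) (fin 3) p q c′
        with point-of {w} {w′} {fin 1} {fin 1} c₃ {st} {st′} (here refl) {[]} {k} {0} hst
      ... | [] , k′ , hst′ , _ =
        let ρ′ , r , sl = enter {w} {w′} {ozero} {ozero} c₃ {st} {st′} {v} {v′} {v₂} {v₂′} {e} {e′} {[]} {k} {[]} {k′} {j}
              (here refl) (there (here refl)) (there (there (here refl))) (there (there (there (here refl)))) hst hst′ hv hv₂ ev {ρ} he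
        in located hst hst′ r sl (chain-⊆ _ (λ { (here refl) → here refl ; (there m) → there (there (there m)) }) c′)

    locate : ∀ {b b′} π i π′ i′ t k j ρ → Chain w w′ (osuc x) (osuc y) ((b , b′) ∷ (e , e′) ∷ ps) → fin 3 ≤ₒ x → fin 3 ≤ₒ y →
      IsSlot b π i 0 → IsSlot b′ π′ i′ 0 → T (even t) → T (even j) → T (valid (top w) (π ∷ʳ (i , t))) →
      T (valid (top w) ((π ∷ʳ (i , t)) ∷ʳ (k , j))) → path e ≡ ((π ∷ʳ (i , t)) ∷ʳ (k , j)) ++ ρ →
      Located w w′ x y e e′ ps (π ∷ʳ (i , t)) k j ρ (π′ ∷ʳ (i′ , t))
    locate {b} {b′} π i π′ i′ t k j ρ c p q hb hb′ ev ev′ v vk he =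
      -- All in one round: `u₀` and `u₁` force the answer to the block start `st₀` into slot `t`,
      -- then `v₀` and `v₁` force `e′` into slot `j` of the block so found.
      go u₀ u₁ st₀ v₀ v₁ refl refl refl refl refl (chain-stepˡ c (u₀ ∷ u₁ ∷ st₀ ∷ v₀ ∷ v₁ ∷ []))
      where
      u₀ u₁ st₀ v₀ v₁ : Elem w
      u₀ = pt {w} (π ∷ʳ (i , t)) (valid-other-slot {w} π i t t ev ev v)
      u₁ = pt {w} (π ∷ʳ (i , suc (suc t))) (valid-other-slot {w} π i t (suc (suc t)) ev (even-+2 t ev) v)
      st₀ = pt {w} ((π ∷ʳ (i , t)) ∷ʳ (k , 0)) (valid-other-slot {w} (π ∷ʳ (i , t)) k j 0 ev′ tt vk)
      v₀ = pt {w} ((π ∷ʳ (i , t)) ∷ʳ (k , j)) (valid-other-slot {w} (π ∷ʳ (i , t)) k j j ev′ ev′ vk)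
      v₁ = pt {w} ((π ∷ʳ (i , t)) ∷ʳ (k , suc (suc j))) (valid-other-slot {w} (π ∷ʳ (i , t)) k j (suc (suc j)) ev′ (even-+2 j ev′) vk)
      go : ∀ u u₂ st v v₂ → IsSlot u π i t → IsSlot u₂ π i (suc (suc t)) → IsSlot st (π ∷ʳ (i , t)) k 0 → IsSlot v (π ∷ʳ (i , t)) k j →
        IsSlot v₂ (π ∷ʳ (i , t)) k (suc (suc j)) →
        Σ (Vec (Elem w′) 5) (λ z → Chain w w′ x y (zipᵛ (u ∷ u₂ ∷ st ∷ v ∷ v₂ ∷ []) z ++ (b , b′) ∷ (e , e′) ∷ ps)) →
        Located w w′ x y e e′ ps (π ∷ʳ (i , t)) k j ρ (π′ ∷ʳ (i′ , t))
      go u u₂ st v v₂ hu hu₂ hst hv hv₂ (u′ ∷ u₂′ ∷ st′ ∷ v′ ∷ v₂′ ∷ [] , c′) =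
        start-found (enter {w} {w′} {ozero} {ozero} c₃ {b} {b′} {u} {u′} {u₂} {u₂′} {st} {st′} {π} {i} {π′} {i′} {t}
          (there (there (there (there (there (here refl)))))) (here refl) (there (here refl)) (there (there (here refl)))
          hb hb′ hu hu₂ ev {(k , 0) ∷ []} (cong proj₁ hst))
        where
        c₃ : Chain w w′ (fin 3) (fin 3) (zipᵛ (u ∷ u₂ ∷ st ∷ v ∷ v₂ ∷ []) (u′ ∷ u₂′ ∷ st′ ∷ v′ ∷ v₂′ ∷ []) ++ (b , b′) ∷ (e , e′) ∷ ps)
        c₃ = chain-mono x y (fin 3) (fin 3) p q c′
        start-found : (Σ Path λ σ → path st′ ≡ (π′ ∷ʳ (i′ , t)) ++ σ × 0 ∷ [] ≡ slots σ) →
          Located w w′ x y e e′ ps (π ∷ʳ (i , t)) k j ρ (π′ ∷ʳ (i′ , t))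
        start-found ((k′ , .0) ∷ [] , r , refl) =
          let ρ′ , r′ , sl = enter {w} {w′} {ozero} {ozero} c₃ {st} {st′} {v} {v′} {v₂} {v₂′} {e} {e′} {π ∷ʳ (i , t)} {k} {π′ ∷ʳ (i′ , t)} {k′} {j}
                (there (there (here refl))) (there (there (there (here refl)))) (there (there (there (there (here refl)))))
                (there (there (there (there (there (there (here refl))))))) hst hst′ hv hv₂ ev′ {ρ} he
          in located hst hst′ r′ sl
               (chain-⊆ _ (λ { (here refl) → there (there (here refl)) ; (there m) → there (there (there (there (there (there m))))) }) c′)
          where
          hst′ : IsSlot st′ (π′ ∷ʳ (i′ , t)) k′ 0
          hst′ = cong₂ _,_ r (trans (sym (proj₁ (chain-visible {x = fin 1} {fin 1} c₃ {st} {st′} (there (there (here refl)))))) (cong proj₂ hst))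

  ranked-locate : ∀ s {w w′ a c b b′ e e′ ps} π i π′ i′ t k j ρ → RankedChain s w w′ (osuc a) (osuc c) ((b , b′) ∷ (e , e′) ∷ ps) →
    IsSlot b π i 0 → IsSlot b′ π′ i′ 0 → T (even t) → T (even j) → T (valid (top w) (π ∷ʳ (i , t))) →
    T (valid (top w) ((π ∷ʳ (i , t)) ∷ʳ (k , j))) → path e ≡ ((π ∷ʳ (i , t)) ∷ʳ (k , j)) ++ ρ →
    Located w w′ (pad 4 (select s a c)) (pad 4 (select s c a)) e e′ ps (π ∷ʳ (i , t)) k j ρ (π′ ∷ʳ (i′ , t))
  ranked-locate true {a = a} {c} π i π′ i′ t k j ρ r = locate π i π′ i′ t k j ρ r
    (≤ₒ-trans (fin 3) (fin 4) (pad 4 a) tt (fin≤pad 4 a)) (≤ₒ-trans (fin 3) (fin 4) (pad 4 c) tt (fin≤pad 4 c))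
  ranked-locate false {a = a} {c} π i π′ i′ t k j ρ r = locate π i π′ i′ t k j ρ r
    (≤ₒ-trans (fin 3) (fin 4) (pad 4 c) tt (fin≤pad 4 c)) (≤ₒ-trans (fin 3) (fin 4) (pad 4 a) tt (fin≤pad 4 a))

  ∷ʳ-cancel : ∀ (π : Path) e e′ ρ ρ′ → (π ∷ʳ e) ++ ρ ≡ π ++ e′ ∷ ρ′ → e ≡ e′ × ρ ≡ ρ′
  ∷ʳ-cancel π e e′ ρ ρ′ h = Listₚ.∷-injective (Listₚ.++-cancelˡ π (e ∷ ρ) (e′ ∷ ρ′) (trans (sym (Listₚ.∷ʳ-++ π e ρ)) h))

  -- Rigidity with a rank. If the two points lie in different blocks, these differ in a mark and
  -- `variants-differ′` applies to that slot; if they lie in one block, the difference is found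
  -- deeper in the same slot.
  positions-differ : ∀ α s a c {w w′ b b′ e e′} π i π′ i′ t x ρ ρ′ → RankedChain s w w′ a c ((b , b′) ∷ (e , e′) ∷ []) →
    IsSlot b π i 0 → IsSlot b′ π′ i′ 0 → T (even t) →
    T (valid (top w) (π ∷ʳ (i , t))) → T (valid (top w′) (π′ ∷ʳ (i′ , t))) →
    content (top w) (π ∷ʳ (i , t)) ≡ tree α x → content (top w′) (π′ ∷ʳ (i′ , t)) ≡ tree α x →
    path e ≡ (π ∷ʳ (i , t)) ++ ρ → path e′ ≡ (π′ ∷ʳ (i′ , t)) ++ ρ′ → slots ρ ≡ slots ρ′ →
    osuc (visible α) ≤ₒ c → ρ ≢ ρ′ → a ≤ₒ visible α
  positions-differ α s a c π i π′ i′ t x [] [] r hb hb′ ev v v′ k k′ he he′ sl h ne = ⊥-elim (ne refl)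
  positions-differ leaf s a c {w} {w′} {e = e} {e′} π i π′ i′ t x ((i₁ , j₁) ∷ ρ₁) ((i₂ , j₂) ∷ ρ₂) r hb hb′ ev v v′ k k′ he he′ sl h ne =
    ⊥-elim (ne (leaf-paths x i₁ j₁ ρ₁ i₂ j₂ ρ₂ (valid-inside {w} {π ∷ʳ (i , t)} _ (subst (T ∘ valid (top w)) he (path-valid′ e)) k)
      (valid-inside {w′} {π′ ∷ʳ (i′ , t)} _ (subst (T ∘ valid (top w′)) he′ (path-valid′ e′)) k′) sl))
  positions-differ (node f) s ozero c π i π′ i′ t x ρ ρ′ r hb hb′ ev v v′ k k′ he he′ sl h ne = tt
  positions-differ (node f) s (olim g) c π i π′ i′ t x ρ ρ′ r hb hb′ ev v v′ k k′ he he′ sl h ne = λ n →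
    positions-differ (node f) s (g n) c π i π′ i′ t x ρ ρ′ (ranked-mono s (olim g) c (g n) c (≤ₒ-lim g n) (≤ₒ-refl c) r)
      hb hb′ ev v v′ k k′ he he′ sl h ne
  positions-differ (node f) s (osuc a) c {w} {w′} {b} {b′} {e} {e′} π i π′ i′ t x ((i₁ , j₁) ∷ ρ₁) ((i₂ , j₂) ∷ ρ₂) r hb hb′ ev v v′ k k′ he he′ sl h ne
    with refl ← Listₚ.∷-injectiveˡ sl = continue (ranked-locate s π i π′ i′ t i₁ j₁ ρ₁
      (ranked-mono s (osuc a) c (osuc a) (osuc vis) (≤ₒ-refl a) h r) hb hb′ ev (proj₂ o₁) v (entry-valid π i i₁ j₁ v k (∧-T⁺ (proj₁ o₁) (proj₂ o₁)))
      (trans he (sym (Listₚ.∷ʳ-++ (π ∷ʳ (i , t)) (i₁ , j₁) ρ₁))))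
    where
    vis : Ord
    vis = visible (node f)
    o₁ = ∧-T⁻ {allowed x i₁} (proj₁ (∧-T⁻ {entry-ok (tree (node f) x) i₁ j₁}
      (valid-inside {w} {π ∷ʳ (i , t)} _ (subst (T ∘ valid (top w)) he (path-valid′ e)) k)))
    o₂ = ∧-T⁻ {allowed x i₂} (proj₁ (∧-T⁻ {entry-ok (tree (node f) x) i₂ j₂}
      (valid-inside {w′} {π′ ∷ʳ (i′ , t)} _ (subst (T ∘ valid (top w′)) he′ (path-valid′ e′)) k′)))
    entry-valid : ∀ {w} π i j n → T (valid (top w) (π ∷ʳ (i , t))) → content (top w) (π ∷ʳ (i , t)) ≡ tree (node f) x →
      T (entry-ok (tree (node f) x) j n) → T (valid (top w) ((π ∷ʳ (i , t)) ∷ʳ (j , n)))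
    entry-valid π i j n v k o = proj₂ (∧-T⁻ {not (null ((π ∷ʳ (i , t)) ∷ʳ (j , n)))}
      (valid-extend (π ∷ʳ (i , t)) (tree (node f) x) ((j , n) ∷ []) v k (∧-T⁺ o tt)))
    step-up : ∀ n → a ≤ₒ visible (f n) → osuc a ≤ₒ vis
    step-up n p = ≤ₒ-trans a (visible (f n)) (olim λ k → visible (f k)) p (≤ₒ-lim (λ k → visible (f k)) n)
    content-slot : ∀ {w} π i j n → content (top w) (π ∷ʳ (i , t)) ≡ tree (node f) x →
      content (top w) ((π ∷ʳ (i , t)) ∷ʳ (j , n)) ≡ tree (f (tree-number n)) (bit j n)
    content-slot {w} π i j n k = trans (content-∷ʳ (top w) (π ∷ʳ (i , t)) (j , n)) (cong (λ c → sub c j n) k)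
    lowered : ∀ {b b′ ps} n → RankedChain s w w′ a vis ((b , b′) ∷ ps) → RankedChain s w w′ a (osuc (visible (f n))) ((b , b′) ∷ ps)
    lowered n = ranked-mono s a vis a (osuc (visible (f n))) (≤ₒ-refl a) (≤ₒ-lim (λ k → visible (f k)) n)
    continue : Located w w′ (pad 4 (select s a vis)) (pad 4 (select s vis a)) e e′ [] (π ∷ʳ (i , t)) i₁ j₁ ρ₁ (π′ ∷ʳ (i′ , t)) → osuc a ≤ₒ vis
    continue (located {st} {st′} {m} {ρ″} hst hst′ pe sl′ c′)
      with refl , refl ← ∷ʳ-cancel (π′ ∷ʳ (i′ , t)) (m , j₁) (i₂ , j₂) ρ″ ρ₂ (trans (sym pe) he′)
      with i₁ ≟ᴵ m
    ... | yes refl = step-up (tree-number j₁) (positions-differ (f (tree-number j₁)) s a (osuc (visible (f (tree-number j₁))))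
            (π ∷ʳ (i , t)) i₁ (π′ ∷ʳ (i′ , t)) i₁ j₁ (bit i₁ j₁) ρ₁ ρ₂ (lowered (tree-number j₁) c′) hst hst′ (proj₂ o₁)
            (entry-valid π i i₁ j₁ v k (∧-T⁺ (proj₁ o₁) (proj₂ o₁))) (entry-valid π′ i′ i₁ j₁ v′ k′ (∧-T⁺ (proj₁ o₂) (proj₂ o₂)))
            (content-slot π i i₁ j₁ k) (content-slot π′ i′ i₁ j₁ k′)
            (trans he (sym (Listₚ.∷ʳ-++ (π ∷ʳ (i , t)) (i₁ , j₁) ρ₁))) pe sl′ (≤ₒ-refl (visible (f (tree-number j₁))))
            (λ q → ne (cong ((i₁ , j₁) ∷_) q)))
    ... | no i≢ = let n , evn , d = differing-slot i₁ m i≢ in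
          step-up (tree-number n) (variants-differ′ (f (tree-number n)) (bit i₁ n) (bit m n) d s a (osuc (visible (f (tree-number n))))
            (π ∷ʳ (i , t)) i₁ (π′ ∷ʳ (i′ , t)) m n (chain-⊆ _ (λ { (here refl) → here refl }) (lowered (tree-number n) c′)) hst hst′ (true⇒T evn)
            (entry-valid π i i₁ n v k (∧-T⁺ (proj₁ o₁) (true⇒T evn))) (entry-valid π′ i′ m n v′ k′ (∧-T⁺ (proj₁ o₂) (true⇒T evn)))
            (content-slot π i i₁ n k) (content-slot π′ i′ m n k′) (≤ₒ-refl (visible (f (tree-number n)))))

-- Recovering an isomorphism

-- Passing to a larger rival can be repeated only finitely often, by the pigeonhole principle.
opaque
  ascent : ∀ G (q : ℕ → Ord) {C : ℕ → Set} →
    (∀ i → i ≤ G → C i ⊎ Σ ℕ λ j → j ≤ G × q i <ₒ q j) → Σ ℕ λ i → i ≤ G × C i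
  ascent G q {C} D = decide (all-climb (suc (suc G)))
    where
    Candidate : Set
    Candidate = Σ ℕ (_≤ G)
    choice : (c : Candidate) → C (proj₁ c) ⊎ Σ ℕ λ j → j ≤ G × q (proj₁ c) <ₒ q j
    choice (i , p) = D i p
    next : Candidate → Candidate
    next c with choice c
    ... | inj₁ _ = c
    ... | inj₂ (j , p , _) = j , p
    walk : ℕ → Candidate
    walk zero = 0 , z≤n
    walk (suc n) = next (walk n)
    Climbs : ℕ → Set
    Climbs n = q (proj₁ (walk n)) <ₒ q (proj₁ (walk (suc n)))
    climb : ∀ n → C (proj₁ (walk n)) ⊎ Climbs n
    climb n with choice (walk n)
    ... | inj₁ c = inj₁ c
    ... | inj₂ (_ , _ , l) = inj₂ l
    all-climb : ∀ n → (Σ ℕ λ i → C (proj₁ (walk i))) ⊎ (∀ i → i < n → Climbs i)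
    all-climb zero = inj₂ λ _ ()
    all-climb (suc n) with all-climb n | climb n
    ... | inj₁ c | _ = inj₁ c
    ... | inj₂ _ | inj₁ c = inj₁ (n , c)
    ... | inj₂ h | inj₂ l = inj₂ λ i p → case ℕₚ.m≤n⇒m<n∨m≡n (ℕₚ.≤-pred p) of λ { (inj₁ i<n) → h i i<n ; (inj₂ refl) → l }
    increasing : ∀ n → (∀ i → i < n → Climbs i) → ∀ {i j} → i < j → j ≤ n → q (proj₁ (walk i)) <ₒ q (proj₁ (walk j))
    increasing n h {i} {suc j} (s≤s i≤j) j<n with ℕₚ.m≤n⇒m<n∨m≡n i≤j
    ... | inj₂ refl = h i j<n
    ... | inj₁ i<j = <ₒ-trans (q (proj₁ (walk i))) (q (proj₁ (walk j))) (q (proj₁ (walk (suc j))))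
            (increasing n h i<j (ℕₚ.<⇒≤ j<n)) (h j j<n)
    decide : (Σ ℕ λ i → C (proj₁ (walk i))) ⊎ (∀ i → i < suc (suc G) → Climbs i) → Σ ℕ λ i → i ≤ G × C i
    decide (inj₁ (i , c)) = proj₁ (walk i) , proj₂ (walk i) , c
    decide (inj₂ h) with i , j , i<j , e ← pigeonhole {suc G} {suc (suc G)} ℕₚ.≤-refl (λ n → fromℕ< (s≤s (proj₂ (walk (toℕ n))))) =
      ⊥-elim (<ₒ-irrefl (q (proj₁ (walk (toℕ j)))) (subst (λ k → q k <ₒ q (proj₁ (walk (toℕ j))))
        (trans (sym (Finₚ.toℕ-fromℕ< (s≤s (proj₂ (walk (toℕ i)))))) (trans (cong toℕ e) (Finₚ.toℕ-fromℕ< (s≤s (proj₂ (walk (toℕ j)))))))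
        (increasing (suc (suc G)) h i<j (ℕₚ.<⇒≤ (Finₚ.toℕ<n j)))))

all-or-some : ∀ {A B : ℕ → Set} → (∀ h → A h ⊎ B h) → ∀ G → (∀ h → h ≤ G → A h) ⊎ Σ ℕ λ h → h ≤ G × B h
all-or-some d zero with d 0
... | inj₁ a = inj₁ λ { zero z≤n → a }
... | inj₂ b = inj₂ (0 , z≤n , b)
all-or-some d (suc G) with all-or-some d G | d (suc G)
... | inj₂ (h , p , b) | _ = inj₂ (h , ℕₚ.m≤n⇒m≤1+n p , b)
... | inj₁ _ | inj₂ b = inj₂ (suc G , ℕₚ.≤-refl , b)
... | inj₁ f | inj₁ a = inj₁ λ h p → case ℕₚ.m≤n⇒m<n∨m≡n p of λ { (inj₁ (s≤s p)) → f h p ; (inj₂ refl) → a }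

block-start : ∀ {w} → ℤ → Elem w
block-start κ = pt (((κ , []) , 0) ∷ []) tt

module TopLevel (N : Str) where
  open Positions N public

  module _ {w w′ : World} where
    starts-ordered : ∀ {x y ps} → Chain w w′ x y ps → ∀ {κ λ′ κ′ λ″} → (block-start κ , block-start κ′) ∈ ps → (block-start λ′ , block-start λ″) ∈ ps →
      κ <ℤ λ′ → κ′ <ℤ λ″
    starts-ordered c {κ} {λ′} {κ′} {λ″} m n p = less⇒< ℤₚ.<-cmp (trans (sym cmpᴵ-integers) (first-less
      (trans (sym (chain-cmp c m n)) (⊗-lessˡ (⊗-lessˡ (⊗-lessˡ (trans cmpᴵ-integers (<⇒less ℤₚ.<-cmp p))))))))
      where
      first-less : ∀ {x} → ((x ⊗ same) ⊗ same) ⊗ same ≡ less → x ≡ less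
      first-less {less} _ = refl

    start-answer : ∀ {x y ps} → Chain w w′ (osuc (osuc x)) (osuc (osuc y)) ps → ∀ {κ e′} → (block-start κ , e′) ∈ ps →
      Σ ℤ λ κ′ → e′ ≡ block-start κ′
    start-answer {x} {y} c {κ} {e′} m with point-of {w} {w′} {x} {y} c {block-start κ} {e′} m {[]} {κ , []} {0} refl
    ... | [] , (κ′ , []) , h , _ = κ′ , raw-injective h
    ... | [] , (κ′ , _ ∷ _) , h , _ = ⊥-elim (subst (T ∘ valid (top w′)) (cong proj₁ h) (path-valid′ e′))

    nonnegative-starts : ∀ n → Vec (Elem w) n
    nonnegative-starts zero = []
    nonnegative-starts (suc n) = block-start (+ n) ∷ nonnegative-starts n

    negative-starts : ∀ n → Vec (Elem w) n
    negative-starts zero = []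
    negative-starts (suc n) = block-start -[1+ n ] ∷ negative-starts n

    nonnegative-≤ : ∀ {x y ps} → Chain w w′ (osuc (osuc x)) (osuc (osuc y)) ps → (block-start (+ 0) , block-start (+ 0)) ∈ ps →
      ∀ n (u : Vec (Elem w′) n) {κ′} → (block-start (+ n) , block-start κ′) ∈ ps → (∀ {r} → r ∈ zipᵛ (nonnegative-starts n) u → r ∈ ps) →
      + n ℤ.≤ κ′
    nonnegative-≤ c o zero [] {κ′} m s = ℤₚ.≤-reflexive (sym (cmp-same ℤ-comparator κ′ (+ 0) (trans (sym cmpᴵ-integers)
      (all-same (trans (sym (chain-cmp c m o)) (cmp-refl Raw-comparator (raw (block-start {w} (+ 0)))))))))
      where
      all-same : ∀ {x} → ((x ⊗ same) ⊗ same) ⊗ same ≡ same → x ≡ same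
      all-same {same} _ = refl
    nonnegative-≤ {x} {y} c o (suc n) (e ∷ u) {κ′} m s with start-answer {x} {y} c {+ n} (s (here refl))
    ... | κ , refl = ℤₚ.≤-trans (ℤₚ.i<j⇒suc[i]≤j (ℤₚ.≤-<-trans (nonnegative-≤ {x} {y} c o n u (s (here refl)) (s ∘ there))
            (starts-ordered c (s (here refl)) m (ℤ.+<+ (ℕₚ.n<1+n n))))) ℤₚ.≤-refl

    negative-≤ : ∀ {x y ps} → Chain w w′ (osuc (osuc x)) (osuc (osuc y)) ps → (block-start (+ 0) , block-start (+ 0)) ∈ ps →
      ∀ n (u : Vec (Elem w′) n) {κ′} → (block-start -[1+ n ] , block-start κ′) ∈ ps → (∀ {r} → r ∈ zipᵛ (negative-starts n) u → r ∈ ps) →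
      κ′ ℤ.≤ -[1+ n ]
    negative-≤ c o zero [] {κ′} m s = ℤₚ.i<j⇒i≤pred[j] (starts-ordered c m o ℤ.-<+)
    negative-≤ {x} {y} c o (suc n) (e ∷ u) {κ′} m s with start-answer {x} {y} c { -[1+ n ] } (s (here refl))
    ... | κ , refl = ℤₚ.i<j⇒i≤pred[j] (ℤₚ.<-≤-trans (starts-ordered c m (s (here refl)) (ℤ.-<- (ℕₚ.n<1+n n)))
            (negative-≤ {x} {y} c o n u (s (here refl)) (s ∘ there)))

  -- The distance from block 0 is measured by playing the starts of all blocks in between; their
  -- answers are distinct block starts in the same order.
  start-≤ : ∀ {w w′ x y κ κ′} → Chain w w′ (osuc (osuc (osuc x))) (osuc (osuc (osuc y))) ((block-start κ , block-start κ′) ∷ (block-start (+ 0) , block-start (+ 0)) ∷ []) →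
    (+ 0 ℤ.≤ κ → κ ℤ.≤ κ′) × (κ <ℤ + 0 → κ′ ℤ.≤ κ)
  start-≤ {w} {w′} {x} {y} {+ n} {κ′} c with chain-stepˡ c (nonnegative-starts {w} {w′} n)
  ... | u , c′ = (λ _ → nonnegative-≤ {x = x} {y} c′ (∈ₚ.∈-++⁺ʳ (zipᵛ (nonnegative-starts {w} {w′} n) u) (there (here refl))) n u
                   (∈ₚ.∈-++⁺ʳ (zipᵛ (nonnegative-starts {w} {w′} n) u) (here refl)) ∈ₚ.∈-++⁺ˡ) , λ { (ℤ.+<+ ()) }
  start-≤ {w} {w′} {x} {y} { -[1+ n ] } {κ′} c with chain-stepˡ c (negative-starts {w} {w′} n)
  ... | u , c′ = (λ ()) , λ _ → negative-≤ {x = x} {y} c′ (∈ₚ.∈-++⁺ʳ (zipᵛ (negative-starts {w} {w′} n) u) (there (here refl))) n u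
                   (∈ₚ.∈-++⁺ʳ (zipᵛ (negative-starts {w} {w′} n) u) (here refl)) ∈ₚ.∈-++⁺ˡ

  start-same : ∀ {w w′ x y κ κ′} → Chain w w′ (osuc (osuc (osuc x))) (osuc (osuc (osuc y))) ((block-start κ , block-start κ′) ∷ (block-start (+ 0) , block-start (+ 0)) ∷ []) → κ ≡ κ′
  start-same {w} {w′} {x} {y} {κ} {κ′} c with + 0 ℤ.≤? κ | + 0 ℤ.≤? κ′
  ... | yes p | yes q = ℤₚ.≤-antisym (proj₁ (start-≤ {x = x} {y} c) p) (proj₁ (start-≤ {w′} {w} {y} {x} (chain-swap c)) q)
  ... | no p | no q = ℤₚ.≤-antisym (proj₂ (start-≤ {w′} {w} {y} {x} (chain-swap c)) (ℤₚ.≰⇒> q)) (proj₂ (start-≤ {x = x} {y} c) (ℤₚ.≰⇒> p))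
  ... | yes p | no q = ⊥-elim (q (ℤₚ.≤-trans p (proj₁ (start-≤ {x = x} {y} c) p)))
  ... | no p | yes q = ⊥-elim (p (ℤₚ.≤-trans q (proj₁ (start-≤ {w′} {w} {y} {x} (chain-swap c)) q)))

search : ∀ {P : ℕ → Set} → (∀ t → Dec (P t)) → ∀ n → Σ ℕ P ⊎ (∀ t → t < n → ¬ P t)
search d zero = inj₂ λ _ ()
search d (suc n) with d n | search d n
... | yes p | _ = inj₁ (n , p)
... | no _ | inj₁ s = inj₁ s
... | no ¬p | inj₂ f = inj₂ λ t l → case ℕₚ.m≤n⇒m<n∨m≡n (ℕₚ.≤-pred l) of λ { (inj₁ t<n) → f t t<n ; (inj₂ refl) → ¬p }

module Extraction (N : Str) (trees : ℕ → ℕ → Tree) (marks : ℤ → ℕ → Bool) (group : ℕ → ℕ → ℕ)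
    (group≤ : ∀ n m → group n m ≤ n) (q : ℕ → Ord) (visible≤ : ∀ n m → visible (trees n m) ≤ₒ q (group n m)) where
  open TopLevel N

  w : World
  w k n = node (trees n) , marks k n

  M : Str
  M = structure w

  -- `osuc (q g)` exceeds the visible rank of every tree of group `g`; `r` counts the rounds that
  -- are still to be spent.
  level : ℕ → ℕ → Ord
  level r g = pad 4 (sucs r (osuc (q g)))

  Differing : ℕ → ℕ → Ix → Ix → ℕ → Set
  Differing g n i i′ t = T (even t) × group n (tree-number t) ≡ g × bit i t ≢ bit i′ t

  Coincide : ℕ → ℕ → Ix → Ix → Set
  Coincide g n i i′ = ∀ t → T (even t) → group n (tree-number t) ≡ g → bit i t ≡ bit i′ t

  -- A finite search, as a block has no marks beyond its tag.
  coincide? : ∀ g n i i′ → Σ ℕ (Differing g n i i′) ⊎ Coincide g n i i′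
  coincide? g n i i′ with search differing? (suc (tag i ⊔ tag i′))
    where
    differing? : ∀ t → Dec (Differing g n i i′ t)
    differing? t with T? (even t) | group n (tree-number t) ℕ.≟ g | bit i t Boolₚ.≟ bit i′ t
    ... | yes e | yes p | no d = yes (e , p , d)
    ... | no ¬e | _ | _ = no λ (e , _) → ¬e e
    ... | _ | no ¬p | _ = no λ (_ , p , _) → ¬p p
    ... | _ | _ | yes d = no λ (_ , _ , ¬d) → ¬d d
  ... | inj₁ s = inj₁ s
  ... | inj₂ f = inj₂ agree
    where
    agree : Coincide g n i i′
    agree t e p with bit i t Boolₚ.≟ bit i′ t
    ... | yes d = d
    ... | no ¬d with t ℕ.≤? (tag i ⊔ tag i′)
    ...   | yes l = ⊥-elim (f t (s≤s l) (e , p , ¬d))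
    ...   | no ¬l = trans (bit-above i t (ℕₚ.≤-<-trans (ℕₚ.m≤m⊔n (tag i) (tag i′)) (ℕₚ.≰⇒> ¬l)))
                      (sym (bit-above i′ t (ℕₚ.≤-<-trans (ℕₚ.m≤n⊔m (tag i) (tag i′)) (ℕₚ.≰⇒> ¬l))))

  -- The two paths cannot be told apart by looking at the slots carrying trees of group g.
  data Agreement (g : ℕ) : Path → Path → Set where
    sep : ∀ {e} → Agreement g (e ∷ []) (e ∷ [])
    inside : ∀ {k n i i′ j ρ ρ′} → Coincide g n i i′ → (group n (tree-number j) ≡ g → ρ ≡ ρ′) → slots ρ ≡ slots ρ′ →
      Agreement g ((k , n) ∷ (i , j) ∷ ρ) ((k , n) ∷ (i′ , j) ∷ ρ′)

  data SameShape : Path → Path → Set where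
    sep : ∀ {e} → SameShape (e ∷ []) (e ∷ [])
    inside : ∀ {k n i i′ j ρ ρ′} → slots ρ ≡ slots ρ′ → SameShape ((k , n) ∷ (i , j) ∷ ρ) ((k , n) ∷ (i′ , j) ∷ ρ′)

  Agreement-sym : ∀ {g π π′} → Agreement g π π′ → Agreement g π′ π
  Agreement-sym sep = sep
  Agreement-sym (inside c r s) = inside (λ t e p → sym (c t e p)) (λ p → sym (r p)) (sym s)

  Agreement-trans : ∀ {g π π′ π″} → Agreement g π π′ → Agreement g π′ π″ → Agreement g π π″
  Agreement-trans sep sep = sep
  Agreement-trans (inside c r s) (inside c′ r′ s′) =
    inside (λ t e p → trans (c t e p) (c′ t e p)) (λ p → trans (r p) (r′ p)) (trans s s′)

  slot-number : Path → ℕ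
  slot-number [] = 0
  slot-number ((k , n) ∷ _) = n

  -- By `group≤`, slot `n` contains only trees of groups up to `n`, so beyond that there is nothing
  -- to compare. This reduces the infinitely many ranks to finitely many for each element.
  agree-beyond : ∀ {g π π′} → slot-number π < g → SameShape π π′ → Agreement g π π′
  agree-beyond l sep = sep
  agree-beyond {g} l (inside {k} {n} {j = j} s) = inside (λ t e p → ⊥-elim (absurd t p)) (λ p → ⊥-elim (absurd j p)) s
    where
    absurd : ∀ t → group n (tree-number t) ≡ g → ⊥
    absurd t p = ℕₚ.<⇒≱ l (subst (_≤ n) p (group≤ n (tree-number t)))

  -- A block is determined by its marks, each of which lies in a slot of some group; the remainder
  -- of the path is settled by the group of its own slot.
  agree-all : ∀ {π π′} → T (valid (top w) π) → T (valid (top w) π′) → (∀ g → Agreement g π π′) → π ≡ π′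
  agree-all {[]} v v′ a with () ← a 0
  agree-all {_ ∷ []} v v′ a with sep ← a 0 = refl
  agree-all {(k , n) ∷ (i , j) ∷ ρ} v v′ a with inside {i′ = i′} {ρ′ = ρ′} _ _ _ ← a (group n (tree-number j)) =
    cong₂ (λ i ρ → (k , n) ∷ (i , j) ∷ ρ) (index-same (i ≟ᴵ i′)) (rest-same (a (group n (tree-number j))))
    where
    coincide : ∀ g → Agreement g ((k , n) ∷ (i , j) ∷ ρ) ((k , n) ∷ (i′ , j) ∷ ρ′) → Coincide g n i i′
    coincide g (inside c _ _) = c
    rest-same : Agreement (group n (tree-number j)) ((k , n) ∷ (i , j) ∷ ρ) ((k , n) ∷ (i′ , j) ∷ ρ′) → ρ ≡ ρ′
    rest-same (inside _ r _) = r refl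
    index-same : Dec (i ≡ i′) → i ≡ i′
    index-same (yes p) = p
    index-same (no ¬p) = let t , e , d = differing-slot i i′ ¬p in
      ⊥-elim (d (coincide (group n (tree-number t)) (a _) t (true⇒T e) refl))

  record Compared (h g : ℕ) (m m′ : Elem w) : Set where
    constructor compared
    field
      same-pos : pos m ≡ pos m′
      same-shape : SameShape (path m) (path m′)
      verdict : Agreement g (path m) (path m′) ⊎ q h <ₒ q g

  ordered : ∀ {h g n m} → group n m ≡ g → osuc (q h) ≤ₒ visible (trees n m) → q h <ₒ q g
  ordered {h} {g} {n} {m} refl p = <-≤ₒ-trans (q h) (visible (trees n m)) (q g) p (visible≤ n m)

  compare-inside : ∀ {h g m m′ st st′} κ n i j ρ i′ j′ ρ′ →
    RankedChain true w w (osuc (osuc (q h))) (osuc (osuc (q g))) ((st , st′) ∷ (m , m′) ∷ []) →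
    IsSlot st [] (κ , []) 0 → IsSlot st′ [] (κ , []) 0 →
    path m ≡ ((κ , []) , n) ∷ (i , j) ∷ ρ → path m′ ≡ ((κ , []) , n) ∷ (i′ , j′) ∷ ρ′ → slots ((i , j) ∷ ρ) ≡ slots ((i′ , j′) ∷ ρ′) →
    Agreement g (((κ , []) , n) ∷ (i , j) ∷ ρ) (((κ , []) , n) ∷ (i′ , j′) ∷ ρ′) ⊎ q h <ₒ q g
  compare-inside {h} {g} {m} {m′} {st} {st′} κ n i j ρ i′ j′ ρ′ c hst hst′ hm hm′ sl
    with refl ← Listₚ.∷-injectiveˡ sl =
    decide (ranked-locate true {a = osuc (q h)} {osuc (q g)} [] (κ , []) [] (κ , []) n i j ρ c hst hst′ even-n even-j valid-n
      (proj₁ (valid-++⁻ (top w) (((κ , []) , n) ∷ (i , j) ∷ []) ρ vm)) hm)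
    where
    x = marks κ n
    vm : T (valid (top w) (((κ , []) , n) ∷ (i , j) ∷ ρ))
    vm = subst (T ∘ valid (top w)) hm (path-valid′ m)
    vm′ : T (valid (top w) (((κ , []) , n) ∷ (i′ , j) ∷ ρ′))
    vm′ = subst (T ∘ valid (top w)) hm′ (path-valid′ m′)
    even-n : T (even n)
    even-n = proj₁ (∧-T⁻ {even n} vm)
    valid-n : T (valid (top w) (((κ , []) , n) ∷ []))
    valid-n = ∧-T⁺ even-n tt
    al : ∀ i ρ → T (valid (top w) (((κ , []) , n) ∷ (i , j) ∷ ρ)) → T (allowed x i) × T (even j)
    al i ρ v = ∧-T⁻ {allowed x i} (proj₁ (∧-T⁻ {entry-ok (tree (node (trees n)) x) i j} (proj₂ (∧-T⁻ {even n} v))))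
    even-j : T (even j)
    even-j = proj₂ (al i ρ vm)
    slot-valid : ∀ i t → T (allowed x i) → T (even t) → T (valid (top w) (((κ , []) , n) ∷ (i , t) ∷ []))
    slot-valid i t a e = ∧-T⁺ even-n (∧-T⁺ (∧-T⁺ a e) tt)
    decide : Located w w (level 0 h) (level 0 g) m m′ [] (((κ , []) , n) ∷ []) i j ρ (((κ , []) , n) ∷ []) →
      Agreement g (((κ , []) , n) ∷ (i , j) ∷ ρ) (((κ , []) , n) ∷ (i′ , j) ∷ ρ′) ⊎ q h <ₒ q g
    decide (located {s} {s′} hs hs′ pm′ _ c′) with refl ← trans (sym hm′) pm′ with coincide? g n i i′
    ... | inj₁ (t , e , p , d) = inj₂ (ordered {h} {g} {n} {tree-number t} p
          (variants-differ′ (trees n (tree-number t)) (bit i t) (bit i′ t) d true (osuc (q h)) (osuc (q g))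
            (((κ , []) , n) ∷ []) i (((κ , []) , n) ∷ []) i′ t (chain-⊆ _ (λ { (here refl) → here refl }) c′) hs hs′ e
            (slot-valid i t (proj₁ (al i ρ vm)) e) (slot-valid i′ t (proj₁ (al i′ ρ′ vm′)) e) refl refl
            (subst (λ g → visible (trees n (tree-number t)) ≤ₒ q g) p (visible≤ n (tree-number t)))))
    ... | inj₂ coincide with group n (tree-number j) ℕ.≟ g | Listₚ.≡-dec _≟ᵉ_ ρ ρ′
    ...   | no ¬p | _ = inj₁ (inside coincide (λ p → ⊥-elim (¬p p)) (Listₚ.∷-injectiveʳ sl))
    ...   | yes _ | yes r = inj₁ (inside coincide (λ _ → r) (Listₚ.∷-injectiveʳ sl))
    ...   | yes p | no ¬r = inj₂ (ordered {h} {g} {n} {tree-number j} p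
          (positions-differ (trees n (tree-number j)) true (osuc (q h)) (osuc (q g))
            (((κ , []) , n) ∷ []) i (((κ , []) , n) ∷ []) i′ j (bit i j) ρ ρ′ c′ hs hs′ even-j
            (slot-valid i j (proj₁ (al i ρ vm)) even-j) (slot-valid i′ j (proj₁ (al i′ ρ′ vm′)) even-j)
            refl (cong (tree (trees n (tree-number j))) (sym (coincide j even-j p)))
            hm hm′ (Listₚ.∷-injectiveʳ sl)
            (subst (λ g → visible (trees n (tree-number j)) ≤ₒ q g) p (visible≤ n (tree-number j))) ¬r))

  -- Two answers to the same `y`, obtained at different ranks, form a chain through `y`. One round
  -- locates the block of the ℤ-chain and one the block inside its slot, which leaves `level 0`.
  compare : ∀ h g {b y m m′} → Bf N M (level 2 h) ((y , m) ∷ (b , origin) ∷ []) → Bf N M (level 2 g) ((y , m′) ∷ (b , origin) ∷ []) →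
    Compared h g m m′
  compare h g {b} {y} {m} {m′} bf bf′ = by-path (path m) refl
    where
    ranked : RankedChain true w w (sucs 2 (osuc (q h))) (sucs 2 (osuc (q g))) ((m , m′) ∷ (origin , origin) ∷ [])
    ranked = chain (y ∷ b ∷ []) (m ∷ origin ∷ []) (m′ ∷ origin ∷ []) refl bf bf′
    low : Chain w w (fin 4) (fin 4) ((m , m′) ∷ (origin , origin) ∷ [])
    low = ranked-finite true (sucs 2 (osuc (q h))) (sucs 2 (osuc (q g))) ranked
    same-pos : pos m ≡ pos m′
    same-pos = proj₁ (chain-visible {x = fin 2} {fin 2} low (here refl))
    by-path : ∀ π → path m ≡ π → Compared h g m m′
    by-path [] e = ⊥-elim (subst (λ π → T (not (null π) ∧ valid (top w) π)) e (path-valid m))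
    by-path (((κ , _ ∷ _) , n) ∷ ρ) e = ⊥-elim (subst (T ∘ valid (top w)) e (path-valid′ m))
    by-path (((κ , []) , n) ∷ ρ) e = from-start (locate-top (κ , []) n ρ ranked
        (≤ₒ-trans (fin 3) (fin 4) (level 1 h) tt (fin≤pad 4 (sucs 1 (osuc (q h)))))
        (≤ₒ-trans (fin 3) (fin 4) (level 1 g) tt (fin≤pad 4 (sucs 1 (osuc (q g))))) e)
      where
      from-start : Located w w (level 1 h) (level 1 g) m m′ ((origin , origin) ∷ []) [] (κ , []) n ρ [] → Compared h g m m′
      from-start (located {st} {st′} {κ′ , _ ∷ _} hst hst′ pm′ sl c′) = ⊥-elim (subst (T ∘ valid (top w)) (cong proj₁ hst′) (path-valid′ st′))
      from-start (located {st} {st′} {κ′ , []} {ρ′} hst hst′ pm′ sl c′)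
        with refl ← raw-injective {e = st} {block-start κ} hst | refl ← raw-injective {e = st′} {block-start κ′} hst′
        with refl ← start-same {w} {w} {fin 3} {fin 3} {κ} {κ′} (chain-⊆ _ (λ { (here refl) → here refl ; (there (here refl)) → there (there (here refl)) })
               (chain-mono (level 1 h) (level 1 g) (fin 6) (fin 6) (fin≤pad 4 (q h)) (fin≤pad 4 (q g)) c′)) =
        by-rest ρ ρ′ e pm′ sl
        where
        by-rest : ∀ ρ ρ′ → path m ≡ ((κ , []) , n) ∷ ρ → path m′ ≡ ((κ , []) , n) ∷ ρ′ → slots ρ ≡ slots ρ′ → Compared h g m m′
        by-rest [] [] e e′ sl = compared same-pos (subst₂ SameShape (sym e) (sym e′) sep) (inj₁ (subst₂ (Agreement g) (sym e) (sym e′) sep))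
        by-rest ((i , j) ∷ ρ) ((i′ , j′) ∷ ρ′) e e′ sl with refl ← Listₚ.∷-injectiveˡ sl =
          compared same-pos (subst₂ SameShape (sym e) (sym e′) (inside (Listₚ.∷-injectiveʳ sl)))
            (Sum.map (subst₂ (Agreement g) (sym e) (sym e′)) id
              (compare-inside {h} {g} κ n i j ρ i′ j ρ′ (chain-⊆ _ (λ { (here refl) → here refl ; (there (here refl)) → there (here refl) }) c′)
                refl refl e e′ sl))

  Known : Carrier N → ℕ → Carrier N → Elem w → Set
  Known b g y m = Bf N M (level 2 g) ((y , m) ∷ (b , origin) ∷ [])

  -- m is the element that y has to be: for every group g it agrees with some element which y resembles up to the level of g.
  Found : Carrier N → Carrier N → Elem w → Set
  Found b y m = ∀ g → Σ (Elem w) λ m′ → Known b g y m′ × pos m ≡ pos m′ × Agreement g (path m) (path m′)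

  known-agree : ∀ g {b y m m′} → Known b g y m → Known b g y m′ → Agreement g (path m) (path m′)
  known-agree g {b} {y} {m} {m′} k k′ with Compared.verdict (compare g g {b} {y} {m} {m′} k k′)
  ... | inj₁ a = a
  ... | inj₂ l = ⊥-elim (<ₒ-irrefl (q g) l)

  found-unique : ∀ {b y m m′} → Found b y m → Found b y m′ → m ≡ m′
  found-unique {b} {y} {m} {m′} f f′ = raw-injective (cong₂ _,_
    (agree-all (path-valid′ m) (path-valid′ m′) λ g →
      let d , k , _ , a = f g ; d′ , k′ , _ , a′ = f′ g in
      Agreement-trans a (Agreement-trans (known-agree g {b} {y} {d} {d′} k k′) (Agreement-sym a′)))
    (let d , k , p , _ = f 0 ; d′ , k′ , p′ , _ = f′ 0 in
      trans p (trans (Compared.same-pos (compare 0 0 {b} {y} {d} {d′} k k′)) (sym p′))))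

  found-from : ∀ {b y} G (m : ℕ → Elem w) → (∀ g → Known b g y (m g)) → ∀ i → slot-number (path (m i)) ≤ G →
    (∀ g → g ≤ G → Agreement g (path (m i)) (path (m g))) → Found b y (m i)
  found-from {b} {y} G m k i s a g = m g , k g , Compared.same-pos c , agreement
    where
    c : Compared i g (m i) (m g)
    c = compare i g {b} {y} {m i} {m g} (k i) (k g)
    agreement : Agreement g (path (m i)) (path (m g))
    agreement with g ℕ.≤? G
    ... | yes p = a g p
    ... | no ¬p = agree-beyond (ℕₚ.≤-<-trans s (ℕₚ.≰⇒> ¬p)) (Compared.same-shape c)

  shape-slot : ∀ {π π′} → SameShape π π′ → slot-number π ≡ slot-number π′
  shape-slot sep = refl
  shape-slot (inside _) = refl

  module _ (b : Carrier N) (start : ∀ g → Bf N M (level 3 g) ((b , origin) ∷ [])) where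

    opaque
      -- Two elements are treated together so that `Agree` can be read off a single answer;
      -- `found-unique` makes the images independent of the pair in which an element occurs.
      find-pair : ∀ y₁ y₂ → Σ (Elem w) λ m₁ → Σ (Elem w) λ m₂ → Found b y₁ m₁ × Found b y₂ m₂ × Agree N M (y₁ , m₁) (y₂ , m₂)
      find-pair y₁ y₂ = finish (ascent G q {λ i → ∀ g → g ≤ G → Agreement g (path (m₁ i)) (path (m₁ g)) × Agreement g (path (m₂ i)) (path (m₂ g))} climb)
        where
        answers : ∀ g → Σ (Elem w × Elem w) λ (m₁ , m₂) → Bf N M (level 2 g) ((y₁ , m₁) ∷ (y₂ , m₂) ∷ (b , origin) ∷ [])
        answers g with proj₁ (start g) 2 (y₁ ∷ y₂ ∷ [])
        ... | m₁ ∷ m₂ ∷ [] , h = (m₁ , m₂) , h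
        m₁ m₂ : ℕ → Elem w
        m₁ g = proj₁ (proj₁ (answers g))
        m₂ g = proj₂ (proj₁ (answers g))
        both : ∀ g → Bf N M (level 2 g) ((y₁ , m₁ g) ∷ (y₂ , m₂ g) ∷ (b , origin) ∷ [])
        both g = proj₂ (answers g)
        k₁ : ∀ g → Known b g y₁ (m₁ g)
        k₁ g = Bf-⊆ N M (level 2 g) _ _ (λ { (here p) → here p ; (there m) → there (there m) }) (both g)
        k₂ : ∀ g → Known b g y₂ (m₂ g)
        k₂ g = Bf-⊆ N M (level 2 g) _ _ there (both g)
        G : ℕ
        -- The slot number is the same in all answers, by `SameShape`, so the answers at rank 0
        -- bound the groups that matter.
        G = slot-number (path (m₁ 0)) ⊔ slot-number (path (m₂ 0))
        within₁ : ∀ i → slot-number (path (m₁ i)) ≤ G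
        within₁ i = subst (_≤ G) (shape-slot (Compared.same-shape (compare 0 i {b} {y₁} {m₁ 0} {m₁ i} (k₁ 0) (k₁ i)))) (ℕₚ.m≤m⊔n _ _)
        within₂ : ∀ i → slot-number (path (m₂ i)) ≤ G
        within₂ i = subst (_≤ G) (shape-slot (Compared.same-shape (compare 0 i {b} {y₂} {m₂ 0} {m₂ i} (k₂ 0) (k₂ i)))) (ℕₚ.m≤n⊔m (slot-number (path (m₁ 0))) _)
        climb : ∀ i → i ≤ G → (∀ g → g ≤ G → Agreement g (path (m₁ i)) (path (m₁ g)) × Agreement g (path (m₂ i)) (path (m₂ g))) ⊎
          Σ ℕ λ j → j ≤ G × q i <ₒ q j
        climb i _ = all-or-some test G
          where
          test : ∀ g → (Agreement g (path (m₁ i)) (path (m₁ g)) × Agreement g (path (m₂ i)) (path (m₂ g))) ⊎ q i <ₒ q g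
          test g with Compared.verdict (compare i g {b} {y₁} {m₁ i} {m₁ g} (k₁ i) (k₁ g))
                    | Compared.verdict (compare i g {b} {y₂} {m₂ i} {m₂ g} (k₂ i) (k₂ g))
          ... | inj₂ l | _ = inj₂ l
          ... | inj₁ _ | inj₂ l = inj₂ l
          ... | inj₁ a₁ | inj₁ a₂ = inj₁ (a₁ , a₂)
        finish : (Σ ℕ λ i → i ≤ G × (∀ g → g ≤ G → Agreement g (path (m₁ i)) (path (m₁ g)) × Agreement g (path (m₂ i)) (path (m₂ g)))) →
          Σ (Elem w) λ m₁ → Σ (Elem w) λ m₂ → Found b y₁ m₁ × Found b y₂ m₂ × Agree N M (y₁ , m₁) (y₂ , m₂)
        finish (i , _ , a) = m₁ i , m₂ i ,
          found-from {b} {y₁} G m₁ k₁ i (within₁ i) (λ g p → proj₁ (a g p)) ,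
          found-from {b} {y₂} G m₂ k₂ i (within₂ i) (λ g p → proj₂ (a g p)) ,
          Bf-agree N M (level 2 i) _ (both i) (y₁ , m₁ i) (y₂ , m₂ i) (here refl) (there (here refl))

    find : Carrier N → Elem w
    find y = proj₁ (find-pair y y)

    find-found : ∀ y → Found b y (find y)
    find-found y = proj₁ (proj₂ (proj₂ (find-pair y y)))

    find-agree : ∀ y₁ y₂ → Agree N M (y₁ , find y₁) (y₂ , find y₂)
    find-agree y₁ y₂ = settle (find-pair y₁ y₂)
      where
      settle : (Σ (Elem w) λ m₁ → Σ (Elem w) λ m₂ → Found b y₁ m₁ × Found b y₂ m₂ × Agree N M (y₁ , m₁) (y₂ , m₂)) →
        Agree N M (y₁ , find y₁) (y₂ , find y₂)
      settle (m₁ , m₂ , f₁ , f₂ , a) = subst₂ (λ m₁ m₂ → Agree N M (y₁ , m₁) (y₂ , m₂))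
        (found-unique {b} {y₁} {m₁} {find y₁} f₁ (find-found y₁)) (found-unique {b} {y₂} {m₂} {find y₂} f₂ (find-found y₂)) a

    opaque
      -- If the answer `y` to `m` at the rank of `g` is not mapped to `m`, the disagreement yields a
      -- group of larger rank, with which one tries again; `ascent` ends this.
      preimage : ∀ m → Σ (Carrier N) λ y → find y ≡ m
      preimage m = let g , _ , y , e = ascent G q {λ g → Σ (Carrier N) λ y → find y ≡ m} climb in y , e
        where
        G : ℕ
        G = slot-number (path m)
        answers : ∀ g → Σ (Carrier N) λ y → Known b g y m
        answers g with proj₂ (start g) 1 (m ∷ [])
        ... | y ∷ [] , h = y , h
        climb : ∀ g → g ≤ G → (Σ (Carrier N) λ y → find y ≡ m) ⊎ Σ ℕ λ h → h ≤ G × q g <ₒ q h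
        climb g _ = resolve g (answers g)
          where
          agreement-shape : ∀ {π π′ π″ g} → SameShape π π′ → Agreement g π′ π″ → SameShape π π″
          agreement-shape sep sep = sep
          agreement-shape (inside s) (inside _ _ s′) = inside (trans s s′)
          resolve : ∀ g → (Σ (Carrier N) λ y → Known b g y m) → (Σ (Carrier N) λ y → find y ≡ m) ⊎ Σ ℕ λ h → h ≤ G × q g <ₒ q h
          resolve g (y , k) = conclude (all-or-some (λ h → test h (find-found y h)) G)
            where
            test : ∀ h → (Σ (Elem w) λ m′ → Known b h y m′ × pos (find y) ≡ pos m′ × Agreement h (path (find y)) (path m′)) →
              Agreement h (path (find y)) (path m) ⊎ q g <ₒ q h
            test h (m′ , k′ , _ , a) = Sum.map (λ a′ → Agreement-trans a (Agreement-sym a′)) id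
              (Compared.verdict (compare g h {b} {y} {m} {m′} k k′))
            conclude : (∀ h → h ≤ G → Agreement h (path (find y)) (path m)) ⊎ (Σ ℕ λ h → h ≤ G × q g <ₒ q h) →
              (Σ (Carrier N) λ y → find y ≡ m) ⊎ Σ ℕ λ h → h ≤ G × q g <ₒ q h
            conclude (inj₂ l) = inj₂ l
            conclude (inj₁ a) = inj₁ (identify (find-found y 0))
              where
              identify : (Σ (Elem w) λ m′ → Known b 0 y m′ × pos (find y) ≡ pos m′ × Agreement 0 (path (find y)) (path m′)) →
                Σ (Carrier N) λ y → find y ≡ m
              identify (m₀ , k₀ , p₀ , a₀) = y , raw-injective (cong₂ _,_
                (agree-all (path-valid′ (find y)) (path-valid′ m) agree) (trans p₀ (sym (Compared.same-pos c))))
                where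
                c : Compared g 0 m m₀
                c = compare g 0 {b} {y} {m} {m₀} k k₀
                agree : ∀ h → Agreement h (path (find y)) (path m)
                agree h with h ℕ.≤? G
                ... | yes p = a h p
                ... | no ¬p = Agreement-sym (agree-beyond (ℕₚ.≰⇒> ¬p) (agreement-shape (Compared.same-shape c) (Agreement-sym a₀)))

    extract : N ≅ M
    extract = mk↔ₛ′ find (λ m → proj₁ (preimage m)) (λ m → proj₂ (preimage m))
        (λ y → Equivalence.from (proj₂ (find-agree _ y)) (proj₂ (preimage (find y)))) ,
      λ y₁ y₂ → proj₁ (find-agree y₁ y₂)

-- Trees below a limit ordinal

-- node (low α) has hidden rank α up to a finite error, and so does node (high α), but without falling below α.
-- Alternating between the two makes up for the fact that ranks of nodes grow in steps of two.
low high : Ord → ℕ → Tree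
low ozero k = leaf
low (osuc α) k = high α k
low (olim f) k = low (f (proj₁ (unpair k))) (proj₂ (unpair k))
high ozero k = leaf
high (osuc α) k = node (low α)
high (olim f) k = high (f (proj₁ (unpair k))) (proj₂ (unpair k))

low-above : ∀ α → α ≤ₒ osuc (hidden (node (low α)))
high-above : ∀ α → α ≤ₒ hidden (node (high α))
low-above ozero = tt
low-above (osuc α) = high-above α
low-above (olim f) i = ≤ₒ-trans (f i) (osuc (hidden (node (low (f i))))) (osuc (hidden (node (low (olim f))))) (low-above (f i))
  λ k → ≤ₒ-mono-lim (osuc (osuc (hidden (low (f i) k)))) (λ k → osuc (osuc (hidden (low (olim f) k)))) (pair i k)
    (subst (λ x → osuc (osuc (hidden (low (f i) k))) ≤ₒ osuc (osuc (hidden (low (f (proj₁ x)) (proj₂ x)))))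
          (sym (unpair-pair i k)) (≤ₒ-refl (hidden (low (f i) k))))
high-above ozero = tt
high-above (osuc α) = 0 , low-above α
high-above (olim f) i = ≤ₒ-trans (f i) (hidden (node (high (f i)))) (hidden (node (high (olim f)))) (high-above (f i))
  λ k → ≤ₒ-mono-lim (osuc (osuc (hidden (high (f i) k)))) (λ k → osuc (osuc (hidden (high (olim f) k)))) (pair i k)
    (subst (λ x → osuc (osuc (hidden (high (f i) k))) ≤ₒ osuc (osuc (hidden (high (f (proj₁ x)) (proj₂ x)))))
          (sym (unpair-pair i k)) (≤ₒ-refl (hidden (high (f i) k))))

low-below : ∀ α k → hidden (low α k) ≤ₒ α
high-below : ∀ α k → hidden (high α k) ≤ₒ osuc α
low-below ozero k = tt
low-below (osuc α) k = high-below α k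
low-below (olim f) k = ≤ₒ-mono-lim (hidden (low (olim f) k)) f (proj₁ (unpair k)) (low-below (f (proj₁ (unpair k))) (proj₂ (unpair k)))
high-below ozero k = tt
high-below (osuc α) k = λ n → low-below α n
high-below (olim f) k = ≤ₒ-trans (hidden (high (olim f) k)) (osuc (f (proj₁ (unpair k)))) (osuc (olim f))
  (high-below (f (proj₁ (unpair k))) (proj₂ (unpair k))) (≤ₒ-lim f (proj₁ (unpair k)))

-- At a leaf the left side is `double (fin 4)`, that is `fin 9`; at a node both sides grow by two.
visible-bound : ∀ t → double (pad 4 (visible t)) ≤ₒ sucs 9 (hidden t)
visible-bound leaf = tt
visible-bound (node f) k = ≤ₒ-trans (double (pad 4 (visible (f k)))) (sucs 9 (hidden (f k))) (sucs 7 (hidden (node f)))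
  (visible-bound (f k)) (≤ₒ-lim (λ k → osuc (osuc (hidden (f k)))) k)

-- A cofinal enumeration of predecessors, with `ozero` as default where there are none.
point : Ord → ℕ → Ord
point ozero n = ozero
point (osuc α) zero = α
point (osuc α) (suc n) = point α n
point (olim f) n = point (f (proj₁ (unpair n))) (proj₂ (unpair n))

point-< : ∀ α n → point α n <ₒ α ⊎ point α n ≡ ozero
point-< ozero n = inj₂ refl
point-< (osuc α) zero = inj₁ (≤ₒ-refl α)
point-< (osuc α) (suc n) with point-< α n
... | inj₁ p = inj₁ (<⇒≤ₒ (point α n) α p)
... | inj₂ e = inj₂ e
point-< (olim f) n with point-< (f (proj₁ (unpair n))) (proj₂ (unpair n))
... | inj₁ p = inj₁ (proj₁ (unpair n) , p)
... | inj₂ e = inj₂ e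

point-cofinal : ∀ α β → β <ₒ α → Σ ℕ λ n → β ≤ₒ point α n
point-cofinal (osuc α) β p = 0 , p
point-cofinal (olim f) β (i , p) = let n , q = point-cofinal (f i) β p in
  pair i n , subst (λ x → β ≤ₒ point (f (proj₁ x)) (proj₂ x)) (sym (unpair-pair i n)) q

module Levels (λ′ : Ord) (limit : IsLimit λ′) where
  p : ℕ → Ord
  p = point λ′

  p<λ : ∀ g → p g <ₒ λ′
  p<λ g with point-< λ′ g
  ... | inj₁ l = l
  ... | inj₂ e = subst (_<ₒ λ′) (sym e) (proj₁ limit)

  group : ℕ → ℕ → ℕ
  group n m = proj₁ (unpair m) ℕ.⊓ n

  -- The trees of slot n come from the first n + 1 points of the limit: their join need not be below it.
  trees : ℕ → ℕ → Tree
  trees n m = high (p (group n m)) (proj₂ (unpair m))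

  q : ℕ → Ord
  q g = olim λ k → visible (high (p g) k)

  visible≤q : ∀ n m → visible (trees n m) ≤ₒ q (group n m)
  visible≤q n m = ≤ₒ-lim (λ k → visible (high (p (group n m)) k)) (proj₂ (unpair m))

  p≤hidden : ∀ {g n} → g ≤ n → p g ≤ₒ hidden (node (trees n))
  p≤hidden {g} {n} g≤n = ≤ₒ-trans (p g) (hidden (node (high (p g)))) (hidden (node (trees n))) (high-above (p g))
    λ k → ≤ₒ-mono-lim (osuc (osuc (hidden (high (p g) k)))) (λ m → osuc (osuc (hidden (trees n m)))) (pair g k)
      (subst (λ x → osuc (osuc (hidden (high (p g) k))) ≤ₒ osuc (osuc (hidden (high (p (proj₁ x ℕ.⊓ n)) (proj₂ x)))))
        (sym (unpair-pair g k)) (subst (λ g′ → hidden (high (p g) k) ≤ₒ hidden (high (p g′) k)) (sym (ℕₚ.m≤n⇒m⊓n≡m g≤n)) (≤ₒ-refl (hidden (high (p g) k)))))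

  -- The 18 successors: 8 for the four doubled rounds of `sucs 4`, 9 from `visible-bound` and 1 from
  -- `high-below`.
  double-level<λ : ∀ g → double (pad 4 (sucs 4 (q g))) <ₒ λ′
  double-level<λ g = ≤-<ₒ-trans (double (pad 4 (sucs 4 (q g)))) (sucs 18 (p g)) λ′
    (λ k → ≤ₒ-trans (double (pad 4 (visible (high (p g) k)))) (sucs 9 (hidden (high (p g) k))) (sucs 10 (p g))
      (visible-bound (high (p g) k)) (sucs-mono 9 (hidden (high (p g) k)) (osuc (p g)) (high-below (p g) k)))
    (sucs-< λ′ limit 18 (p g) (p<λ g))

-- Failure of Π Scott sentences

slot-of : Raw → ℕ
slot-of ([] , _) = 0
slot-of ((_ , n) ∷ _ , _) = n

AgreeBelow : ℕ → World → World → Set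
AgreeBelow m w w′ = ∀ κ n → n < m → w κ n ≡ w′ κ n

carry : ∀ {m w w′} → AgreeBelow m w w′ → (e : Elem w) → slot-of (raw e) < m → T (elem-ok w′ (raw e))
carry a (elem ([] , p) ()) l
carry {w = w} {w′} a (elem (((κ , l) , n) ∷ π , p) o) lt =
  let u , v = ∧-T⁻ {null l ∧ even n} (proj₁ (∧-T⁻ {valid (top w) (((κ , l) , n) ∷ π)} o)) in
  ∧-T⁺ (∧-T⁺ u (subst (λ x → T (valid (uncurry tree x) π)) (a κ n lt) v))
    (proj₂ (∧-T⁻ {valid (top w) (((κ , l) , n) ∷ π)} o))

module Variation (trees : ℕ → ℕ → Tree) where
  world : (ℤ → ℕ → Bool) → World
  world z κ n = node (trees n) , z κ n

  any-variants : ∀ {β} α x x′ → β ≤ₒ hidden α → Equivalent β α x x′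
  any-variants {β} α false true p = ≤ₒ-step β (hidden α) p
  any-variants α false false p = p
  any-variants α true true p = p
  any-variants α true false p = p

  module _ {β m} (small : ∀ n → m ≤ n → β ≤ₒ hidden (node (trees n))) {z z′ : ℤ → ℕ → Bool}
           (a : ∀ κ n → n < m → z κ n ≡ z′ κ n) where
    slot-state : ∀ κ n → Dec (n < m) → State β (tree (node (trees n)) (z κ n)) (tree (node (trees n)) (z′ κ n))
    slot-state κ n (yes l) = idem′ (a κ n l)
    slot-state κ n (no ¬l) = fresh (any-variants {β} (node (trees n)) (z κ n) (z′ κ n) (small n (ℕₚ.≮⇒≥ ¬l)))

    -- From slot `m` on the trees are so large that their variants are equivalent at rank `β`, so
    -- infinitely many marks may change at once.
    varied : State β (top (world z)) (top (world z′))
    varied = tops λ κ n → slot-state κ n (n ℕ.<? m)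

    varied-paired : ∀ (e : Elem (world z)) (e′ : Elem (world z′)) → raw e ≡ raw e′ → slot-of (raw e) < m → Paired varied e e′
    varied-paired (elem ([] , p) ()) _ refl l
    varied-paired (elem (((κ , l) , n) ∷ π , p) _) (elem _ _) refl lt with n ℕ.<? m
    ... | yes q = (refl , Related-idem′ (a κ n q) π) , refl
    ... | no ¬q = ⊥-elim (¬q lt)

  slots-bound : ∀ {w n} → Vec (Elem w) n → ℕ
  slots-bound [] = 0
  slots-bound (e ∷ v) = suc (slot-of (raw e)) ⊔ slots-bound v

  slots-bound-< : ∀ {w n} (v : Vec (Elem w) n) i → slot-of (raw (lookup v i)) < slots-bound v
  slots-bound-< (e ∷ v) fz = ℕₚ.m≤m⊔n (suc (slot-of (raw e))) (slots-bound v)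
  slots-bound-< (e ∷ v) (fs i) = ℕₚ.≤-trans (slots-bound-< v i) (ℕₚ.m≤n⊔m (suc (slot-of (raw e))) (slots-bound v))

  SameRaw : ∀ {w w′ n} → Vec (Elem w) n → Vec (Elem w′) n → Set
  SameRaw [] [] = ⊤
  SameRaw (e ∷ v) (e′ ∷ v′) = raw e ≡ raw e′ × SameRaw v v′

  sameRaw-lookup : ∀ {w w′ n} (v : Vec (Elem w) n) (v′ : Vec (Elem w′) n) → SameRaw v v′ → ∀ i → raw (lookup v i) ≡ raw (lookup v′ i)
  sameRaw-lookup (e ∷ v) (e′ ∷ v′) (p , s) fz = p
  sameRaw-lookup (e ∷ v) (e′ ∷ v′) (p , s) (fs i) = sameRaw-lookup v v′ s i

  module Commitments (λ′ : Ord) (p : ℕ → Ord) (cofinal : ∀ β → β <ₒ λ′ → Σ ℕ λ g → β ≤ₒ p g)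
      (p≤hidden : ∀ {g n} → g ≤ n → p g ≤ₒ hidden (node (trees n))) (z : ℤ → ℕ → Bool) where

    -- Truth as an open condition on the marks. Tuples of different worlds are compared by their raw
    -- data.
    Persists : ∀ {n} → Form n → Vec (Elem (world z)) n → Set
    Persists φ e = Σ ℕ λ m → ∀ z′ → (∀ κ n → n < m → z κ n ≡ z′ κ n) → (e′ : Vec (Elem (world z′)) _) → SameRaw e e′ →
      Sat (structure (world z′)) φ e′

    QF-persists : ∀ {n} {φ : Form n} {e} → QF φ → Sat (structure (world z)) φ e → Persists φ e
    QF-persists {e = e} qφ s = 0 , λ z′ _ e′ eqs → Equivalence.to (QF-transfer (structure (world z)) (structure (world z′)) qφ
      (λ i j → cmpᴱ-agree (lookup e i) (lookup e j) (lookup e′ i) (lookup e′ j)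
        (cong₂ (cmp Raw-comparator) (sameRaw-lookup e e′ eqs i) (sameRaw-lookup e e′ eqs j)))) s

    -- The witnesses survive if the slots in which they lie are kept, and the Π matrix, of some rank
    -- `β` below λ, survives every change beyond slot `g` when `β ≤ₒ p g`.
    ExBlock-persists : ∀ {α n} {φ : Form n} e → ExBlock α φ → α ≤ₒ λ′ → Sat (structure (world z)) φ e → Persists φ e
    ExBlock-persists {α} {n} {φ} e (base {β = β} β<α πφ) α≤ s with cofinal β (<-≤ₒ-trans β α λ′ β<α α≤)
    ... | g , β≤ = g ⊔ slots-bound e , persists
      where
      persists : ∀ z′ → (∀ κ k → k < g ⊔ slots-bound e → z κ k ≡ z′ κ k) → (e′ : Vec (Elem (world z′)) n) → SameRaw e e′ → Sat (structure (world z′)) φ e′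
      persists z′ a e′ eqs = Π-transfer (structure (world z)) (structure (world z′)) e e′ πφ
        (Preserves-mono β (p g) (structure (world z)) (structure (world z′)) e e′ β≤
          (state-preserves (p g) (varied small a) e e′ λ i → varied-paired small a (lookup e i) (lookup e′ i)
            (sameRaw-lookup e e′ eqs i) (ℕₚ.≤-trans (slots-bound-< e i) (ℕₚ.m≤n⊔m g _)))) s
        where
        small : ∀ n → g ⊔ slots-bound e ≤ n → p g ≤ₒ hidden (node (trees n))
        small n l = p≤hidden (ℕₚ.≤-trans (ℕₚ.m≤m⊔n g _) l)
    ExBlock-persists e (step b) α≤ (d , s) with ExBlock-persists (d ∷ e) b α≤ s
    ... | m , persists = m ⊔ suc (slot-of (raw d)) , λ z′ a e′ eqs →
      let d′ = elem {world z′} (raw d) (carry {m ⊔ suc (slot-of (raw d))} {world z} {world z′} (λ κ n l → cong (node (trees n) ,_) (a κ n l)) d (ℕₚ.m≤n⊔m m _)) in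
      d′ , persists z′ (λ κ n l → a κ n (ℕₚ.≤-trans l (ℕₚ.m≤m⊔n m _))) (d′ ∷ e′) (refl , eqs)

    Σ-persists : ∀ {β n} {φ : Form n} e → IsΣ β φ → β ≤ₒ λ′ → Sat (structure (world z)) φ e → Persists φ e
    Σ-persists e (qf qφ) β≤ s = QF-persists {e = e} qφ s
    Σ-persists e (disj f b) β≤ (i , s) with ExBlock-persists e (b i) β≤ s
    ... | m , persists = m , λ z′ a e′ eqs → i , persists z′ a e′ eqs

arity : ∀ {α n} {φ : Form n} → AllBlock α φ → ℕ
arity (base _ _) = 0
arity (step b) = suc (arity b)

Instance : ∀ {α n} {φ : Form n} → AllBlock α φ → (M : Str) → Vec (Carrier M) n → ∀ {k} → Vec (Carrier M) k → Set
Instance {φ = φ} (base _ _) M e v = Sat M φ e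
-- A default for tuples that are too short; `Instance⇒Sat` uses those of length `arity b`.
Instance (step b) M e [] = ⊤
Instance (step b) M e (a ∷ v) = Instance b M (a ∷ e) v

Sat⇒Instance : ∀ {α n} {φ : Form n} (b : AllBlock α φ) M e → Sat M φ e → ∀ {k} (v : Vec (Carrier M) k) → Instance b M e v
Sat⇒Instance (base _ _) M e s v = s
Sat⇒Instance (step b) M e s [] = tt
Sat⇒Instance (step b) M e s (a ∷ v) = Sat⇒Instance b M (a ∷ e) (s a) v

Instance⇒Sat : ∀ {α n} {φ : Form n} (b : AllBlock α φ) M e → ((v : Vec (Carrier M) (arity b)) → Instance b M e v) → Sat M φ e
Instance⇒Sat (base _ _) M e h = h []
Instance⇒Sat (step b) M e h a = Instance⇒Sat b M (a ∷ e) (λ v → h (a ∷ v))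

shift-raw : ℤ → Raw → Raw
shift-raw d ([] , p) = [] , p
shift-raw d (((κ , l) , n) ∷ π , p) = ((κ +ℤ d , l) , n) ∷ π , p

shift-raw-cmp : ∀ d r r′ → cmp Raw-comparator (shift-raw d r) (shift-raw d r′) ≡ cmp Raw-comparator r r′
shift-raw-cmp d ([] , p) ([] , p′) = refl
shift-raw-cmp d ([] , p) (_ ∷ _ , p′) = refl
shift-raw-cmp d (_ ∷ _ , p) ([] , p′) = refl
shift-raw-cmp d (((κ , l) , n) ∷ π , p) (((κ′ , l′) , n′) ∷ π′ , p′) rewrite cmpᴵ-translate {κ} {κ′} d l l′ = refl

shift-raw-inverse : ∀ d d′ → (∀ κ → (κ +ℤ d) +ℤ d′ ≡ κ) → ∀ r → shift-raw d′ (shift-raw d r) ≡ r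
shift-raw-inverse d d′ h ([] , p) = refl
shift-raw-inverse d d′ h (((κ , l) , n) ∷ π , p) = cong (λ κ → ((κ , l) , n) ∷ π , p) (h κ)

translate : ℤ → World → World
translate d w κ n = w (κ +ℤ d) n

shift-ok : ∀ d w r → T (elem-ok (translate d w) r) → T (elem-ok w (shift-raw d r))
shift-ok d w (((κ , l) , n) ∷ π , p) o = o

unshift-ok : ∀ d w r → T (elem-ok w r) → T (elem-ok (translate d w) (shift-raw (-ℤ d) r))
unshift-ok d w (((κ , l) , n) ∷ π , p) o =
  subst (λ κ → T (((null l ∧ even n) ∧ valid (uncurry tree (w κ n)) π) ∧ (p ≤ᵇ size (((κ , l) , n) ∷ π)))) (sym (cancel κ)) o
  where
  cancel : ∀ κ → (κ +ℤ -ℤ d) +ℤ d ≡ κ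
  cancel κ = trans (ℤₚ.+-assoc κ (-ℤ d) d) (trans (cong (κ +ℤ_) (ℤₚ.+-inverseˡ d)) (ℤₚ.+-identityʳ κ))

translate-≅ : ∀ d w → structure (translate d w) ≅ structure w
translate-≅ d w = mk↔ₛ′
    (λ e → elem (shift-raw d (raw e)) (shift-ok d w (raw e) (ok e)))
    (λ e → elem (shift-raw (-ℤ d) (raw e)) (unshift-ok d w (raw e) (ok e)))
    (λ e → raw-injective (shift-raw-inverse (-ℤ d) d (λ κ → trans (ℤₚ.+-assoc κ (-ℤ d) d) (trans (cong (κ +ℤ_) (ℤₚ.+-inverseˡ d)) (ℤₚ.+-identityʳ κ))) (raw e)))
    (λ e → raw-injective (shift-raw-inverse d (-ℤ d) (λ κ → trans (ℤₚ.+-assoc κ d (-ℤ d)) (trans (cong (κ +ℤ_) (ℤₚ.+-inverseʳ d)) (ℤₚ.+-identityʳ κ))) (raw e))) ,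
  λ a b → mk⇔ (trans (shift-raw-cmp d (raw a) (raw b))) (trans (sym (shift-raw-cmp d (raw a) (raw b))))

does-⇔ : ∀ {A B : Set} (a : Dec A) (b : Dec B) → (A → B) → (B → A) → does a ≡ does b
does-⇔ (yes _) (yes _) f g = refl
does-⇔ (no _) (no _) f g = refl
does-⇔ (yes a) (no ¬b) f g = ⊥-elim (¬b (f a))
does-⇔ (no ¬a) (yes b) f g = ⊥-elim (¬a (g b))

does-true : ∀ {A : Set} (a : Dec A) → does a ≡ true → A
does-true (yes a) _ = a

-- These marks are recurrent: moving the origin by 2 ^ x changes no mark in slots up to x.
divisibility : ℤ → ℕ → Bool
divisibility κ n = does (+ (2 ^ n) ℤ∣.∣? κ)

2^-divides : ∀ {m n} → m ≤ n → + (2 ^ m) ℤ∣.∣ + (2 ^ n)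
2^-divides {m} {n} p = ℤ∣.divides (+ (2 ^ (n ∸ m))) (trans (cong +_ (trans (cong (2 ^_) (sym (ℕₚ.m∸n+n≡m p)))
  (ℕₚ.^-distribˡ-+-* 2 (n ∸ m) m))) (ℤₚ.pos-* (2 ^ (n ∸ m)) (2 ^ m)))

divisibility-periodic : ∀ κ {n x} → n ≤ x → divisibility (κ +ℤ + (2 ^ x)) n ≡ divisibility κ n
divisibility-periodic κ {n} {x} p = does-⇔ (+ (2 ^ n) ℤ∣.∣? (κ +ℤ + (2 ^ x))) (+ (2 ^ n) ℤ∣.∣? κ)
  (λ d → ℤ∣.∣m+n∣n⇒∣m {m = κ} d (2^-divides p)) (λ d → ℤ∣.∣m∣n⇒∣m+n {m = κ} d (2^-divides p))

n<2^n : ∀ n → n < 2 ^ n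
n<2^n zero = ℕₚ.≤-refl
n<2^n (suc n) = ℕₚ.≤-trans (ℕₚ.+-mono-≤ (ℕₚ.≤-trans (s≤s z≤n) (n<2^n n)) (n<2^n n))
  (ℕₚ.≤-reflexive (cong (λ k → (2 ^ n) + k) (sym (ℕₚ.+-identityʳ (2 ^ n)))))

-- The carrier changes with the marks, so instances are enumerated as raw tuples, and at a given
-- stage such a tuple may fail to consist of elements.
lift : ∀ w {k} → Vec Raw k → Maybe (Vec (Elem w) k)
lift w [] = just []
lift w (r ∷ rs) with T? (elem-ok w r) | lift w rs
... | yes o | just v = just (elem r o ∷ v)
... | _ | _ = nothing

lift-∷ : ∀ w r {k} (rs : Vec Raw k) u (o : T (elem-ok w r)) → lift w rs ≡ just u → lift w (r ∷ rs) ≡ just (elem r o ∷ u)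
lift-∷ w r rs u o e with T? (elem-ok w r) | lift w rs | e
... | yes o′ | just _ | refl = cong (λ o → just (elem r o ∷ u)) (T-irrelevant o′ o)
... | no ¬o | _ | _ = ⊥-elim (¬o o)

module Instances (trees : ℕ → ℕ → Tree) where
  open Variation trees public

  lift-agreeing : ∀ {z z′ m k} (v : Vec (Elem (world z′)) k) → (∀ κ n → n < m → z′ κ n ≡ z κ n) → slots-bound v ≤ m →
    Σ (Vec (Elem (world z)) k) λ u → lift (world z) (Vec.map raw v) ≡ just u × SameRaw u v
  lift-agreeing [] a b = [] , refl , tt
  lift-agreeing {z} {z′} {m} (e ∷ v) a b =
    let u , l , s = lift-agreeing {z} {z′} {m} v a (ℕₚ.≤-trans (ℕₚ.m≤n⊔m (suc (slot-of (raw e))) (slots-bound v)) b)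
        o = carry {m} {world z′} {world z} (λ κ n l → cong (node (trees n) ,_) (a κ n l)) e
              (ℕₚ.≤-trans (ℕₚ.m≤m⊔n (suc (slot-of (raw e))) (slots-bound v)) b)
    in elem (raw e) o ∷ u , lift-∷ (world z) (raw e) (Vec.map raw v) u o l , refl , s

  module InstanceCommitments (λ′ : Ord) (p : ℕ → Ord) (cofinal : ∀ β → β <ₒ λ′ → Σ ℕ λ g → β ≤ₒ p g)
      (p≤hidden : ∀ {g n} → g ≤ n → p g ≤ₒ hidden (node (trees n))) (z : ℤ → ℕ → Bool) where
    open Commitments λ′ p cofinal p≤hidden z public

    Instance-persists : ∀ {α n} {φ : Form n} (b : AllBlock α φ) → α ≤ₒ osuc λ′ → (e : Vec (Elem (world z)) n) → ∀ {k} (v : Vec (Elem (world z)) k) →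
      Instance b (structure (world z)) e v → Σ ℕ λ m → ∀ z′ → (∀ κ n → n < m → z κ n ≡ z′ κ n) →
        (e′ : Vec (Elem (world z′)) n) → SameRaw e e′ → (v′ : Vec (Elem (world z′)) k) → SameRaw v v′ → Instance b (structure (world z′)) e′ v′
    Instance-persists {α} (base {β = β} β<α σ) α≤ e v s with Σ-persists e σ (<-≤ₒ-trans β α (osuc λ′) β<α α≤) s
    ... | m , persists = m , λ z′ a e′ eqs v′ _ → persists z′ a e′ eqs
    Instance-persists (step b) α≤ e [] s = 0 , λ { z′ a e′ eqs [] _ → tt }
    Instance-persists (step b) α≤ e (d ∷ v) s with Instance-persists b α≤ (d ∷ e) v s
    ... | m , persists = m , λ { z′ a e′ eqs (d′ ∷ v′) (e≡ , eqs′) → persists z′ a (d′ ∷ e′) (e≡ , eqs) v′ eqs′ }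

-- The limit of translates

module Diagonal (λ′ : Ord) (limit : IsLimit λ′) where
  open Levels λ′ limit public
  open Instances trees public

  translated : ℕ → ℤ → ℕ → Bool
  translated b κ n = divisibility (κ +ℤ + b) n

  M : Str
  M = structure (world divisibility)

  module Limit (f : ℕ → Form 0) (blocks : ∀ i → AllBlock (osuc λ′) (f i))
      (holds : ∀ b i → Sat (structure (world (translated b))) (f i) []) where

    module C (b : ℕ) = InstanceCommitments λ′ p (point-cofinal λ′) p≤hidden (translated b)

    Instances-of : ℕ → Set
    Instances-of i = Vec Raw (arity (blocks i))

    persistent : ∀ b i (v : Vec (Elem (world (translated b))) (arity (blocks i))) → Σ ℕ λ m → ∀ z′ → (∀ κ n → n < m → translated b κ n ≡ z′ κ n) →
      (e′ : Vec (Elem (world z′)) 0) → SameRaw {world (translated b)} {world z′} [] e′ → (v′ : Vec (Elem (world z′)) (arity (blocks i))) → SameRaw v v′ →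
      Instance (blocks i) (structure (world z′)) e′ v′
    persistent b i v = C.Instance-persists b (blocks i) (≤ₒ-refl (osuc λ′)) [] v (Sat⇒Instance (blocks i) _ [] (holds b i) v)

    need-lifted : ∀ b i → Maybe (Vec (Elem (world (translated b))) (arity (blocks i))) → ℕ
    need-lifted b i nothing = 0
    need-lifted b i (just v) = proj₁ (persistent b i v)

    need-raw : ∀ b i → Instances-of i → ℕ
    need-raw b i rs = need-lifted b i (lift (world (translated b)) rs)

    need-code : ∀ b → ℕ × ℕ → ℕ
    need-code b (i , c) = need-raw b i (dec (Vec-coding Raw-coding (arity (blocks i))) c)

    need : ℕ → ℕ → ℕ
    need b t = need-code b (unpair t)

    task : ∀ i → Instances-of i → ℕ
    task i rs = pair i (enc (Vec-coding Raw-coding (arity (blocks i))) rs)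

    need-task : ∀ b i rs → need b (task i rs) ≡ need-raw b i rs
    need-task b i rs = trans (cong (need-code b) (unpair-pair i _)) (cong (need-raw b i) (dec-enc (Vec-coding Raw-coding (arity (blocks i))) rs))

    needs : ℕ → ℕ → ℕ
    needs b zero = need b 0
    needs b (suc s) = need b (suc s) ⊔ needs b s

    need≤needs : ∀ b {t} s → t ≤ s → need b t ≤ needs b s
    need≤needs b zero z≤n = ℕₚ.≤-refl
    need≤needs b {t} (suc s) l with ℕₚ.m≤n⇒m<n∨m≡n l
    ... | inj₁ (s≤s l′) = ℕₚ.≤-trans (need≤needs b s l′) (ℕₚ.m≤n⊔m (need b (suc s)) (needs b s))
    ... | inj₂ refl = ℕₚ.m≤m⊔n (need b (suc s)) (needs b s)

    half-exponent : ℕ → ℕ → ℕ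
    -- Above `b + s`, so that the blocks near the origin, moved by `b`, get numbers below the next
    -- power of 2; and at least `needs b s`, so that the commitments are kept.
    half-exponent b s = (suc (b + s)) + needs b s

    -- Stage s commits the first s instances of the sentence and then moves the origin so far that the commitments survive.
    offset : ℕ → ℕ
    exponent : ℕ → ℕ
    offset zero = 0
    offset (suc s) = offset s + 2 ^ exponent s
    -- Doubled in order to be even: the slot with this number, which must exist in M, will show that
    -- a block is not fully marked.
    exponent s = half-exponent (offset s) s + half-exponent (offset s) s

    half≤exponent : ∀ s → half-exponent (offset s) s ≤ exponent s
    half≤exponent s = ℕₚ.m≤m+n _ _

    offset+s<exponent : ∀ s → offset s + s < exponent s
    offset+s<exponent s = ℕₚ.≤-trans (ℕₚ.m≤m+n (suc (offset s + s)) (needs (offset s) s)) (half≤exponent s)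

    s<exponent : ∀ s → s < exponent s
    s<exponent s = ℕₚ.≤-<-trans (ℕₚ.m≤n+m s (offset s)) (offset+s<exponent s)

    needs≤exponent : ∀ s → needs (offset s) s ≤ exponent s
    needs≤exponent s = ℕₚ.≤-trans (ℕₚ.m≤n+m (needs (offset s) s) (suc (offset s + s))) (half≤exponent s)

    exponent-step : ∀ s → exponent s ≤ exponent (suc s)
    exponent-step s = ℕₚ.≤-trans (ℕₚ.<⇒≤ (n<2^n (exponent s))) (ℕₚ.≤-trans (ℕₚ.m≤n+m (2 ^ exponent s) (offset s))
      (ℕₚ.≤-trans (ℕₚ.m≤m+n (offset (suc s)) (suc s)) (ℕₚ.<⇒≤ (offset+s<exponent (suc s)))))

    -- The exponents do not decrease, so all later translations are by multiples of 2 ^ n.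
    stable : ∀ {s t} κ n → s ≤ t → n ≤ exponent s → translated (offset t) κ n ≡ translated (offset s) κ n × n ≤ exponent t
    stable {s} {zero} κ n z≤n l = refl , l
    stable {s} {suc t} κ n s≤t l with ℕₚ.m≤n⇒m<n∨m≡n s≤t
    ... | inj₂ refl = refl , l
    ... | inj₁ (s≤s s≤t′) = let e , l′ = stable {s} {t} κ n s≤t′ l in
      trans (trans (cong (λ z → divisibility z n) (trans (cong (κ +ℤ_) (ℤₚ.pos-+ (offset t) (2 ^ exponent t)))
        (sym (ℤₚ.+-assoc κ (+ offset t) (+ (2 ^ exponent t)))))) (divisibility-periodic (κ +ℤ + offset t) l′)) e ,
      ℕₚ.≤-trans l′ (exponent-step t)

    -- Slot `n` is settled at stage `n`, because `n < exponent n`.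
    limit-marks : ℤ → ℕ → Bool
    limit-marks κ n = translated (offset n) κ n

    limit-agrees : ∀ s κ n → n ≤ exponent s → limit-marks κ n ≡ translated (offset s) κ n
    limit-agrees s κ n l with ℕₚ.≤-total s n
    ... | inj₁ s≤n = proj₁ (stable {s} {n} κ n s≤n l)
    ... | inj₂ n≤s = sym (proj₁ (stable {n} {s} κ n n≤s (ℕₚ.<⇒≤ (s<exponent n))))

    limit-holds : ∀ i → Sat (structure (world limit-marks)) (f i) []
    limit-holds i = Instance⇒Sat (blocks i) (structure (world limit-marks)) [] λ v′ → instance-holds v′
      where
      instance-holds : (v′ : Vec (Elem (world limit-marks)) (arity (blocks i))) → Instance (blocks i) (structure (world limit-marks)) [] v′
      instance-holds v′ = from-lift (lift-agreeing {translated (offset s)} {limit-marks} {exponent s} v′ (λ κ n l → limit-agrees s κ n (ℕₚ.<⇒≤ l))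
          (ℕₚ.≤-trans (ℕₚ.m≤n⊔m t (slots-bound v′)) (ℕₚ.<⇒≤ (s<exponent s))))
        where
        rs = Vec.map raw v′
        t = task i rs
        -- Late enough for task `t` to have been committed and for the slots of `v′` to be settled,
        -- so that `v′` already consists of elements at this stage.
        s = t ⊔ slots-bound v′
        from-lift : (Σ (Vec (Elem (world (translated (offset s)))) (arity (blocks i))) λ u → lift (world (translated (offset s))) rs ≡ just u × SameRaw u v′) →
          Instance (blocks i) (structure (world limit-marks)) [] v′
        from-lift (u , e , same-raw) = proj₂ (persistent (offset s) i u) limit-marks
          (λ κ n l → sym (limit-agrees s κ n (ℕₚ.<⇒≤ (ℕₚ.<-≤-trans l m≤)))) [] tt v′ same-raw
          where
          m≤ : proj₁ (persistent (offset s) i u) ≤ exponent s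
          m≤ = ℕₚ.≤-trans (ℕₚ.≤-reflexive (sym (trans (need-task (offset s) i rs) (cong (need-lifted (offset s) i) e))))
            (ℕₚ.≤-trans (need≤needs (offset s) s (ℕₚ.m≤m⊔n t (slots-bound v′))) (needs≤exponent s))

-- Scott complexity of the chain of blocks

QF-closed : {φ : Form 0} → QF φ → ⊥
QF-closed (rel () _)
QF-closed (eq () _)
QF-closed (neg p) = QF-closed p
QF-closed (and p _) = QF-closed p
QF-closed (or p _) = QF-closed p

≅-refl : ∀ N → N ≅ N
≅-refl N = mk↔ₛ′ id id (λ _ → refl) (λ _ → refl) , λ _ _ → mk⇔ id id

offset-between : ∀ κ o s x → ℤ.∣ κ ∣ < s → s ≤ o → o + s < x →
  Σ ℕ λ c → κ +ℤ + o ≡ + c × 0 < c × c < x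
offset-between (+ k) o s x k<s s≤o l = k + o , sym (ℤₚ.pos-+ k o) ,
  ℕₚ.≤-trans (ℕₚ.≤-trans (s≤s z≤n) k<s) (ℕₚ.≤-trans s≤o (ℕₚ.m≤n+m o k)) ,
  ℕₚ.≤-<-trans (ℕₚ.≤-trans (ℕₚ.+-monoˡ-≤ o (ℕₚ.<⇒≤ k<s)) (ℕₚ.≤-reflexive (ℕₚ.+-comm s o))) l
offset-between -[1+ k ] o s x k<s s≤o l = o ∸ suc k , ℤₚ.⊖-≥ (ℕₚ.<⇒≤ k<o) , ℕₚ.m<n⇒0<n∸m k<o ,
  ℕₚ.≤-<-trans (ℕₚ.≤-trans (ℕₚ.m∸n≤m o (suc k)) (ℕₚ.m≤m+n o s)) l
  where
  k<o : suc k < o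
  k<o = ℕₚ.<-≤-trans k<s s≤o

module Complexity (λ′ : Ord) (limit : IsLimit λ′) where
  open Diagonal λ′ limit

  divisibility-zero : ∀ n → divisibility (+ 0) n ≡ true
  divisibility-zero n = does-⇔ (+ (2 ^ n) ℤ∣.∣? + 0) (yes tt) (λ _ → tt) (λ _ → ℤ∣.divides (+ 0) refl)

  module _ (f : ℕ → Form 0) (blocks : ∀ i → AllBlock (osuc λ′) (f i))
      (holds : ∀ b i → Sat (structure (world (translated b))) (f i) []) where
    open Limit f blocks holds

    s≤offset : ∀ s → s ≤ offset s
    s≤offset zero = z≤n
    s≤offset (suc s) = ℕₚ.≤-trans (ℕₚ.≤-reflexive (sym (ℕₚ.+-comm s 1)))
      (ℕₚ.+-mono-≤ (s≤offset s) (ℕₚ.≤-trans (s≤s z≤n) (n<2^n (exponent s))))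

    exponent-even : ∀ s → T (even (exponent s))
    exponent-even s = true⇒T (even-double (half-exponent (offset s) s))

    -- At a stage `s` beyond the absolute value of `κ`, block `κ` of the limit looks like a block of
    -- M whose number is positive and smaller than 2 ^ exponent s, hence not divisible by it.
    not-all-marked : ∀ κ → (∀ n → T (even n) → limit-marks κ n ≡ true) → ⊥
    not-all-marked κ h with offset-between κ (offset s) s (2 ^ exponent s) ℕₚ.≤-refl (s≤offset s)
        (ℕₚ.<-trans (offset+s<exponent s) (n<2^n (exponent s)))
      where s = suc ℤ.∣ κ ∣
    ... | c , e , 0<c , c< = ℕₚ.<⇒≱ c< (ℕ∣.∣⇒≤ {{ℕ.>-nonZero 0<c}}
          (ℤ∣.∣⇒∣ᵤ (subst (+ (2 ^ exponent s) ℤ∣.∣_) e (does-true (+ (2 ^ exponent s) ℤ∣.∣? (κ +ℤ + offset s))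
            (trans (sym (limit-agrees s κ (exponent s) ℕₚ.≤-refl)) (h (exponent s) (exponent-even s)))))))
      where
      s = suc ℤ.∣ κ ∣

    -- An isomorphism would match block 0 of M, all of whose even slots are marked, with some block of the limit.
    limit-≇ : ¬ (structure (world limit-marks) ≅ M)
    limit-≇ i = from-start (start-answer {x = fin 2} {fin 2} (chain-swap (ranked-finite true ozero ozero (matched ozero ozero))) (here refl))
      where
      N = structure (world limit-marks)
      open TopLevel N
      e : Elem (world limit-marks)
      e = Inverse.from (proj₁ i) (block-start (+ 0))
      matched : ∀ a c → RankedChain true (world limit-marks) (world divisibility) a c ((e , block-start (+ 0)) ∷ [])
      -- The chain runs through the limit itself, by the identity and the supposed isomorphism, and
      -- so has every rank. With equal ranks just above the visible rank of a slot, a differing mark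
      -- would put that rank below itself.
      matched a c = chain (e ∷ []) (e ∷ []) (block-start (+ 0) ∷ []) refl
        (Bf-iso N N (≅-refl N) (pad 4 a) _ (refl ∷ []))
        (Bf-iso N M i (pad 4 c) _ (Inverse.strictlyInverseˡ (proj₁ i) (block-start (+ 0)) ∷ []))
      from-start : (Σ ℤ λ κ → e ≡ block-start κ) → ⊥
      from-start (κ , eκ) = not-all-marked κ marked
        where
        marked : ∀ n → T (even n) → limit-marks κ n ≡ true
        marked n ev with limit-marks κ n Boolₚ.≟ divisibility (+ 0) n
        ... | yes p = trans p (divisibility-zero n)
        ... | no ¬p = ⊥-elim (<ₒ-irrefl (visible (node (trees n)))
              (variants-differ′ (node (trees n)) (limit-marks κ n) (divisibility (+ 0) n) ¬p true
                (osuc (visible (node (trees n)))) (osuc (visible (node (trees n)))) [] (κ , []) [] (+ 0 , []) n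
                (matched (osuc (visible (node (trees n)))) (osuc (visible (node (trees n))))) (cong raw eκ) refl ev (∧-T⁺ ev tt) (∧-T⁺ ev tt) refl refl (≤ₒ-refl (visible (node (trees n))))))

  no-Π : ¬ HasΠScott M (osuc λ′)
  no-Π (_ , qf q , _) = QF-closed q
  no-Π (_ , conj f blocks , scott) = limit-≇ f blocks holds
      (Equivalence.to (scott _) (Limit.limit-holds f blocks holds))
    where
    holds : ∀ b i → Sat (structure (world (translated b))) (f i) []
    holds b = Equivalence.from (scott (structure (world (translated b)))) (translate-≅ (+ b) (world divisibility))

  module _ {β : Ord} (β≤ : β ≤ₒ λ′) where
    -- A Σ sentence of rank at most λ is a universal block without variables; the constant
    -- conjunction supplies the normal form.
    Σ⇒Π : HasΣScott M β → HasΠScott M (osuc λ′)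
    Σ⇒Π (φ , σ , scott) = ⋀ (λ _ → φ) , conj _ (λ _ → base {β = β} β≤ σ) ,
      λ N → mk⇔ (λ s → Equivalence.to (scott N) (s 0)) (λ i _ → Equivalence.from (scott N) i)

    Π⇒Π : HasΠScott M β → HasΠScott M (osuc λ′)
    Π⇒Π (φ , qf q , scott) = ⊥-elim (QF-closed q)
    Π⇒Π (φ , conj f b , scott) = φ , conj f (λ i → AllBlock-mono (≤ₒ-step β λ′ β≤) (b i)) , scott

    dΣ⇒Π : HasdΣScott M β → HasΠScott M (osuc λ′)
    dΣ⇒Π (φ , ψ , σ , qf q , scott) = ⊥-elim (QF-closed q)
    dΣ⇒Π (φ , ψ , σ , conj f b , scott) = ⋀ both , conj both blocks ,
        λ N → mk⇔ (λ s → Equivalence.to (scott N) (s 0 , s ∘ suc))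
                  (λ i → λ { zero → proj₁ (Equivalence.from (scott N) i) ; (suc n) → proj₂ (Equivalence.from (scott N) i) n })
      where
      both : ℕ → Form 0
      both zero = φ
      both (suc i) = f i
      blocks : ∀ i → AllBlock (osuc λ′) (both i)
      blocks zero = base {β = β} β≤ σ
      blocks (suc i) = AllBlock-mono (≤ₒ-step β λ′ β≤) (b i)

  open ScottFormulas M (Elem-coding (world divisibility)) (R? (world divisibility))

  has-Σ : HasΣScott M (osuc λ′)
  -- The quantified element plays the part of `origin`. The clauses for all `g` share one
  -- conjunction: each has complexity below λ, though no common bound below λ is at hand.
  has-Σ = ⋁ (λ _ → ex (⋀ clause)) ,
      disj _ (λ _ → step (base {β = λ′} (≤ₒ-refl λ′) (conj clause λ t →
        AllBlock-mono (<⇒≤ₒ (double (rank (proj₁ (unpair t)))) λ′ (double-level<λ (proj₁ (unpair t))))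
          (conjunct-AllBlock (rank (proj₁ (unpair t))) (origin ∷ []) (proj₂ (unpair t)))))) ,
      λ N → mk⇔ (λ (_ , b , s) → reflect N b s) (realise N)
    where
    rank : ℕ → Ord
    -- This is `level 3 g`: one round for finding an image or a preimage, two for `compare`.
    rank g = pad 4 (sucs 4 (q g))
    clause : ℕ → Form 1
    clause t = conjunct (rank (proj₁ (unpair t))) (origin ∷ []) (proj₂ (unpair t))
    reflect : ∀ N b → (∀ t → Sat N (clause t) (b ∷ [])) → N ≅ M
    reflect N b s = Extraction.extract N trees divisibility group (λ n m → ℕₚ.m⊓n≤n (proj₁ (unpair m)) n) q visible≤q b λ g →
      conjuncts⇒Bf N (rank g) (b ∷ []) (origin ∷ []) λ t →
        subst (λ x → Sat N (conjunct (rank (proj₁ x)) (origin ∷ []) (proj₂ x)) (b ∷ [])) (unpair-pair g t) (s (pair g t))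
    realise : ∀ N → N ≅ M → N ⊨ ⋁ (λ _ → ex (⋀ clause))
    realise N i = 0 , Inverse.from (proj₁ i) origin , λ t →
      Bf⇒conjuncts N (rank (proj₁ (unpair t))) (Inverse.from (proj₁ i) origin ∷ []) (origin ∷ [])
        (Bf-iso N M i (rank (proj₁ (unpair t))) _ (Inverse.strictlyInverseˡ (proj₁ i) origin ∷ [])) (proj₂ (unpair t))

theorem1p3 : (λ' : Ord) → IsLimit λ' →
    Σ Str λ M → IsLinearOrder M × ScottComplexityΣ M (osuc λ')
theorem1p3 λ' limit = M , structure-linear (world divisibility) , has-Σ , no-Π ,
    λ β β≤ → no-Π ∘ Σ⇒Π {β} β≤ , no-Π ∘ Π⇒Π {β} β≤ , no-Π ∘ dΣ⇒Π {β} β≤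
  where
  open Complexity λ' limit
  open Diagonal λ' limit using (M; world)
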